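{- Let $s,t\geq 1$ be integers and let $p,q,l$ be three distinct primes with $p,q$ odd, $p\equiv 3 \pmod 4$, $\mathrm{ord}_{p^s}(l)=\phi(p^s)/2$, $\mathrm{ord}_{q^t}(l)=\phi(q^t)$ and $\gcd(\phi(p^s),\phi(q^t))=2$. Suppose that $q$ is a quadratic residue modulo $p$. Then the primitive idempotents $\theta_{ij},\theta_{ij}^*$ of $\mathbb{F}_l[x]/\langle x^{p^sq^t}-1\rangle$ are given as follows. (i) For $i=0$ and $j=t$, \[\theta_{0t}=\frac{1}{pq^t}\Big(\frac{p-1}{2}\sum_{0\leq m\leq t}\chi_{sm}+\mathscr{N}\sum_{0\leq m\leq t}\chi_{s-1,m}+\mathscr{R}\sum_{0\leq m\leq t}\chi_{s-1,m}^*\Big),\] \[\theta_{0t}^*=\frac{1}{pq^t}\Big(\frac{p-1}{2}\sum_{0\leq m\leq t}\chi_{sm}+\mathscr{R}\sum_{0\leq m\leq t}\chi_{s-1,m}+\mathscr{N}\sum_{0\leq m\leq t}\chi_{s-1,m}^*\Big).\] (ii) For $i=0$ and $0\leq j\leq t-1$, \[\begin{aligned} \theta_{0j}=\frac{1}{pq^{j+1}}\Big(&\frac{p-1}{2}(q-1)\sum_{t-j\leq m\leq t}\chi_{sm} +(q-1)\Big(\mathscr{N}\sum_{t-j\leq m\leq t}\chi_{s-1,m}+\mathscr{R}\sum_{t-j\leq m\leq t}\chi_{s-1,m}^*\Big)\\ &-\big(\mathscr{N}\chi_{s-1,t-j-1}+\mathscr{R}\chi_{s-1,t-j-1}^*\big)-\frac{p-1}{2}\chi_{s,t-j-1}\Big),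 \end{aligned}\] \[\begin{aligned} \theta_{0j}^*=\frac{1}{pq^{j+1}}\Big(&\frac{p-1}{2}(q-1)\sum_{t-j\leq m\leq t}\chi_{sm} +(q-1)\Big(\mathscr{R}\sum_{t-j\leq m\leq t}\chi_{s-1,m}+\mathscr{N}\sum_{t-j\leq m\leq t}\chi_{s-1,m}^*\Big)\\ &-\big(\mathscr{R}\chi_{s-1,t-j-1}+\mathscr{N}\chi_{s-1,t-j-1}^*\big)-\frac{p-1}{2}\chi_{s,t-j-1}\Big). \end{aligned}\] (iii) For $1\leq i\leq s-1$ and $0\leq j\leq t-1$, \[\begin{aligned} \theta_{ij}=\frac{1}{p^{i+1}q^{j+1}}\Big(&\frac{p-1}{2}(q-1)\Big(\sum_{\substack{s-i\leq k\leq s-1\\t-j\leq m\leq t}}(\chi_{km}+\chi_{km}^*)+\sum_{t-j\leq m\leq t}\chi_{sm}\Big)\\ &+(q-1)\Big(\mathscr{N}\sum_{t-j\leq m\leq t}\chi_{s-i-1,m}+\mathscr{R}\sum_{t-j\leq m\leq t}\chi_{s-i-1,m}^*\Big)\\ &-\big(\mathscr{N}\chi_{s-i-1,t-j-1}+\mathscr{R}\chi_{s-i-1,t-j-1}^*\big)\\ &-\frac{p-1}{2}\big(\chi_{s-i,t-j-1}+\chi_{s-i,t-j-1}^*\big)\Big), \end{aligned}\] \[\begin{aligned} \theta_{ij}^*=\frac{1}{p^{i+1}q^{j+1}}\Big(&\frac{p-1}{2}(q-1)\Big(\sum_{\substack{s-i\leq k\leq s-1\\t-j\leq m\leq t}}(\chi_{km}+\chi_{km}^*)+\sum_{t-j\leq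 m\leq t}\chi_{sm}\Big)\\ &+(q-1)\Big(\mathscr{R}\sum_{t-j\leq m\leq t}\chi_{s-i-1,m}+\mathscr{N}\sum_{t-j\leq m\leq t}\chi_{s-i-1,m}^*\Big)\\ &-\big(\mathscr{R}\chi_{s-i-1,t-j-1}+\mathscr{N}\chi_{s-i-1,t-j-1}^*\big)\\ &-\frac{p-1}{2}\big(\chi_{s-i,t-j-1}+\chi_{s-i,t-j-1}^*\big)\Big). \end{aligned}\] (iv) For $1\leq i\leq s-1$ and $j=t$, \[\begin{aligned} \theta_{it}=\frac{1}{p^{i+1}q^t}\Big(&\frac{p-1}{2}\sum_{\substack{s-i\leq k\leq s-1\\ 0\leq m\leq t}}(\chi_{km}+\chi_{km}^*)+\frac{p-1}{2}\sum_{0\leq m\leq t}\chi_{sm}\\&+\mathscr{N}\sum_{0\leq m\leq t}\chi_{s-i-1,m}+\mathscr{R}\sum_{0\leq m\leq t}\chi_{s-i-1,m}^*\Big), \end{aligned}\] \[\begin{aligned} \theta_{it}^*=\frac{1}{p^{i+1}q^t}\Big(&\frac{p-1}{2}\sum_{\substack{s-i\leq k\leq s-1\\ 0\leq m\leq t}}(\chi_{km}+\chi_{km}^*)+\frac{p-1}{2}\sum_{0\leq m\leq t}\chi_{sm}\\&+\mathscr{R}\sum_{0\leq m\leq t}\chi_{s-i-1,m}+\mathscr{N}\sum_{0\leq m\leq t}\chi_{s-i-1,m}^*\Big). \end{aligned}\] (v) For $i=s$ and $0\leq j\leq t-1$, \[\begin{aligned} \theta_{sj}=\frac{1}{p^sq^{j+1}}\Big(&(q-1)\Big(\sum_{\substack{0\leq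 k\leq s-1\\t-j\leq m\leq t}}(\chi_{km}+\chi_{km}^*)+\sum_{t-j\leq m\leq t}\chi_{sm}\Big)\\ &-\Big(\sum_{0\leq k\leq s-1}(\chi_{k,t-j-1}+\chi_{k,t-j-1}^*)+\chi_{s,t-j-1}\Big)\Big). \end{aligned}\] (vi) For $i=s$ and $j=t$, \[\theta_{st}=\frac{1}{p^sq^t}\Big(\sum_{\substack{0\leq k\leq s-1\\0\leq m\leq t}}(\chi_{km}+\chi_{km}^*)+\sum_{0\leq m\leq t}\chi_{sm}\Big)=\frac{1}{p^sq^t}\sum_{0\leq u< p^sq^t}x^u.\]
   Context: Here $\phi$ is Euler's phi function (with $\phi(1)=1$) and $\mathrm{ord}_m(k)$ is the multiplicative order of $k$ modulo $m$. Put $n=p^sq^t$. Fix an integer $g$ that is a primitive root both modulo $p^s$ and modulo $q^t$. For an integer $\gamma$, $C_\gamma=\{\gamma l^r \bmod n: r\geq 0\}\subseteq \mathbb{Z}_n$ is the $l$-cyclotomic coset modulo $n$ containing $\gamma$. For $0\leq i\leq s$, $0\leq j\leq t$ set $C_{ij}=C_{p^iq^j}$ and $C_{ij}^*=C_{p^iq^jg}$; in particular $C_{sj}=C_{sj}^*$ and $C_{st}=C_0=\{0\}$. Define elements of $\mathbb{F}_l[x]/\langle x^{n}-1\rangle$ by $\chi_{ij}=\sum_{a\in C_{ij}}x^a$ and $\chi_{ij}^*=\sum_{a\in C_{ij}^*}x^a$; in particular $\chi_{sj}=\chi_{sj}^*$ and $\chi_{st}=1$. Let $\alpha$ be a fixed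 primitive $n$-th root of unity in some extension field of $\mathbb{F}_l$. For an integer $\gamma$ let $M_\gamma(x)=\prod_{u\in C_\gamma}(x-\alpha^u)$, the minimal polynomial of $\alpha^\gamma$ over $\mathbb{F}_l$, and let $\theta_\gamma(x)$ be the primitive idempotent of the minimal ideal of $\mathbb{F}_l[x]/\langle x^n-1\rangle$ generated by $(x^n-1)/M_\gamma(x)$; that is, $\theta_\gamma(\alpha^u)=1$ if $u\in C_\gamma$ and $\theta_\gamma(\alpha^u)=0$ if $u\notin C_\gamma$. Set $\theta_{ij}=\theta_{p^iq^j}$ and $\theta_{ij}^*=\theta_{p^iq^jg}$; in particular $\theta_{sj}=\theta_{sj}^*$ and $\theta_{st}=\theta_0$. Let $\beta=\alpha^{p^{s-1}q^t}$, a primitive $p$-th root of unity, let $R_1$ and $N_1$ be the sets of quadratic residues and quadratic nonresidues in $\mathbb{Z}_p^*$, and put $\mathscr{R}=\sum_{x\in R_1}\beta^x$ and $\mathscr{N}=\sum_{x\in N_1}\beta^x$. These are elements of $\mathbb{F}_l$, the two roots of $x^2+x+\frac{p+1}{4}=0$: for $l=2$ one takes, without loss of generality, $\mathscr{R}=1$ and $\mathscr{N}=0$, and for $l$ odd $\mathscr{R}=\frac{ -1+\delta}{2}$, $\mathscr{N}=\frac{ -1-\delta}{2}$ for some $\delta\in\mathbb{F}_l$ with $\delta^2=-p$. Integers and their inverses appearing as coefficients are read in $\mathbb{F}_l$.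
   Formalization: In (iii) the last summand is corrected, for both θ_ij and θ*_ij, to −(p−1)/2·(Σ_{s−i≤k≤s−1}(χ_{k,t−j−1}+χ*_{k,t−j−1})+χ_{s,t−j−1}); as printed it is false, e.g. p=7, q=11, l=2, s=2, t=1, i=1, j=0. -}

module Defs where

open import Algebra.Bundles using (CommutativeRing)
open import Algebra.Definitions using (Invertible)
open import Algebra.Morphism.Structures using (module RingMorphisms)
import Algebra.Properties.Semiring.Exp as SemiringExp
open import Data.Fin.Base as Fin using (Fin; toℕ)
import Data.Fin.Properties as Fin
open import Data.Integer.Base as ℤ using (ℤ; +_; 0ℤ; 1ℤ)
open import Data.Integer.DivMod using (_%ℕ_; _/ℕ_; a≡a%ℕn+[a/ℕn]*n; n%ℕd<d)
import Data.Integer.Divisibility.Signed as ℤ∣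
import Data.Integer.Properties as ℤ
open import Data.Integer.Tactic.RingSolver using (solve-∀)
open import Data.List.Base using (List; []; _∷_; map; foldr; filter; upTo; length)
open import Data.List.Membership.Propositional using (_∈_)
open import Data.List.Membership.Propositional.Properties using (∈-filter⁺; ∈-filter⁻; ∈-upTo⁺)
open import Data.Nat.Base as ℕ using (ℕ; zero; suc; NonZero)
open import Data.Nat.Coprimality using (Coprime; coprime?; coprime⇒gcd≡1)
open import Data.Nat.DivMod using (_/_)
open import Data.Nat.GCD using (module Bézout; gcd; gcd-GCD)
open import Data.Nat.Induction using (<-rec)
import Data.Nat.Properties as ℕ
open import Data.Product.Base using (∃; _×_; _,_)
open import Data.Sum.Base using (_⊎_; inj₁; inj₂)
open import Function.Bundles using (_⇔_; mk⇔)
open import Level using (Level; _⊔_) renaming (suc to lsuc)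
open import Relation.Binary.PropositionalEquality
open import Relation.Nullary using (¬_; Dec; yes; no)
open import Relation.Nullary.Decidable using (map′; _×-dec_; ¬?)

------------------------------------------------------------------------
-- Integers modulo m

infix 4 _≡_[mod_]

record _≡_[mod_] (a b : ℤ) (m : ℕ) : Set where
  constructor divides-difference
  field
    difference : (+ m) ℤ∣.∣ (a ℤ.- b)

open _≡_[mod_] public

_≡?_[mod_] : ∀ a b m → Dec (a ≡ b [mod m ])
a ≡? b [mod m ] = map′ divides-difference difference (+ m ℤ∣.∣? (a ℤ.- b))

module _ {m : ℕ} where

  private
    by : ∀ {x y} → x ≡ y → (+ m) ℤ∣.∣ x → (+ m) ℤ∣.∣ y
    by = subst ((+ m) ℤ∣.∣_)

  mod-reflexive : ∀ {a b} → a ≡ b → a ≡ b [mod m ]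
  mod-reflexive {a} refl = divides-difference
    (ℤ∣.divides 0ℤ (trans (ℤ.+-inverseʳ a) (sym (ℤ.*-zeroˡ (+ m)))))

  mod-sym : ∀ {a b} → a ≡ b [mod m ] → b ≡ a [mod m ]
  mod-sym {a} {b} (divides-difference d) =
    divides-difference (by (lem a b) (ℤ∣.∣m⇒∣-m d))
    where
    lem : ∀ a b → ℤ.- (a ℤ.- b) ≡ b ℤ.- a
    lem = solve-∀

  mod-trans : ∀ {a b c} → a ≡ b [mod m ] → b ≡ c [mod m ] → a ≡ c [mod m ]
  mod-trans {a} {b} {c} (divides-difference d) (divides-difference e) =
    divides-difference (by (lem a b c) (ℤ∣.∣m∣n⇒∣m+n d e))
    where
    lem : ∀ a b c → (a ℤ.- b) ℤ.+ (b ℤ.- c) ≡ a ℤ.- c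
    lem = solve-∀

  mod-+-cong : ∀ {a b c d} → a ≡ b [mod m ] → c ≡ d [mod m ] →
               a ℤ.+ c ≡ b ℤ.+ d [mod m ]
  mod-+-cong {a} {b} {c} {d} (divides-difference x) (divides-difference y) =
    divides-difference (by (lem a b c d) (ℤ∣.∣m∣n⇒∣m+n x y))
    where
    lem : ∀ a b c d → (a ℤ.- b) ℤ.+ (c ℤ.- d) ≡ (a ℤ.+ c) ℤ.- (b ℤ.+ d)
    lem = solve-∀

  mod-*-cong : ∀ {a b c d} → a ≡ b [mod m ] → c ≡ d [mod m ] →
               a ℤ.* c ≡ b ℤ.* d [mod m ]
  mod-*-cong {a} {b} {c} {d} (divides-difference x) (divides-difference y) =
    divides-difference (by (lem a b c d)
      (ℤ∣.∣m∣n⇒∣m+n (ℤ∣.∣n⇒∣m*n c x) (ℤ∣.∣n⇒∣m*n b y)))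
    where
    lem : ∀ a b c d → c ℤ.* (a ℤ.- b) ℤ.+ b ℤ.* (c ℤ.- d) ≡ a ℤ.* c ℤ.- b ℤ.* d
    lem = solve-∀

  mod-neg-cong : ∀ {a b} → a ≡ b [mod m ] → ℤ.- a ≡ ℤ.- b [mod m ]
  mod-neg-cong {a} {b} (divides-difference d) =
    divides-difference (by (lem a b) (ℤ∣.∣m⇒∣-m d))
    where
    lem : ∀ a b → ℤ.- (a ℤ.- b) ≡ ℤ.- a ℤ.- (ℤ.- b)
    lem = solve-∀

ℤ/ : ℕ → CommutativeRing _ _
ℤ/ m = record
  { Carrier = ℤ ; _≈_ = _≡_[mod m ] ; _+_ = ℤ._+_ ; _*_ = ℤ._*_ ; -_ = ℤ.-_
  ; 0# = 0ℤ ; 1# = 1ℤ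
  ; isCommutativeRing = record
    { isRing = record
      { +-isAbelianGroup = record
        { isGroup = record
          { isMonoid = record
            { isSemigroup = record
              { isMagma = record
                { isEquivalence = record
                  { refl = mod-reflexive refl ; sym = mod-sym ; trans = mod-trans }
                ; ∙-cong = mod-+-cong }
              ; assoc = λ x y z → mod-reflexive (ℤ.+-assoc x y z) }
            ; identity = (λ x → mod-reflexive (ℤ.+-identityˡ x))
                       , (λ x → mod-reflexive (ℤ.+-identityʳ x)) }
          ; inverse = (λ x → mod-reflexive (ℤ.+-inverseˡ x))
                    , (λ x → mod-reflexive (ℤ.+-inverseʳ x))
          ; ⁻¹-cong = mod-neg-cong }
        ; comm = λ x y → mod-reflexive (ℤ.+-comm x y) }
      ; *-cong = mod-*-cong
      ; *-assoc = λ x y z → mod-reflexive (ℤ.*-assoc x y z)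
      ; *-identity = (λ x → mod-reflexive (ℤ.*-identityˡ x))
                   , (λ x → mod-reflexive (ℤ.*-identityʳ x))
      ; distrib = (λ x y z → mod-reflexive (ℤ.*-distribˡ-+ x y z))
                , (λ x y z → mod-reflexive (ℤ.*-distribʳ-+ x y z)) }
    ; *-comm = λ x y → mod-reflexive (ℤ.*-comm x y) } }

-- 1/d in ℤ/m, read off from a Bézout identity; meaningful only for d
-- coprime to m, see recip-inverse.
recip : (m d : ℕ) → ℤ
recip m d with Bézout.identity (gcd-GCD d m)
... | Bézout.+- x y _ = + x
... | Bézout.-+ x y _ = ℤ.- (+ x)

recip-inverse : ∀ m d → Coprime d m → recip m d ℤ.* (+ d) ≡ 1ℤ [mod m ]
recip-inverse m d c
  with Bézout.identity (gcd-GCD d m) | coprime⇒gcd≡1 c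
... | Bézout.+- x y eq | g =
  divides-difference (ℤ∣.divides (+ y) (trans (cong (ℤ._- 1ℤ) (sym z)) (lem (+ y ℤ.* + m))))
  where
  z : 1ℤ ℤ.+ (+ y ℤ.* + m) ≡ + x ℤ.* + d
  z = trans (cong (λ w → 1ℤ ℤ.+ w) (sym (ℤ.pos-* y m)))
            (trans (cong +_ (subst (λ k → k ℕ.+ y ℕ.* m ≡ x ℕ.* d) g eq)) (ℤ.pos-* x d))
  lem : ∀ a → (1ℤ ℤ.+ a) ℤ.- 1ℤ ≡ a
  lem = solve-∀
... | Bézout.-+ x y eq | g =
  divides-difference (ℤ∣.divides (ℤ.- (+ y))
    (trans (lem (+ x) (+ d)) (trans (cong ℤ.-_ z) (ℤ.neg-distribˡ-* (+ y) (+ m)))))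
  where
  z : 1ℤ ℤ.+ (+ x ℤ.* + d) ≡ + y ℤ.* + m
  z = trans (cong (λ w → 1ℤ ℤ.+ w) (sym (ℤ.pos-* x d)))
            (trans (cong +_ (subst (λ k → k ℕ.+ x ℕ.* d ≡ y ℕ.* m) g eq)) (ℤ.pos-* y m))
  lem : ∀ a b → (ℤ.- a) ℤ.* b ℤ.- 1ℤ ≡ ℤ.- (1ℤ ℤ.+ a ℤ.* b)
  lem = solve-∀

φ : ℕ → ℕ
φ m = length (filter (λ a → coprime? a m) (upTo m))

record HasOrder (m : ℕ) (k : ℤ) (d : ℕ) : Set where
  field
    positive : 0 ℕ.< d
    power    : k ℤ.^ d ≡ 1ℤ [mod m ]
    minimal  : ∀ e → 0 ℕ.< e → e ℕ.< d → ¬ (k ℤ.^ e ≡ 1ℤ [mod m ])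

IsPrimitiveRoot : ℕ → ℤ → Set
IsPrimitiveRoot m g = HasOrder m g (φ m)

IsQuadraticResidue : ℕ → ℤ → Set
IsQuadraticResidue p a =
  ¬ (a ≡ 0ℤ [mod p ]) × ∃ λ (x : Fin p) → (+ toℕ x) ℤ.^ 2 ≡ a [mod p ]

IsQuadraticNonresidue : ℕ → ℤ → Set
IsQuadraticNonresidue p a =
  ¬ (a ≡ 0ℤ [mod p ]) × ¬ (∃ λ (x : Fin p) → (+ toℕ x) ℤ.^ 2 ≡ a [mod p ])

square? : ∀ p a → Dec (∃ λ (x : Fin p) → (+ toℕ x) ℤ.^ 2 ≡ a [mod p ])
square? p a = Fin.any? (λ x → ((+ toℕ x) ℤ.^ 2) ≡? a [mod p ])

residues nonresidues : ℕ → List ℕ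
residues p =
  filter (λ a → ¬? ((+ a) ≡? 0ℤ [mod p ]) ×-dec square? p (+ a)) (upTo p)
nonresidues p =
  filter (λ a → ¬? ((+ a) ≡? 0ℤ [mod p ]) ×-dec ¬? (square? p (+ a))) (upTo p)

------------------------------------------------------------------------
-- Cyclotomic cosets

module Cosets (l n : ℕ) where

  -- The residue class of u lies in C_γ.
  _∈C_ : ℕ → ℤ → Set
  u ∈C γ = ∃ λ r → (+ u) ≡ γ ℤ.* (+ l) ℤ.^ r [mod n ]

  -- The representatives of C_γ in {0,…,n-1}.  The n exponents r < n
  -- already produce every element, see ∈-coset.
  coset : ℤ → List ℕ
  coset γ = filter
    (λ u → ℕ.anyUpTo? (λ r → (+ u) ≡? (γ ℤ.* (+ l) ℤ.^ r) [mod n ]) n) (upTo n)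

  private
    small : .{{_ : NonZero n}} → ∀ γ r →
      ∃ λ r′ → r′ ℕ.< n × γ ℤ.* (+ l) ℤ.^ r ≡ γ ℤ.* (+ l) ℤ.^ r′ [mod n ]
    small γ = <-rec _ step
      where
      f : Fin (suc n) → Fin n
      f i = Fin.fromℕ< (n%ℕd<d (γ ℤ.* (+ l) ℤ.^ toℕ i) n)

      mod-% : ∀ a → a ≡ + (a %ℕ n) [mod n ]
      mod-% a = divides-difference (ℤ∣.divides (a /ℕ n)
        (trans (cong (ℤ._- + (a %ℕ n)) (a≡a%ℕn+[a/ℕn]*n a n))
               (lem (+ (a %ℕ n)) ((a /ℕ n) ℤ.* + n))))
        where
        lem : ∀ x y → (x ℤ.+ y) ℤ.- x ≡ y
        lem = solve-∀

      from-f : ∀ {i j} → f i ≡ f j →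
        γ ℤ.* (+ l) ℤ.^ toℕ i ≡ γ ℤ.* (+ l) ℤ.^ toℕ j [mod n ]
      from-f {i} {j} eq = mod-trans (mod-% _)
        (mod-trans (mod-reflexive (cong +_ eq′)) (mod-sym (mod-% _)))
        where
        eq′ = trans (sym (Fin.toℕ-fromℕ< _)) (trans (cong toℕ eq) (Fin.toℕ-fromℕ< _))

      step : ∀ r → (∀ {y} → y ℕ.< r →
          ∃ λ r′ → r′ ℕ.< n × γ ℤ.* (+ l) ℤ.^ y ≡ γ ℤ.* (+ l) ℤ.^ r′ [mod n ]) →
        ∃ λ r′ → r′ ℕ.< n × γ ℤ.* (+ l) ℤ.^ r ≡ γ ℤ.* (+ l) ℤ.^ r′ [mod n ]
      step r rec with r ℕ.<? n
      ... | yes r<n = r , r<n , mod-reflexive refl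
      ... | no  r≮n with Fin.pigeonhole (ℕ.n<1+n n) f
      ... | i , j , i<j , eq with rec smaller
        where
        j≤r : toℕ j ℕ.≤ r
        j≤r = ℕ.≤-trans (ℕ.≤-pred (Fin.toℕ<n j)) (ℕ.≮⇒≥ r≮n)
        smaller : toℕ i ℕ.+ (r ℕ.∸ toℕ j) ℕ.< r
        smaller = subst (toℕ i ℕ.+ (r ℕ.∸ toℕ j) ℕ.<_) (ℕ.m+[n∸m]≡n j≤r)
          (ℕ.+-monoˡ-< (r ℕ.∸ toℕ j) i<j)
      ... | r′ , r′<n , e = r′ , r′<n , mod-trans shift e
        where
        d = r ℕ.∸ toℕ j
        j≤r : toℕ j ℕ.≤ r
        j≤r = ℕ.≤-trans (ℕ.≤-pred (Fin.toℕ<n j)) (ℕ.≮⇒≥ r≮n)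
        split : ∀ k → γ ℤ.* (+ l) ℤ.^ (k ℕ.+ d) ≡ (γ ℤ.* (+ l) ℤ.^ k) ℤ.* (+ l) ℤ.^ d
        split k = trans (cong (γ ℤ.*_) (ℤ.^-distribˡ-+-* (+ l) k d))
          (sym (ℤ.*-assoc γ ((+ l) ℤ.^ k) ((+ l) ℤ.^ d)))
        shift : γ ℤ.* (+ l) ℤ.^ r ≡ γ ℤ.* (+ l) ℤ.^ (toℕ i ℕ.+ d) [mod n ]
        shift = mod-trans
          (mod-reflexive (trans (cong (λ k → γ ℤ.* (+ l) ℤ.^ k) (sym (ℕ.m+[n∸m]≡n j≤r)))
                                (split (toℕ j))))
          (mod-trans (mod-*-cong (mod-sym (from-f {i} {j} eq)) (mod-reflexive refl))
                     (mod-reflexive (sym (split (toℕ i)))))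

  ∈-coset : .{{_ : NonZero n}} → ∀ γ {u} → u ℕ.< n → u ∈ coset γ ⇔ u ∈C γ
  ∈-coset γ {u} u<n = mk⇔ to from
    where
    to : u ∈ coset γ → u ∈C γ
    to u∈ with ∈-filter⁻ _ {xs = upTo n} u∈
    ... | _ , r , _ , e = r , e
    from : u ∈C γ → u ∈ coset γ
    from (r , e) with small γ r
    ... | r′ , r′<n , e′ = ∈-filter⁺ _ (∈-upTo⁺ u<n) (r′ , r′<n , mod-trans e e′)

------------------------------------------------------------------------
-- Polynomials, as lists of coefficients in order of increasing degree

infix 5 _⋯_
_⋯_ : ℕ → ℕ → List ℕ
a ⋯ b = map (a ℕ.+_) (upTo (suc b ℕ.∸ a))

module Polynomial {c ℓ} (R : CommutativeRing c ℓ) where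
  open CommutativeRing R

  infixl 6 _⊕_ _⊖_
  infixl 7 _⊗_
  infixr 7 _∙_
  infix  4 _≋_

  Poly : Set c
  Poly = List Carrier

  coeff : Poly → ℕ → Carrier
  coeff []      _       = 0#
  coeff (a ∷ f) zero    = a
  coeff (a ∷ f) (suc k) = coeff f k

  -- Trailing zeros are not significant.
  _≋_ : Poly → Poly → Set ℓ
  f ≋ g = ∀ k → coeff f k ≈ coeff g k

  _∙_ : Carrier → Poly → Poly
  a ∙ f = map (a *_) f

  _⊕_ : Poly → Poly → Poly
  []      ⊕ g       = g
  (a ∷ f) ⊕ []      = a ∷ f
  (a ∷ f) ⊕ (b ∷ g) = (a + b) ∷ (f ⊕ g)

  _⊖_ : Poly → Poly → Poly
  f ⊖ g = f ⊕ map -_ g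

  _⊗_ : Poly → Poly → Poly
  []      ⊗ g = []
  (a ∷ f) ⊗ g = (a ∙ g) ⊕ (0# ∷ (f ⊗ g))

  𝟙 : Poly
  𝟙 = 1# ∷ []

  X^_ : ℕ → Poly
  X^ zero  = 𝟙
  X^ suc k = 0# ∷ X^ k

  eval : Poly → Carrier → Carrier
  eval f x = foldr (λ a y → a + x * y) 0# f

  ∑ : List ℕ → (ℕ → Poly) → Poly
  ∑ ks f = foldr (λ k g → f k ⊕ g) [] ks

  ∏ : List ℕ → (ℕ → Poly) → Poly
  ∏ ks f = foldr (λ k g → f k ⊗ g) 𝟙 ks

  infix 10 ∑-syntax
  ∑-syntax : List ℕ → (ℕ → Poly) → Poly
  ∑-syntax = ∑

  syntax ∑-syntax ks (λ k → f) = ∑[ k ∈ ks ] f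

------------------------------------------------------------------------
-- Extension fields of 𝔽_l

-- The classical notion of field: being zero is decidable.
record IsField {c ℓ} (R : CommutativeRing c ℓ) : Set (c ⊔ ℓ) where
  open CommutativeRing R
  field
    0≉1       : ¬ (0# ≈ 1#)
    zero⊎unit : ∀ x → x ≈ 0# ⊎ Invertible _≈_ 1# _*_ x

record ExtensionField (l : ℕ) (c ℓ : Level) : Set (lsuc (c ⊔ ℓ)) where
  field
    commutativeRing : CommutativeRing c ℓ
    isField         : IsField commutativeRing
  open CommutativeRing commutativeRing public
  open SemiringExp semiring public using (_^_)
  field
    ι     : ℤ → Carrier
    ι-hom : RingMorphisms.IsRingHomomorphism
                (CommutativeRing.rawRing (ℤ/ l)) rawRing ι

------------------------------------------------------------------------
-- The algebra 𝔽_l[x]/⟨xⁿ − 1⟩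

module CyclicAlgebra (l n : ℕ) where
  open Polynomial (ℤ/ l) public
  open Cosets l n public

  X^n-1 : Poly
  X^n-1 = X^ n ⊖ 𝟙

  infix 4 _≃_ _∈⟨_⟩

  -- Equality in the quotient.
  _≃_ : Poly → Poly → Set
  f ≃ g = ∃ λ h → f ≋ g ⊕ h ⊗ X^n-1

  -- Membership in a principal ideal of the quotient.
  _∈⟨_⟩ : Poly → Poly → Set
  f ∈⟨ h ⟩ = ∃ λ a → f ≃ a ⊗ h

  cosetSum : ℤ → Poly
  cosetSum γ = ∑[ a ∈ coset γ ] (X^ a)

  module _ {c ℓ} (K : ExtensionField l c ℓ) where
    private
      module K = ExtensionField K
      module K[x] = Polynomial K.commutativeRing

    IsPrimitiveRootOfUnity : K.Carrier → Set ℓ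
    IsPrimitiveRootOfUnity α =
      α K.^ n K.≈ K.1# × (∀ m → 0 ℕ.< m → m ℕ.< n → ¬ (α K.^ m K.≈ K.1#))

    powerSum : K.Carrier → List ℕ → K.Carrier
    powerSum β ks = foldr (λ k y → β K.^ k K.+ y) K.0# ks

    evalAt : Poly → K.Carrier → K.Carrier
    evalAt f x = K[x].eval (map K.ι f) x

    module _ (α : K.Carrier) where

      -- M_γ and (xⁿ − 1)/M_γ.
      record MinimalPolynomial (γ : ℤ) : Set ℓ where
        field
          M             : Poly
          M≋∏           : map K.ι M K[x].≋
                          K[x].∏ (coset γ) (λ u → (K.- (α K.^ u)) ∷ K.1# ∷ [])
          cofactor      : Poly
          cofactor⊗M≋ : cofactor ⊗ M ≋ X^n-1

      record IsPrimitiveIdempotent {γ} (m : MinimalPolynomial γ) (e : Poly) : Set ℓ where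
        field
          idempotent : e ⊗ e ≃ e
          generates  : ∀ f → f ∈⟨ e ⟩ ⇔ f ∈⟨ MinimalPolynomial.cofactor m ⟩
          one-on-C   : ∀ u → u ∈C γ → evalAt e (α K.^ u) K.≈ K.1#
          zero-off-C : ∀ u → ¬ (u ∈C γ) → evalAt e (α K.^ u) K.≈ K.0#

module Idempotents (p q s t l : ℕ) (g : ℤ) where
  open CyclicAlgebra l (p ℕ.^ s ℕ.* q ℕ.^ t) public

  γ γ* : ℕ → ℕ → ℤ
  γ  i j = + (p ℕ.^ i ℕ.* q ℕ.^ j)
  γ* i j = γ i j ℤ.* g

  χ χ* : ℕ → ℕ → Poly
  χ  i j = cosetSum (γ  i j)
  χ* i j = cosetSum (γ* i j)

  module Theta {c ℓ} (K : ExtensionField l c ℓ) (α : ExtensionField.Carrier K)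
               (m : ∀ δ → MinimalPolynomial K α δ) where

    infix 3 θ[_,_]≐_ θ*[_,_]≐_

    -- θ_ij is the element of the quotient singled out by
    -- IsPrimitiveIdempotent; that it equals f says that f, and up to
    -- equality in the quotient only f, has this property.
    θ[_,_]≐_ θ*[_,_]≐_ : ℕ → ℕ → Poly → Set ℓ
    θ[ i , j ]≐ f = ∀ e → IsPrimitiveIdempotent K α (m (γ i j)) e ⇔ e ≃ f
    θ*[ i , j ]≐ f = ∀ e → IsPrimitiveIdempotent K α (m (γ* i j)) e ⇔ e ≃ f

-- Write n = p^s q^t.  An element of F_l[x]/⟨xⁿ - 1⟩ is determined by its values at the powers of α
-- (inverse discrete Fourier transform), so an idempotent is recognised by being 1 at the α^u with
-- u in the coset and 0 at the others.  Because φ(p^s)/2 is odd, ord_{p^s}(l) and ord_{q^t}(l) are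
-- coprime; hence C_{p^i q^j} and C_{p^i q^j g} consist of the u with q^j the exact q-part of u and
-- with u / p^i a quadratic residue, respectively a nonresidue, modulo p.
--
-- Thus the coefficient of x^k in a candidate is a product of a p-part and a q-part.  The q-part is
-- q [q^(t-j) ∣ k] - [q^(t-j-1) ∣ k], or 1 if j = t.  The p-part is 1 if i = s; otherwise, for
-- k = p^(s-i-1) a, it is Σ β^(x a) over the nonresidues x (the residues for θ*), and it vanishes for
-- the other k.  At α^u the candidate becomes a sum of geometric series over the multiples k of
-- p^(s-i-1) q^(t-j) and of p^(s-i-1) q^(t-j-1); each survives only if its ratio is 1, which leaves
-- the number of x with u + p^i q^t x = 0 modulo p^(i+1), combined with a condition on the q-part of
-- u.  As q is a residue and -1 is not, this is the indicator of the coset.  No value of the Gauss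
-- periods is needed.

module Submission where

open import Defs
open import Algebra.Bundles using (CommutativeRing)
open import Algebra.Morphism.Structures using (module RingMorphisms)
import Algebra.Properties.Ring as RingProperties
import Algebra.Properties.Semiring.Exp as SemiringExp
import Algebra.Solver.Ring as RingSolver
open import Algebra.Solver.Ring.AlmostCommutativeRing using (fromCommutativeRing; _-Raw-AlmostCommutative⟶_)
import Algebra.Solver.Ring.NaturalCoefficients.Default as NaturalSolver
open import Data.Empty using (⊥-elim)
open import Data.Fin.Base as Fin using (Fin; toℕ)
import Data.Fin.Properties as Fin
open import Data.Integer.Base as ℤ using (ℤ; +_; 0ℤ; 1ℤ; -1ℤ)
open import Data.Integer.DivMod using (_%ℕ_; _/ℕ_; a≡a%ℕn+[a/ℕn]*n; n%ℕd<d)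
import Data.Integer.Divisibility.Signed as ℤ∣
import Data.Integer.Properties as ℤ
open import Data.Integer.Tactic.RingSolver using (solve-∀)
open import Data.List.Base using (List; []; _∷_; _∷ʳ_; map; foldr; filter; upTo; length; lookup; take; drop)
open import Data.List.Membership.Propositional using (_∈_)
open import Data.List.Membership.Propositional.Properties using (∈-filter⁺; ∈-filter⁻; ∈-map⁻; ∈-upTo⁺; ∈-upTo⁻)
import Data.List.Properties as List
open import Data.List.Relation.Unary.Any using (here; there; index)
open import Data.List.Relation.Unary.Any.Properties using (lookup-index)
open import Data.Maybe.Base as Maybe using ()
open import Data.Nat.Base as ℕ using (ℕ; zero; suc; NonZero; s≤s; z≤n)
open import Data.Nat.Coprimality as Coprimality using (Coprime; coprime?; coprime-Bézout; coprime-divisor)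
open import Data.Nat.Divisibility as ℕ∣ using (_∣_; _∣?_; divides; m%n≡0⇒n∣m)
open import Data.Nat.DivMod as ℕ using (_/_; _%_; m%n<n; m≡m%n+[m/n]*n; m<n*o⇒m/o<n)
open import Data.Nat.GCD using (module Bézout; gcd; gcd-greatest)
open import Data.Nat.Primality using (Prime; prime[2]; euclidsLemma; prime⇒irreducible; prime⇒nonZero; prime⇒nonTrivial)
import Data.Nat.Properties as ℕ
import Data.Nat.Tactic.RingSolver as ℕSolver
open import Data.Product.Base using (∃; _×_; _,_; proj₁; proj₂)
open import Data.Sign.Base as Sign using (Sign; opposite) renaming (+ to plus; - to minus)
import Data.Sign.Properties as Sign
open import Data.Sum.Base using (_⊎_; inj₁; inj₂)
open import Function.Base using (_∘_)
open import Function.Bundles using (_⇔_; mk⇔; Equivalence)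
open import Relation.Binary.PropositionalEquality as ≡ using (_≡_; _≢_; module ≡-Reasoning)
open import Relation.Nullary using (¬_; Dec; yes; no)
open import Relation.Nullary.Decidable using (map′; _×-dec_; ¬?; _→-dec_; dec⇒maybe)
open import Relation.Unary using (Pred; Decidable)

-- Polynomials

-- The coefficients of a candidate lie in the field of `l` elements, yet they are described by
-- indicators and Gauss periods, which live in `K`. A polynomial is therefore linked to a `K`-valued
-- coefficient function only through its values at the powers of `α`, and every formula becomes
-- linear algebra with such functions. Whole rows and columns of coset sums occur in the formulas
-- because an indicator of an exact prime power part is a difference of two divisibility indicators,
-- so that sums over ranges telescope. The factor `q - 1` arises in the same way: q [q^(m+1) ∣ k] -
-- [q^m ∣ k] is q - 1 times the first indicator minus the indicator of exact part q^m. The scalar in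
-- front is the length of the surviving geometric series, p^(i+1) q^(j+1) after the two q-terms are
-- brought to a common factor. A congruence modulo p^s fixes the exponent of `l` only up to its
-- period, and likewise modulo q^t; coprime periods let one exponent serve both. The starred and
-- unstarred families differ by a sign, and one argument with that sign as parameter covers both.

module PolynomialProperties {c ℓ} (R : CommutativeRing c ℓ) where
  open CommutativeRing R
  open Polynomial R
  open RingProperties ring using (-0#≈0#)
  open NaturalSolver commutativeSemiring using (solve; _:+_; _:*_; _:=_; con)
  open import Relation.Binary.Reasoning.Setoid setoid

  coeff-⊕ : ∀ f g k → coeff (f ⊕ g) k ≈ coeff f k + coeff g k
  coeff-⊕ []      g       k       = sym (+-identityˡ _)
  coeff-⊕ (a ∷ f) []      k       = sym (+-identityʳ _)
  coeff-⊕ (a ∷ f) (b ∷ g) zero    = refl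
  coeff-⊕ (a ∷ f) (b ∷ g) (suc k) = coeff-⊕ f g k

  coeff-∙ : ∀ a f k → coeff (a ∙ f) k ≈ a * coeff f k
  coeff-∙ a []      k       = sym (zeroʳ a)
  coeff-∙ a (b ∷ f) zero    = refl
  coeff-∙ a (b ∷ f) (suc k) = coeff-∙ a f k

  coeff-neg : ∀ f k → coeff (map -_ f) k ≈ - coeff f k
  coeff-neg []      k       = sym -0#≈0#
  coeff-neg (b ∷ f) zero    = refl
  coeff-neg (b ∷ f) (suc k) = coeff-neg f k

  coeff-⊖ : ∀ f g k → coeff (f ⊖ g) k ≈ coeff f k - coeff g k
  coeff-⊖ f g k = trans (coeff-⊕ f (map -_ g) k) (+-congˡ (coeff-neg g k))

  ⊕-cong : ∀ f f′ g g′ → f ≋ f′ → g ≋ g′ → f ⊕ g ≋ f′ ⊕ g′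
  ⊕-cong f f′ g g′ p q k =
    trans (coeff-⊕ f g k) (trans (+-cong (p k) (q k)) (sym (coeff-⊕ f′ g′ k)))

  coeff-∷⊗-zero : ∀ a f g → coeff ((a ∷ f) ⊗ g) 0 ≈ a * coeff g 0
  coeff-∷⊗-zero a f g = begin
    coeff (a ∙ g ⊕ (0# ∷ f ⊗ g)) 0  ≈⟨ coeff-⊕ (a ∙ g) (0# ∷ f ⊗ g) 0 ⟩
    coeff (a ∙ g) 0 + 0#            ≈⟨ +-identityʳ _ ⟩
    coeff (a ∙ g) 0                 ≈⟨ coeff-∙ a g 0 ⟩
    a * coeff g 0                   ∎

  coeff-∷⊗-suc : ∀ a f g k →
    coeff ((a ∷ f) ⊗ g) (suc k) ≈ a * coeff g (suc k) + coeff (f ⊗ g) k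
  coeff-∷⊗-suc a f g k =
    trans (coeff-⊕ (a ∙ g) (0# ∷ f ⊗ g) (suc k)) (+-congʳ (coeff-∙ a g (suc k)))

  ⊗-congˡ : ∀ f g g′ → g ≋ g′ → f ⊗ g ≋ f ⊗ g′
  ⊗-congˡ []      g g′ p k    = refl
  ⊗-congˡ (a ∷ f) g g′ p zero =
    trans (coeff-∷⊗-zero a f g) (trans (*-congˡ (p 0)) (sym (coeff-∷⊗-zero a f g′)))
  ⊗-congˡ (a ∷ f) g g′ p (suc k) =
    trans (coeff-∷⊗-suc a f g k)
      (trans (+-cong (*-congˡ (p (suc k))) (⊗-congˡ f g g′ p k)) (sym (coeff-∷⊗-suc a f g′ k)))

  ⊗-[] : ∀ f → f ⊗ [] ≋ []
  ⊗-[] []      k       = refl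
  ⊗-[] (a ∷ f) zero    = refl
  ⊗-[] (a ∷ f) (suc k) = ⊗-[] f k

  coeff-⊗∷-zero : ∀ f b g → coeff (f ⊗ (b ∷ g)) 0 ≈ b * coeff f 0
  coeff-⊗∷-zero []      b g = sym (zeroʳ b)
  coeff-⊗∷-zero (a ∷ f) b g = trans (coeff-∷⊗-zero a f (b ∷ g)) (*-comm a b)

  -- Multiplication recurses on the left factor. This is the mirrored recursion on the right factor,
  -- and commutativity follows by comparing the two.
  coeff-⊗∷-suc : ∀ f b g k →
    coeff (f ⊗ (b ∷ g)) (suc k) ≈ b * coeff f (suc k) + coeff (f ⊗ g) k
  coeff-⊗∷-suc [] b g k = sym (trans (+-congʳ (zeroʳ b)) (+-identityˡ 0#))
  coeff-⊗∷-suc (a ∷ f) b g zero = begin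
    coeff ((a ∷ f) ⊗ (b ∷ g)) 1                ≈⟨ coeff-∷⊗-suc a f (b ∷ g) 0 ⟩
    a * coeff g 0 + coeff (f ⊗ (b ∷ g)) 0      ≈⟨ +-cong (sym (coeff-∷⊗-zero a f g)) (coeff-⊗∷-zero f b g) ⟩
    coeff ((a ∷ f) ⊗ g) 0 + b * coeff f 0      ≈⟨ +-comm _ _ ⟩
    b * coeff f 0 + coeff ((a ∷ f) ⊗ g) 0      ∎
  coeff-⊗∷-suc (a ∷ f) b g (suc k) = begin
    coeff ((a ∷ f) ⊗ (b ∷ g)) (suc (suc k))
      ≈⟨ coeff-∷⊗-suc a f (b ∷ g) (suc k) ⟩
    a * coeff g (suc k) + coeff (f ⊗ (b ∷ g)) (suc k)
      ≈⟨ +-congˡ (coeff-⊗∷-suc f b g k) ⟩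
    a * coeff g (suc k) + (b * coeff f (suc k) + coeff (f ⊗ g) k)
      ≈⟨ solve 3 (λ x y z → x :+ (y :+ z) := y :+ (x :+ z)) refl _ _ _ ⟩
    b * coeff f (suc k) + (a * coeff g (suc k) + coeff (f ⊗ g) k)
      ≈⟨ +-congˡ (sym (coeff-∷⊗-suc a f g k)) ⟩
    b * coeff f (suc k) + coeff ((a ∷ f) ⊗ g) (suc k)
      ∎

  ⊗-comm : ∀ f g → f ⊗ g ≋ g ⊗ f
  ⊗-comm f []      = ⊗-[] f
  ⊗-comm f (b ∷ g) zero = trans (coeff-⊗∷-zero f b g) (sym (coeff-∷⊗-zero b g f))
  ⊗-comm f (b ∷ g) (suc k) = begin
    coeff (f ⊗ (b ∷ g)) (suc k)                  ≈⟨ coeff-⊗∷-suc f b g k ⟩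
    b * coeff f (suc k) + coeff (f ⊗ g) k        ≈⟨ +-congˡ (⊗-comm f g k) ⟩
    b * coeff f (suc k) + coeff (g ⊗ f) k        ≈⟨ sym (coeff-∷⊗-suc b g f k) ⟩
    coeff ((b ∷ g) ⊗ f) (suc k)                  ∎

  ⊗-congʳ : ∀ f f′ g → f ≋ f′ → f ⊗ g ≋ f′ ⊗ g
  ⊗-congʳ f f′ g p k = trans (⊗-comm f g k) (trans (⊗-congˡ g f f′ p k) (⊗-comm g f′ k))

  ⊗-distribʳ : ∀ h f g → (f ⊕ g) ⊗ h ≋ f ⊗ h ⊕ g ⊗ h
  ⊗-distribʳ h []      g       k = refl
  ⊗-distribʳ h (a ∷ f) []      k = sym (trans (coeff-⊕ ((a ∷ f) ⊗ h) [] k) (+-identityʳ _))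
  ⊗-distribʳ h (a ∷ f) (b ∷ g) zero = begin
    coeff (((a + b) ∷ (f ⊕ g)) ⊗ h) 0              ≈⟨ coeff-∷⊗-zero (a + b) (f ⊕ g) h ⟩
    (a + b) * coeff h 0                            ≈⟨ distribʳ _ a b ⟩
    a * coeff h 0 + b * coeff h 0                  ≈⟨ sym
        (+-cong (coeff-∷⊗-zero a f h) (coeff-∷⊗-zero b g h)) ⟩
    coeff ((a ∷ f) ⊗ h) 0 + coeff ((b ∷ g) ⊗ h) 0  ≈⟨ sym (coeff-⊕ ((a ∷ f) ⊗ h) ((b ∷ g) ⊗ h) 0) ⟩
    coeff ((a ∷ f) ⊗ h ⊕ (b ∷ g) ⊗ h) 0            ∎
  ⊗-distribʳ h (a ∷ f) (b ∷ g) (suc k) = begin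
    coeff (((a + b) ∷ (f ⊕ g)) ⊗ h) (suc k)
      ≈⟨ coeff-∷⊗-suc (a + b) (f ⊕ g) h k ⟩
    (a + b) * coeff h (suc k) + coeff ((f ⊕ g) ⊗ h) k
      ≈⟨ +-congˡ (trans (⊗-distribʳ h f g k) (coeff-⊕ (f ⊗ h) (g ⊗ h) k)) ⟩
    (a + b) * coeff h (suc k) + (coeff (f ⊗ h) k + coeff (g ⊗ h) k)
      ≈⟨ solve 5 (λ x y u v w → (x :+ y) :* u :+ (v :+ w) := (x :* u :+ v) :+ (y :* u :+ w))
           refl a b _ _ _ ⟩
    (a * coeff h (suc k) + coeff (f ⊗ h) k) + (b * coeff h (suc k) + coeff (g ⊗ h) k)
      ≈⟨ sym (+-cong (coeff-∷⊗-suc a f h k) (coeff-∷⊗-suc b g h k)) ⟩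
    coeff ((a ∷ f) ⊗ h) (suc k) + coeff ((b ∷ g) ⊗ h) (suc k)
      ≈⟨ sym (coeff-⊕ ((a ∷ f) ⊗ h) ((b ∷ g) ⊗ h) (suc k)) ⟩
    coeff ((a ∷ f) ⊗ h ⊕ (b ∷ g) ⊗ h) (suc k)
      ∎

  ∙-⊗ : ∀ a f h → (a ∙ f) ⊗ h ≋ a ∙ (f ⊗ h)
  ∙-⊗ a []      h k = refl
  ∙-⊗ a (b ∷ f) h zero = begin
    coeff ((a * b ∷ a ∙ f) ⊗ h) 0  ≈⟨ coeff-∷⊗-zero (a * b) (a ∙ f) h ⟩
    a * b * coeff h 0              ≈⟨ *-assoc a b _ ⟩
    a * (b * coeff h 0)            ≈⟨ *-congˡ (sym (coeff-∷⊗-zero b f h)) ⟩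
    a * coeff ((b ∷ f) ⊗ h) 0      ≈⟨ sym (coeff-∙ a ((b ∷ f) ⊗ h) 0) ⟩
    coeff (a ∙ ((b ∷ f) ⊗ h)) 0    ∎
  ∙-⊗ a (b ∷ f) h (suc k) = begin
    coeff ((a * b ∷ a ∙ f) ⊗ h) (suc k)
      ≈⟨ coeff-∷⊗-suc (a * b) (a ∙ f) h k ⟩
    a * b * coeff h (suc k) + coeff ((a ∙ f) ⊗ h) k
      ≈⟨ +-congˡ (trans (∙-⊗ a f h k) (coeff-∙ a (f ⊗ h) k)) ⟩
    a * b * coeff h (suc k) + a * coeff (f ⊗ h) k
      ≈⟨ solve 4 (λ x y u v → x :* y :* u :+ x :* v := x :* (y :* u :+ v)) refl a b _ _ ⟩
    a * (b * coeff h (suc k) + coeff (f ⊗ h) k)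
      ≈⟨ *-congˡ (sym (coeff-∷⊗-suc b f h k)) ⟩
    a * coeff ((b ∷ f) ⊗ h) (suc k)
      ≈⟨ sym (coeff-∙ a ((b ∷ f) ⊗ h) (suc k)) ⟩
    coeff (a ∙ ((b ∷ f) ⊗ h)) (suc k)
      ∎

  0∷-⊗ : ∀ f h → (0# ∷ f) ⊗ h ≋ 0# ∷ (f ⊗ h)
  0∷-⊗ f h zero    = trans (coeff-∷⊗-zero 0# f h) (zeroˡ _)
  0∷-⊗ f h (suc k) =
    trans (coeff-∷⊗-suc 0# f h k) (trans (+-congʳ (zeroˡ _)) (+-identityˡ _))

  ⊗-assoc : ∀ f g h → (f ⊗ g) ⊗ h ≋ f ⊗ (g ⊗ h)
  ⊗-assoc []      g h k = refl
  ⊗-assoc (a ∷ f) g h k = begin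
    coeff ((a ∙ g ⊕ (0# ∷ f ⊗ g)) ⊗ h) k
      ≈⟨ ⊗-distribʳ h (a ∙ g) (0# ∷ f ⊗ g) k ⟩
    coeff ((a ∙ g) ⊗ h ⊕ (0# ∷ f ⊗ g) ⊗ h) k
      ≈⟨ ⊕-cong ((a ∙ g) ⊗ h) (a ∙ (g ⊗ h)) ((0# ∷ f ⊗ g) ⊗ h) (0# ∷ f ⊗ (g ⊗ h))
           (∙-⊗ a g h) tail k ⟩
    coeff (a ∙ (g ⊗ h) ⊕ (0# ∷ f ⊗ (g ⊗ h))) k
      ∎
    where
    tail : (0# ∷ f ⊗ g) ⊗ h ≋ 0# ∷ f ⊗ (g ⊗ h)
    tail zero    = 0∷-⊗ (f ⊗ g) h 0
    tail (suc k) = trans (0∷-⊗ (f ⊗ g) h (suc k)) (⊗-assoc f g h k)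

  -- Equal polynomials may be lists of different lengths, so `eval-cong` has to compare a list of
  -- zeros with the empty list.
  eval-[]≋ : ∀ f x → f ≋ [] → eval f x ≈ 0#
  eval-[]≋ []      x p = refl
  eval-[]≋ (a ∷ f) x p = begin
    a + x * eval f x  ≈⟨ +-cong (p 0) (*-congˡ (eval-[]≋ f x (λ k → p (suc k)))) ⟩
    0# + x * 0#       ≈⟨ trans (+-identityˡ _) (zeroʳ x) ⟩
    0#                ∎

  eval-cong : ∀ f g x → f ≋ g → eval f x ≈ eval g x
  eval-cong []      g       x p = sym (eval-[]≋ g x (λ k → sym (p k)))
  eval-cong (a ∷ f) []      x p = eval-[]≋ (a ∷ f) x p
  eval-cong (a ∷ f) (b ∷ g) x p =
    +-cong (p 0) (*-congˡ (eval-cong f g x (λ k → p (suc k))))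

  eval-⊕ : ∀ f g x → eval (f ⊕ g) x ≈ eval f x + eval g x
  eval-⊕ []      g       x = sym (+-identityˡ _)
  eval-⊕ (a ∷ f) []      x = sym (+-identityʳ _)
  eval-⊕ (a ∷ f) (b ∷ g) x = begin
    (a + b) + x * eval (f ⊕ g) x
      ≈⟨ +-congˡ (*-congˡ (eval-⊕ f g x)) ⟩
    (a + b) + x * (eval f x + eval g x)
      ≈⟨ solve 5 (λ a b x u v → (a :+ b) :+ x :* (u :+ v) := (a :+ x :* u) :+ (b :+ x :* v))
           refl a b x _ _ ⟩
    (a + x * eval f x) + (b + x * eval g x)
      ∎

  eval-∙ : ∀ a f x → eval (a ∙ f) x ≈ a * eval f x
  eval-∙ a []      x = sym (zeroʳ a)
  eval-∙ a (b ∷ f) x = begin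
    a * b + x * eval (a ∙ f) x     ≈⟨ +-congˡ (*-congˡ (eval-∙ a f x)) ⟩
    a * b + x * (a * eval f x)     ≈⟨ solve 4 (λ a b x u → a :* b :+ x :* (a :* u) := a :* (b :+ x :* u))
        refl a b x _ ⟩
    a * (b + x * eval f x)         ∎

  eval-⊗ : ∀ f g x → eval (f ⊗ g) x ≈ eval f x * eval g x
  eval-⊗ []      g x = sym (zeroˡ _)
  eval-⊗ (a ∷ f) g x = begin
    eval (a ∙ g ⊕ (0# ∷ f ⊗ g)) x
      ≈⟨ eval-⊕ (a ∙ g) (0# ∷ f ⊗ g) x ⟩
    eval (a ∙ g) x + (0# + x * eval (f ⊗ g) x)
      ≈⟨ +-cong (eval-∙ a g x) (+-congˡ (*-congˡ (eval-⊗ f g x))) ⟩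
    a * eval g x + (0# + x * (eval f x * eval g x))
      ≈⟨ solve 4 (λ a x u v → a :* v :+ (con 0 :+ x :* (u :* v)) := (a :+ x :* u) :* v)
           refl a x _ _ ⟩
    (a + x * eval f x) * eval g x
      ∎

-- Finite sums

module Sums {c ℓ} (R : CommutativeRing c ℓ) where
  open CommutativeRing R
  open RingProperties ring using (-0#≈0#; -‿+-comm)
  open SemiringExp semiring using (_^_)
  open NaturalSolver commutativeSemiring using (solve; _:+_; _:=_)
  open import Relation.Binary.Reasoning.Setoid setoid

  ind : ∀ {a} {A : Set a} → Dec A → Carrier
  ind (yes _) = 1#
  ind (no  _) = 0#

  ind-yes : ∀ {a} {A : Set a} (A? : Dec A) → A → ind A? ≈ 1#
  ind-yes (yes _) x = refl
  ind-yes (no ¬x) x = ⊥-elim (¬x x)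

  ind-no : ∀ {a} {A : Set a} (A? : Dec A) → ¬ A → ind A? ≈ 0#
  ind-no (yes x) ¬x = ⊥-elim (¬x x)
  ind-no (no  _) ¬x = refl

  ind-cong : ∀ {a b} {A : Set a} {B : Set b} (A? : Dec A) (B? : Dec B) →
             (A → B) → (B → A) → ind A? ≈ ind B?
  ind-cong A? (yes y) f g = ind-yes A? (g y)
  ind-cong A? (no ¬y) f g = ind-no A? (λ x → ¬y (f x))

  ind-× : ∀ {a b} {A : Set a} {B : Set b} (A? : Dec A) (B? : Dec B) →
          ind (A? ×-dec B?) ≈ ind A? * ind B?
  ind-× (yes _) (yes _) = sym (*-identityˡ 1#)
  ind-× (yes _) (no  _) = sym (zeroʳ 1#)
  ind-× (no  _) B?      = sym (zeroˡ _)

  -- The same fold as `powerSum`, so the Gauss periods of the statement are instances of `S` by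
  -- definition.
  S : List ℕ → (ℕ → Carrier) → Carrier
  S ks w = foldr (λ k y → w k + y) 0# ks

  S-cong : ∀ ks {w v} → (∀ {k} → k ∈ ks → w k ≈ v k) → S ks w ≈ S ks v
  S-cong []       p = refl
  S-cong (k ∷ ks) p = +-cong (p (here ≡.refl)) (S-cong ks (p ∘ there))

  S-upTo-cong : ∀ n {w v} → (∀ k → k ℕ.< n → w k ≈ v k) → S (upTo n) w ≈ S (upTo n) v
  S-upTo-cong n p = S-cong (upTo n) (λ {k} k∈ → p k (∈-upTo⁻ k∈))

  S-zero : ∀ ks → S ks (λ _ → 0#) ≈ 0#
  S-zero []       = refl
  S-zero (k ∷ ks) = trans (+-identityˡ _) (S-zero ks)

  S-+ : ∀ ks w v → S ks (λ k → w k + v k) ≈ S ks w + S ks v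
  S-+ []       w v = sym (+-identityˡ 0#)
  S-+ (k ∷ ks) w v = begin
    (w k + v k) + S ks (λ k → w k + v k)
      ≈⟨ +-congˡ (S-+ ks w v) ⟩
    (w k + v k) + (S ks w + S ks v)
      ≈⟨ solve 4 (λ a b c d → (a :+ b) :+ (c :+ d) := (a :+ c) :+ (b :+ d)) refl _ _ _ _ ⟩
    (w k + S ks w) + (v k + S ks v)
      ∎

  S-*ˡ : ∀ a ks w → S ks (λ k → a * w k) ≈ a * S ks w
  S-*ˡ a []       w = sym (zeroʳ a)
  S-*ˡ a (k ∷ ks) w = trans (+-congˡ (S-*ˡ a ks w)) (sym (distribˡ a _ _))

  S-*ʳ : ∀ a ks w → S ks (λ k → w k * a) ≈ S ks w * a
  S-*ʳ a []       w = sym (zeroˡ a)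
  S-*ʳ a (k ∷ ks) w = trans (+-congˡ (S-*ʳ a ks w)) (sym (distribʳ a _ _))

  S-neg : ∀ ks w → S ks (λ k → - w k) ≈ - S ks w
  S-neg []       w = sym -0#≈0#
  S-neg (k ∷ ks) w = trans (+-congˡ (S-neg ks w)) (-‿+-comm _ _)

  S-swap : ∀ ks ls (w : ℕ → ℕ → Carrier) →
           S ks (λ k → S ls (w k)) ≈ S ls (λ m → S ks (λ k → w k m))
  S-swap []       ls w = sym (S-zero ls)
  S-swap (k ∷ ks) ls w = trans (+-congˡ (S-swap ks ls w)) (sym (S-+ ls _ _))

  S-map : ∀ (f : ℕ → ℕ) ks w → S (map f ks) w ≡ S ks (w ∘ f)
  S-map f []       w = ≡.refl
  S-map f (k ∷ ks) w = ≡.cong (λ y → w (f k) + y) (S-map f ks w)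

  S-∷ʳ : ∀ ks k w → S (ks ∷ʳ k) w ≈ S ks w + w k
  S-∷ʳ []        k w = trans (+-identityʳ _) (sym (+-identityˡ _))
  S-∷ʳ (k′ ∷ ks) k w = trans (+-congˡ (S-∷ʳ ks k w)) (sym (+-assoc _ _ _))

  S-upTo-suc : ∀ n w → S (upTo (suc n)) w ≈ S (upTo n) w + w n
  S-upTo-suc n w =
    trans (reflexive (≡.cong (λ ks → S ks w) (≡.sym (List.upTo-∷ʳ n)))) (S-∷ʳ (upTo n) n w)

  S-upTo-0∷ : ∀ n w → S (upTo (suc n)) w ≈ w 0 + S (upTo n) (λ k → w (suc k))
  S-upTo-0∷ n w = +-congˡ (reflexive (≡.trans
    (≡.cong (λ ks → S ks w) (≡.sym (List.map-upTo suc n))) (S-map suc (upTo n) w)))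

  S-upTo-+ : ∀ m n w → S (upTo (m ℕ.+ n)) w ≈ S (upTo m) w + S (upTo n) (λ k → w (m ℕ.+ k))
  S-upTo-+ m zero    w =
    trans (reflexive (≡.cong (λ k → S (upTo k) w) (ℕ.+-identityʳ m))) (sym (+-identityʳ _))
  S-upTo-+ m (suc n) w = begin
    S (upTo (m ℕ.+ suc n)) w
      ≡⟨ ≡.cong (λ k → S (upTo k) w) (ℕ.+-suc m n) ⟩
    S (upTo (suc (m ℕ.+ n))) w
      ≈⟨ S-upTo-suc (m ℕ.+ n) w ⟩
    S (upTo (m ℕ.+ n)) w + w (m ℕ.+ n)
      ≈⟨ +-congʳ (S-upTo-+ m n w) ⟩
    S (upTo m) w + S (upTo n) (λ k → w (m ℕ.+ k)) + w (m ℕ.+ n)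
      ≈⟨ +-assoc _ _ _ ⟩
    S (upTo m) w + (S (upTo n) (λ k → w (m ℕ.+ k)) + w (m ℕ.+ n))
      ≈⟨ +-congˡ (sym (S-upTo-suc n _)) ⟩
    S (upTo m) w + S (upTo (suc n)) (λ k → w (m ℕ.+ k))
      ∎

  S-filter : ∀ {p} {P : Pred ℕ p} (P? : Decidable P) ks w →
             S (filter P? ks) w ≈ S ks (λ k → ind (P? k) * w k)
  S-filter P? []       w = refl
  S-filter P? (k ∷ ks) w with P? k
  ... | yes _ = +-cong (sym (*-identityˡ _)) (S-filter P? ks w)
  ... | no  _ = trans (S-filter P? ks w) (sym (trans (+-congʳ (zeroˡ _)) (+-identityˡ _)))

  S-none : ∀ {p} {P : Pred ℕ p} (P? : Decidable P) n (w : ℕ → Carrier) →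
           (∀ k → k ℕ.< n → ¬ P k) → S (upTo n) (λ k → ind (P? k) * w k) ≈ 0#
  S-none P? n w none = trans
    (S-upTo-cong n (λ k k<n → trans (*-congʳ (ind-no (P? k) (none k k<n))) (zeroˡ _)))
    (S-zero (upTo n))

  S-single : ∀ {p} {P : Pred ℕ p} (P? : Decidable P) n (w : ℕ → Carrier) x → x ℕ.< n → P x →
             (∀ k → k ℕ.< n → P k → k ≡ x) → S (upTo n) (λ k → ind (P? k) * w k) ≈ w x
  S-single P? (suc n) w x x<1+n px unique with x ℕ.≟ n
  ... | yes ≡.refl = begin
    S (upTo (suc n)) (λ k → ind (P? k) * w k)
      ≈⟨ S-upTo-suc n _ ⟩
    S (upTo n) (λ k → ind (P? k) * w k) + ind (P? n) * w n
      ≈⟨ +-cong (S-none P? n w (λ k k<n pk → ℕ.<⇒≢ k<n (unique k (ℕ.m<n⇒m<1+n k<n) pk)))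
                (trans (*-congʳ (ind-yes (P? n) px)) (*-identityˡ _)) ⟩
    0# + w n
      ≈⟨ +-identityˡ _ ⟩
    w n
      ∎
  ... | no x≢n = begin
    S (upTo (suc n)) (λ k → ind (P? k) * w k)
      ≈⟨ S-upTo-suc n _ ⟩
    S (upTo n) (λ k → ind (P? k) * w k) + ind (P? n) * w n
      ≈⟨ +-cong (S-single P? n w x (ℕ.≤∧≢⇒< (ℕ.≤-pred x<1+n) x≢n) px
                  (λ k k<n → unique k (ℕ.m<n⇒m<1+n k<n)))
                (trans (*-congʳ (ind-no (P? n) λ pn → x≢n (≡.sym (unique n (ℕ.n<1+n n) pn))))
                       (zeroˡ _)) ⟩
    w x + 0#
      ≈⟨ +-identityʳ _ ⟩
    w x
      ∎

  -- The range is cut into `m` blocks of length `d`, and only the first position of each block is a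
  -- multiple of `d`.
  S-multiples : ∀ d .{{_ : NonZero d}} m (w : ℕ → Carrier) →
                S (upTo (d ℕ.* m)) (λ k → ind (d ∣? k) * w k) ≈ S (upTo m) (λ k → w (d ℕ.* k))
  S-multiples d zero    w = reflexive (≡.cong (λ m → S (upTo m) (λ k → ind (d ∣? k) * w k)) (ℕ.*-zeroʳ d))
  S-multiples d (suc m) w = begin
    S (upTo (d ℕ.* suc m)) v
      ≡⟨ ≡.cong (λ k → S (upTo k) v) (≡.trans (ℕ.*-suc d m) (ℕ.+-comm d _)) ⟩
    S (upTo (d ℕ.* m ℕ.+ d)) v
      ≈⟨ S-upTo-+ (d ℕ.* m) d v ⟩
    S (upTo (d ℕ.* m)) v + S (upTo d) (λ k → v (d ℕ.* m ℕ.+ k))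
      ≈⟨ +-cong (S-multiples d m w) last-block ⟩
    S (upTo m) (λ k → w (d ℕ.* k)) + w (d ℕ.* m)
      ≈⟨ S-upTo-suc m _ ⟨
    S (upTo (suc m)) (λ k → w (d ℕ.* k))
      ∎
    where
    v = λ k → ind (d ∣? k) * w k
    only-zero : ∀ k → k ℕ.< d → d ∣ d ℕ.* m ℕ.+ k → k ≡ 0
    only-zero zero    _   _  = ≡.refl
    only-zero (suc k) k<d d∣ = ⊥-elim (ℕ∣.>⇒∤ k<d (ℕ∣.∣m+n∣m⇒∣n d∣ (ℕ∣.m∣m*n m)))
    last-block : S (upTo d) (λ k → v (d ℕ.* m ℕ.+ k)) ≈ w (d ℕ.* m)
    last-block = trans
      (S-single (λ k → d ∣? (d ℕ.* m ℕ.+ k)) d (λ k → w (d ℕ.* m ℕ.+ k)) 0 (ℕ.>-nonZero⁻¹ d)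
        (≡.subst (d ∣_) (≡.sym (ℕ.+-identityʳ _)) (ℕ∣.m∣m*n m)) only-zero)
      (reflexive (≡.cong w (ℕ.+-identityʳ _)))

  -- Both sides count the pairs (x , f x), once by x and once by f x.
  S-reindex : ∀ {p q} {P : Pred ℕ p} {Q : Pred ℕ q} (P? : Decidable P) (Q? : Decidable Q)
    m n (f g : ℕ → ℕ) →
    (∀ x → x ℕ.< m → P x → f x ℕ.< n × Q (f x) × g (f x) ≡ x) →
    (∀ y → y ℕ.< n → Q y → g y ℕ.< m × P (g y) × f (g y) ≡ y) →
    ∀ (w : ℕ → Carrier) → S (upTo m) (λ x → ind (P? x) * w (f x)) ≈ S (upTo n) (λ y → ind (Q? y) * w y)
  S-reindex {P = P} P? Q? m n f g fwd bwd w = begin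
    S (upTo m) (λ x → ind (P? x) * w (f x))
      ≈⟨ S-upTo-cong m expand ⟩
    S (upTo m) (λ x → S (upTo n) (λ y → ind (graph? x y) * w y))
      ≈⟨ S-swap (upTo m) (upTo n) _ ⟩
    S (upTo n) (λ y → S (upTo m) (λ x → ind (graph? x y) * w y))
      ≈⟨ S-upTo-cong n collapse ⟩
    S (upTo n) (λ y → ind (Q? y) * w y)
      ∎
    where
    graph? : ∀ x y → Dec (P x × y ≡ f x)
    graph? x y = P? x ×-dec (y ℕ.≟ f x)
    expand : ∀ x → x ℕ.< m →
      ind (P? x) * w (f x) ≈ S (upTo n) (λ y → ind (graph? x y) * w y)
    expand x x<m with P? x in eq
    ... | yes px with fwd x x<m px
    ... | fx<n , _ , _ = trans (*-identityˡ _)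
      (sym (trans (S-upTo-cong n λ k _ → *-congʳ (ind-cong (yes px ×-dec (k ℕ.≟ f x)) (k ℕ.≟ f x) proj₂
          (px ,_)))
         (S-single (λ y → y ℕ.≟ f x) n w (f x) fx<n ≡.refl (λ _ _ e → e))))
    expand x x<m | no ¬px = trans (zeroˡ _)
      (sym (S-none (λ y → no ¬px ×-dec (y ℕ.≟ f x)) n w (λ _ _ (px , _) → ¬px px)))
    collapse : ∀ y → y ℕ.< n →
      S (upTo m) (λ x → ind (graph? x y) * w y) ≈ ind (Q? y) * w y
    collapse y y<n with Q? y
    ... | yes qy with bwd y y<n qy
    ... | gy<m , pgy , fgy = trans
      (S-single (λ x → graph? x y) m (λ _ → w y) (g y) gy<m (pgy , ≡.sym fgy)
        (λ { x x<m (px , ≡.refl) → ≡.sym (proj₂ (proj₂ (fwd x x<m px))) }))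
      (sym (*-identityˡ _))
    collapse y y<n | no ¬qy = trans
      (S-none (λ x → graph? x y) m (λ _ → w y)
        (λ { x x<m (px , ≡.refl) → ¬qy (proj₁ (proj₂ (fwd x x<m px))) }))
      (sym (zeroˡ _))

  -- Free of division, hence valid in every commutative ring and also for `z` equal to 1.
  S-geometric : ∀ z n → (z - 1#) * S (upTo n) (z ^_) ≈ z ^ n - 1#
  S-geometric z zero    = trans (zeroʳ _) (sym (-‿inverseʳ 1#))
  S-geometric z (suc n) = begin
    (z - 1#) * S (upTo (suc n)) (z ^_)                  ≈⟨ *-congˡ (S-upTo-suc n (z ^_)) ⟩
    (z - 1#) * (S (upTo n) (z ^_) + z ^ n)              ≈⟨ distribˡ _ _ _ ⟩
    (z - 1#) * S (upTo n) (z ^_) + (z - 1#) * z ^ n     ≈⟨ +-congʳ (S-geometric z n) ⟩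
    (z ^ n - 1#) + (z - 1#) * z ^ n                     ≈⟨ +-congˡ (distribʳ _ _ _) ⟩
    (z ^ n - 1#) + (z * z ^ n + - 1# * z ^ n)           ≈⟨ +-congˡ
        (+-congˡ (RingProperties.-1*x≈-x ring _)) ⟩
    (z ^ n - 1#) + (z ^ suc n - z ^ n)
      ≈⟨ solve 4 (λ a b c d → (a :+ b) :+ (c :+ d) := (c :+ b) :+ (a :+ d)) refl _ _ _ _ ⟩
    (z ^ suc n - 1#) + (z ^ n - z ^ n)                  ≈⟨ +-congˡ (-‿inverseʳ _) ⟩
    (z ^ suc n - 1#) + 0#                               ≈⟨ +-identityʳ _ ⟩
    z ^ suc n - 1#                                      ∎

  -- With `d` a divisibility indicator for prime powers, the summands are the indicators of an exact
  -- power.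
  S-telescope : ∀ (d : ℕ → Carrier) a n →
    S (upTo n) (λ m → d (a ℕ.+ m) - d (a ℕ.+ suc m)) ≈ d a - d (a ℕ.+ n)
  S-telescope d a zero    =
    sym (trans (+-congˡ (-‿cong (reflexive (≡.cong d (ℕ.+-identityʳ a))))) (-‿inverseʳ _))
  S-telescope d a (suc n) = begin
    S (upTo (suc n)) (λ m → d (a ℕ.+ m) - d (a ℕ.+ suc m))
      ≈⟨ S-upTo-suc n _ ⟩
    S (upTo n) (λ m → d (a ℕ.+ m) - d (a ℕ.+ suc m)) + (d (a ℕ.+ n) - d (a ℕ.+ suc n))
      ≈⟨ +-congʳ (S-telescope d a n) ⟩
    (d a - d (a ℕ.+ n)) + (d (a ℕ.+ n) - d (a ℕ.+ suc n))
      ≈⟨ solve 4 (λ x y z u → (x :+ y) :+ (z :+ u) := (x :+ u) :+ (z :+ y)) refl _ _ _ _ ⟩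
    (d a - d (a ℕ.+ suc n)) + (d (a ℕ.+ n) - d (a ℕ.+ n))
      ≈⟨ trans (+-congˡ (-‿inverseʳ _)) (+-identityʳ _) ⟩
    d a - d (a ℕ.+ suc n)
      ∎

-- Congruences and units

%ℕ-mod : ∀ m .{{_ : NonZero m}} a → a ≡ + (a %ℕ m) [mod m ]
%ℕ-mod m a = divides-difference (ℤ∣.divides (a /ℕ m)
  (≡.trans (≡.cong (ℤ._- + (a %ℕ m)) (a≡a%ℕn+[a/ℕn]*n a m)) (lem (+ (a %ℕ m)) ((a /ℕ m) ℤ.* + m))))
  where
  lem : ∀ x y → (x ℤ.+ y) ℤ.- x ≡ y
  lem = solve-∀

mod-weaken : ∀ {d m a b} → d ∣ m → a ≡ b [mod m ] → a ≡ b [mod d ]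
mod-weaken d∣m (divides-difference e) = divides-difference (ℤ∣.∣-trans (ℤ∣.∣ᵤ⇒∣ d∣m) e)

mod-refl : ∀ {m a} → a ≡ a [mod m ]
mod-refl = mod-reflexive ≡.refl

mod-^-cong : ∀ {m a b} n → a ≡ b [mod m ] → a ℤ.^ n ≡ b ℤ.^ n [mod m ]
mod-^-cong zero    e = mod-refl
mod-^-cong (suc n) e = mod-*-cong e (mod-^-cong n e)

∣⇒≡0 : ∀ {m a} → m ∣ a → + a ≡ 0ℤ [mod m ]
∣⇒≡0 {m} {a} m∣a =
  divides-difference (≡.subst ((+ m) ℤ∣.∣_) (≡.sym (ℤ.+-identityʳ (+ a))) (ℤ∣.∣ᵤ⇒∣ m∣a))

≡0⇒∣ : ∀ {m a} → + a ≡ 0ℤ [mod m ] → m ∣ a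
≡0⇒∣ {m} {a} (divides-difference e) =
  ℤ∣.∣⇒∣ᵤ (≡.subst ((+ m) ℤ∣.∣_) (ℤ.+-identityʳ (+ a)) e)

^-*-distrib : ∀ x y n → (x ℤ.* y) ℤ.^ n ≡ x ℤ.^ n ℤ.* y ℤ.^ n
^-*-distrib x y zero    = ≡.refl
^-*-distrib x y (suc n) = ≡.trans (≡.cong (x ℤ.* y ℤ.*_) (^-*-distrib x y n)) (lem x y (x ℤ.^ n) (y ℤ.^ n))
  where
  lem : ∀ a b c d → a ℤ.* b ℤ.* (c ℤ.* d) ≡ a ℤ.* c ℤ.* (b ℤ.* d)
  lem = solve-∀

2∤1+2k : ∀ k → ¬ 2 ∣ suc (k ℕ.* 2)
2∤1+2k k d = ℕ.<⇒≱ (s≤s (s≤s z≤n))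
  (ℕ∣.∣⇒≤ (ℕ∣.∣m+n∣m⇒∣n (≡.subst (2 ∣_) (ℕ.+-comm 1 (k ℕ.* 2)) d) (ℕ∣.n∣m*n k)))

odd-half : ∀ n → ¬ 2 ∣ n → n ≡ 1 ℕ.+ n / 2 ℕ.* 2
odd-half n odd with n % 2 in eq | m%n<n n 2 | m≡m%n+[m/n]*n n 2
... | 0 | _ | _ = ⊥-elim (odd (m%n≡0⇒n∣m n 2 eq))
... | 1 | _ | e = e
... | suc (suc _) | s≤s (s≤s ()) | _

-1^odd : ∀ n → ¬ 2 ∣ n → -1ℤ ℤ.^ n ≡ -1ℤ
-1^odd n odd = begin
  -1ℤ ℤ.^ n                          ≡⟨ ≡.cong (-1ℤ ℤ.^_)
      (≡.trans (odd-half n odd) (≡.cong suc (ℕ.*-comm (n / 2) 2))) ⟩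
  -1ℤ ℤ.* -1ℤ ℤ.^ (2 ℕ.* (n / 2))    ≡⟨ ≡.cong (-1ℤ ℤ.*_) (≡.sym (ℤ.^-*-assoc -1ℤ 2 (n / 2))) ⟩
  -1ℤ ℤ.* 1ℤ ℤ.^ (n / 2)             ≡⟨ ≡.cong (-1ℤ ℤ.*_) (ℤ.^-zeroˡ (n / 2)) ⟩
  -1ℤ                                ∎
  where open ≡-Reasoning

odd-* : ∀ {m n} → ¬ 2 ∣ m → ¬ 2 ∣ n → ¬ 2 ∣ m ℕ.* n
odd-* {m} {n} om on 2∣ with euclidsLemma m n prime[2] 2∣
... | inj₁ x = om x
... | inj₂ y = on y

-- Units are integers with an explicit inverse, because `g`, -1 and products with them have to be
-- handled, while coprimality is available for natural numbers only.
record Inv (m : ℕ) (a : ℤ) : Set where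
  constructor inverted
  field
    inverse  : ℤ
    *inverse : a ℤ.* inverse ≡ 1ℤ [mod m ]

module _ {m : ℕ} where
  open CommutativeRing (ℤ/ m) using (setoid)
  open import Relation.Binary.Reasoning.Setoid setoid

  inv-* : ∀ {a b} → Inv m a → Inv m b → Inv m (a ℤ.* b)
  inv-* {a} {b} (inverted a′ e) (inverted b′ e′) =
    inverted (a′ ℤ.* b′) (mod-trans (mod-reflexive (lem a b a′ b′)) (mod-*-cong e e′))
    where
    lem : ∀ a b c d → a ℤ.* b ℤ.* (c ℤ.* d) ≡ a ℤ.* c ℤ.* (b ℤ.* d)
    lem = solve-∀

  inv-cong : ∀ {a b} → a ≡ b [mod m ] → Inv m a → Inv m b
  inv-cong e (inverted a′ e′) = inverted a′ (mod-trans (mod-*-cong (mod-sym e) mod-refl) e′)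

  inv-1 : Inv m 1ℤ
  inv-1 = inverted 1ℤ mod-refl

  inv-^ : ∀ {a} n → Inv m a → Inv m (a ℤ.^ n)
  inv-^ zero    i = inv-1
  inv-^ (suc n) i = inv-* i (inv-^ n i)

  inv-factor : ∀ a {b} → Inv m (a ℤ.* b) → Inv m a
  inv-factor a {b} (inverted c e) =
    inverted (b ℤ.* c) (mod-trans (mod-reflexive (≡.sym (ℤ.*-assoc a b c))) e)

  mod-*-cancelˡ : ∀ {c a b} → Inv m c → c ℤ.* a ≡ c ℤ.* b [mod m ] → a ≡ b [mod m ]
  mod-*-cancelˡ {c} {a} {b} (inverted c′ i) e = begin
    a                    ≈⟨ mod-reflexive (ℤ.*-identityˡ a) ⟨
    1ℤ ℤ.* a             ≈⟨ mod-*-cong i (mod-refl {a = a}) ⟨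
    c ℤ.* c′ ℤ.* a       ≈⟨ mod-reflexive (lem c c′ a) ⟩
    c′ ℤ.* (c ℤ.* a)     ≈⟨ mod-*-cong (mod-refl {a = c′}) e ⟩
    c′ ℤ.* (c ℤ.* b)     ≈⟨ mod-reflexive (lem c c′ b) ⟨
    c ℤ.* c′ ℤ.* b       ≈⟨ mod-*-cong i (mod-refl {a = b}) ⟩
    1ℤ ℤ.* b             ≈⟨ mod-reflexive (ℤ.*-identityˡ b) ⟩
    b                    ∎
    where
    lem : ∀ x y z → x ℤ.* y ℤ.* z ≡ y ℤ.* (x ℤ.* z)
    lem = solve-∀

  inv-order : ∀ {k d} → HasOrder m k d → Inv m k
  inv-order {k} {suc d} o = inverted (k ℤ.^ d) (HasOrder.power o)
  inv-order {k} {zero} o with () ← HasOrder.positive o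

  -- Cancelling `k ^ a` would leave a positive exponent `b - a` below the order.
  powers-distinct : ∀ {k d} → HasOrder m k d → ∀ a b → a ℕ.< b → b ℕ.< d →
                    ¬ k ℤ.^ a ≡ k ℤ.^ b [mod m ]
  powers-distinct {k} {d} o a b a<b b<d e =
    HasOrder.minimal o (b ℕ.∸ a) (ℕ.m<n⇒0<n∸m a<b) (ℕ.≤-<-trans (ℕ.m∸n≤m b a) b<d)
      (mod-*-cancelˡ (inv-^ a (inv-order o)) (mod-sym (begin
        k ℤ.^ a ℤ.* 1ℤ                   ≈⟨ mod-reflexive (ℤ.*-identityʳ _) ⟩
        k ℤ.^ a                          ≈⟨ e ⟩
        k ℤ.^ b                          ≈⟨ mod-reflexive
            (≡.cong (k ℤ.^_) (≡.sym (ℕ.m+[n∸m]≡n (ℕ.<⇒≤ a<b)))) ⟩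
        k ℤ.^ (a ℕ.+ (b ℕ.∸ a))          ≈⟨ mod-reflexive (ℤ.^-distribˡ-+-* k a (b ℕ.∸ a)) ⟩
        k ℤ.^ a ℤ.* k ℤ.^ (b ℕ.∸ a)      ∎)))

  coprime⇒inv : ∀ {a} → Coprime a m → Inv m (+ a)
  coprime⇒inv {a} c = inverted (recip m a)
    (mod-trans (mod-reflexive (ℤ.*-comm (+ a) (recip m a))) (recip-inverse m a c))

  inv⇒coprime : ∀ {a} → Inv m (+ a) → Coprime a m
  inv⇒coprime {a} (inverted b (divides-difference e)) {d} (d∣a , d∣m) = ℕ∣.∣1⇒≡1 (ℤ∣.∣⇒∣ᵤ
    (≡.subst ((+ d) ℤ∣.∣_) (lem (+ a ℤ.* b))
      (ℤ∣.∣m∣n⇒∣m-n (ℤ∣.∣m⇒∣m*n {m = + a} b (ℤ∣.∣ᵤ⇒∣ d∣a)) (ℤ∣.∣-trans (ℤ∣.∣ᵤ⇒∣ d∣m) e))))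
    where
    lem : ∀ x → x ℤ.- (x ℤ.- 1ℤ) ≡ 1ℤ
    lem = solve-∀

inv-weaken : ∀ {d m a} → d ∣ m → Inv m a → Inv d a
inv-weaken d∣m (inverted b e) = inverted b (mod-weaken d∣m e)

∤⇒coprime-^ : ∀ {p} → Prime p → ∀ s {v} → ¬ p ∣ v → Coprime v (p ℕ.^ s)
∤⇒coprime-^ pr zero    p∤v (_ , d∣1) = ℕ∣.∣1⇒≡1 d∣1
∤⇒coprime-^ {p} pr (suc s) {v} p∤v {d} (d∣v , d∣p*p^s) =
  ∤⇒coprime-^ pr s p∤v (d∣v , Coprimality.coprime-divisor d⊥p d∣p*p^s)
  where
  d⊥p : Coprime d p
  d⊥p (e∣d , e∣p) with prime⇒irreducible pr e∣p
  ... | inj₁ e≡1  = e≡1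
  ... | inj₂ ≡.refl = ⊥-elim (p∤v (ℕ∣.∣-trans e∣d d∣v))

inv⇒∤ : ∀ {p v} → Prime p → Inv p (+ v) → ¬ p ∣ v
inv⇒∤ {p} pr i p∣v = ℕ.nonTrivial⇒≢1 {{prime⇒nonTrivial pr}} (inv⇒coprime i (p∣v , ℕ∣.∣-refl))

∤⇒inv : ∀ {p} → Prime p → ∀ s {v} → ¬ p ∣ v → Inv (p ℕ.^ s) (+ v)
∤⇒inv pr s p∤v = coprime⇒inv (∤⇒coprime-^ pr s p∤v)

-- Pigeonhole: y together with the φ m given units lie in the φ m unit classes.
units-exhausted : ∀ m .{{_ : NonZero m}} (f : ℕ → ℤ) → (∀ r → Inv m (f r)) →
  (∀ a b → a ℕ.< b → b ℕ.< φ m → ¬ f a ≡ f b [mod m ]) →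
  ∀ y → Inv m y → ∃ λ r → r ℕ.< φ m × f r ≡ y [mod m ]
units-exhausted m f unit distinct y y-unit = found (Fin.pigeonhole (ℕ.n<1+n (φ m)) slot)
  where
  units : List ℕ
  units = filter (λ a → coprime? a m) (upTo m)
  unit∈ : ∀ z → Inv m z → (z %ℕ m) ∈ units
  unit∈ z i = ∈-filter⁺ (λ a → coprime? a m) (∈-upTo⁺ (n%ℕd<d z m)) (λ {d} → inv⇒coprime {m} {z %ℕ m}
      (inv-cong (%ℕ-mod m z) i))
  position : ∀ z → Inv m z → Fin (φ m)
  position z i = index (unit∈ z i)
  position-injective : ∀ z z′ i i′ → position z i ≡ position z′ i′ → z ≡ z′ [mod m ]
  position-injective z z′ i i′ e = mod-trans (%ℕ-mod m z)
    (mod-trans (mod-reflexive (≡.cong +_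
      (≡.trans (lookup-index (unit∈ z i))
        (≡.trans (≡.cong (lookup units) e) (≡.sym (lookup-index (unit∈ z′ i′)))))))
      (mod-sym (%ℕ-mod m z′)))
  slot : Fin (suc (φ m)) → Fin (φ m)
  slot Fin.zero    = position y y-unit
  slot (Fin.suc r) = position (f (toℕ r)) (unit (toℕ r))
  found : (∃ λ i → ∃ λ j → i Fin.< j × slot i ≡ slot j) → ∃ λ r → r ℕ.< φ m × f r ≡ y [mod m ]
  found (Fin.zero  , Fin.suc j , _   , e) =
    toℕ j , Fin.toℕ<n j , mod-sym (position-injective y (f (toℕ j)) y-unit (unit (toℕ j)) e)
  found (Fin.suc i , Fin.suc j , s≤s i<j , e) = ⊥-elim (distinct (toℕ i) (toℕ j) i<j (Fin.toℕ<n j)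
    (position-injective (f (toℕ i)) (f (toℕ j)) (unit (toℕ i)) (unit (toℕ j)) e))

-- The factor `w` gives discrete logarithms relative to a base point: 1 for `g` modulo p^s, and a
-- coset representative for `l` modulo q^t, where `l` is itself a primitive root.
primitive-log : ∀ m .{{_ : NonZero m}} {g} → IsPrimitiveRoot m g → ∀ w → Inv m w →
                ∀ y → Inv m y → ∃ λ a → w ℤ.* g ℤ.^ a ≡ y [mod m ]
primitive-log m {g} o w w-unit y y-unit = proj₁ found , proj₂ (proj₂ found)
  where
  found = units-exhausted m (λ a → w ℤ.* g ℤ.^ a) (λ a → inv-* w-unit (inv-^ a (inv-order o)))
    (λ a b a<b b<φ e → powers-distinct o a b a<b b<φ (mod-*-cancelˡ w-unit e)) y y-unit

-- Quadratic characters

module QuadraticCharacter (p m H : ℕ) .{{_ : NonZero m}} (l g : ℤ)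
  (p∣m : p ∣ m) (lift : ∀ {y} → Inv p y → Inv m y)
  (φ≡2H : φ m ≡ 2 ℕ.* H) (H-odd : ¬ 2 ∣ H) (1≢-1 : ¬ 1ℤ ≡ -1ℤ [mod p ])
  (g-order : HasOrder m g (φ m)) (l-order : HasOrder m l H)
  where

  open CommutativeRing (ℤ/ p) using (setoid)
  open import Relation.Binary.Reasoning.Setoid setoid

  -- Squares are taken modulo `p`, although logarithms to base `g` are taken modulo `m`, a multiple
  -- of `p`: the character sees only the residue modulo `p`, the orbits of `l` need all of `m`.
  Square : ℤ → Set
  Square a = ∃ λ y → y ℤ.* y ≡ a [mod p ]

  -- The sign is the value of the Legendre symbol, so that multiplicativity becomes multiplication
  -- of signs.
  Class : Sign → ℤ → Set
  Class plus a = Inv p a × Square a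
  Class minus a = Inv p a × ¬ Square a

  Class⇒inv : ∀ ε {a} → Class ε a → Inv p a
  Class⇒inv plus = proj₁
  Class⇒inv minus = proj₁

  Class-cong : ∀ ε {a b} → a ≡ b [mod p ] → Class ε a → Class ε b
  Class-cong plus e (i , y , q) = inv-cong e i , y , mod-trans q e
  Class-cong minus e (i , ¬q)    = inv-cong e i , λ (y , q) → ¬q (y , mod-trans q (mod-sym e))

  Class-unique : ∀ ε δ {a} → Class ε a → Class δ a → ε ≡ δ
  Class-unique plus plus _ _ = ≡.refl
  Class-unique minus minus _ _ = ≡.refl
  Class-unique plus minus (_ , q) (_ , ¬q) = ⊥-elim (¬q q)
  Class-unique minus plus (_ , ¬q) (_ , q) = ⊥-elim (¬q q)

  -- The parity of the discrete logarithm. `Class minus` is a negated existence and gives nothing to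
  -- compute with; the odd exponent is positive evidence that can be multiplied.
  data View (x : ℤ) : Sign → Set where
    even : ∀ k → x ≡ g ℤ.^ k ℤ.* g ℤ.^ k [mod p ] → View x plus
    odd  : ∀ k → x ≡ g ℤ.* (g ℤ.^ k ℤ.* g ℤ.^ k) [mod p ] → View x minus

  log : ∀ y → Inv p y → ∃ λ a → g ℤ.^ a ≡ y [mod m ]
  log y i =
    let (a , e) = primitive-log m g-order 1ℤ inv-1 y (lift i)
    in a , mod-trans (mod-reflexive (≡.sym (ℤ.*-identityˡ (g ℤ.^ a)))) e

  -- Euler's theorem for `y`, obtained by writing `y` as a power of `g`.
  power-2H : ∀ y → Inv p y → (y ℤ.* y) ℤ.^ H ≡ 1ℤ [mod p ]
  power-2H y i = let (a , e) = log y i in begin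
    (y ℤ.* y) ℤ.^ H        ≈⟨ mod-reflexive (≡.cong (λ x → (y ℤ.* x) ℤ.^ H) (≡.sym (ℤ.*-identityʳ y))) ⟩
    (y ℤ.^ 2) ℤ.^ H        ≈⟨ mod-reflexive (≡.trans (ℤ.^-*-assoc y 2 H) (≡.cong (y ℤ.^_) (≡.sym φ≡2H))) ⟩
    y ℤ.^ φ m              ≈⟨ mod-weaken p∣m (mod-^-cong (φ m) e) ⟨
    (g ℤ.^ a) ℤ.^ φ m      ≈⟨ mod-reflexive (≡.trans (ℤ.^-*-assoc g a (φ m))
                                (≡.trans (≡.cong (g ℤ.^_) (ℕ.*-comm a (φ m)))
                                    (≡.sym (ℤ.^-*-assoc g (φ m) a)))) ⟩
    (g ℤ.^ φ m) ℤ.^ a      ≈⟨ mod-weaken p∣m (mod-^-cong a (HasOrder.power g-order)) ⟩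
    1ℤ ℤ.^ a               ≈⟨ mod-reflexive (ℤ.^-zeroˡ a) ⟩
    1ℤ                     ∎

  square-power : ∀ {a} → Inv p a → Square a → a ℤ.^ H ≡ 1ℤ [mod p ]
  square-power i (y , e) = mod-trans (mod-^-cong H (mod-sym e))
    (power-2H y (inv-factor y (inv-cong (mod-sym e) i)))

  inv--1 : Inv p -1ℤ
  inv--1 = inverted -1ℤ mod-refl

  -- A square has `H`-th power 1, whereas -1 has an odd power -1. The oddness of `H` is the form in
  -- which the condition on `p` modulo 4 enters.
  Class--1 : Class minus -1ℤ
  Class--1 = inv--1 , λ q → 1≢-1
    (mod-trans (mod-sym (square-power inv--1 q)) (mod-reflexive (-1^odd H H-odd)))

  -- If g ^ a is a square then so is its b-th power, where g ^ b = -1; but (-1) ^ a = -1.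
  odd-power-nonsquare : ∀ a → ¬ 2 ∣ a → ¬ Square (g ℤ.^ a)
  odd-power-nonsquare a a-odd (y , e) = let (b , e′) = log -1ℤ inv--1 in
    proj₂ Class--1 (y ℤ.^ b , (begin
    y ℤ.^ b ℤ.* y ℤ.^ b    ≈⟨ mod-reflexive (^-*-distrib y y b) ⟨
    (y ℤ.* y) ℤ.^ b        ≈⟨ mod-^-cong b e ⟩
    (g ℤ.^ a) ℤ.^ b        ≈⟨ mod-reflexive (≡.trans (ℤ.^-*-assoc g a b)
                                (≡.trans (≡.cong (g ℤ.^_) (ℕ.*-comm a b)) (≡.sym (ℤ.^-*-assoc g b a)))) ⟩
    (g ℤ.^ b) ℤ.^ a        ≈⟨ mod-weaken p∣m (mod-^-cong a e′) ⟩
    -1ℤ ℤ.^ a              ≈⟨ mod-reflexive (-1^odd a a-odd) ⟩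
    -1ℤ                    ∎))

  inv-g : Inv p g
  inv-g = inv-weaken p∣m (inv-order g-order)

  Class-square : ∀ {a} → Inv p a → Class plus (a ℤ.* a)
  Class-square {a} i = inv-* i i , a , mod-refl

  Class-g : Class minus g
  Class-g = inv-g , λ q → odd-power-nonsquare 1 (λ d → ℕ.<⇒≱ (s≤s (s≤s z≤n)) (ℕ∣.∣⇒≤ d))
    (proj₁ q , mod-trans (proj₂ q) (mod-reflexive (≡.sym (ℤ.*-identityʳ g))))

  g^2k : ∀ k → g ℤ.^ k ℤ.* g ℤ.^ k ≡ g ℤ.^ (k ℕ.* 2)
  g^2k k = ≡.trans (≡.sym (ℤ.^-distribˡ-+-* g k k))
    (≡.cong (g ℤ.^_) (≡.trans (≡.cong (k ℕ.+_) (≡.sym (ℕ.+-identityʳ k))) (ℕ.*-comm 2 k)))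

  view : ∀ x → Inv p x → ∃ (View x)
  view x i = by-parity (log x i)
    where
    by-parity : (∃ λ a → g ℤ.^ a ≡ x [mod m ]) → ∃ (View x)
    by-parity (a , e) with a % 2 | m%n<n a 2 | m≡m%n+[m/n]*n a 2
    ... | 0 | _ | a≡ = plus , even (a / 2) (mod-trans (mod-sym (mod-weaken p∣m e))
      (mod-reflexive (≡.trans (≡.cong (g ℤ.^_) a≡) (≡.sym (g^2k (a / 2))))))
    ... | 1 | _ | a≡ = minus , odd (a / 2) (mod-trans (mod-sym (mod-weaken p∣m e))
      (mod-reflexive (≡.trans (≡.cong (g ℤ.^_) a≡) (≡.cong (g ℤ.*_) (≡.sym (g^2k (a / 2)))))))
    ... | suc (suc _) | s≤s (s≤s ()) | _

  View⇒Class : ∀ {x} ε → View x ε → Class ε x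
  View⇒Class plus (even k e) = Class-cong plus (mod-sym e) (Class-square (inv-^ k inv-g))
  View⇒Class minus (odd k e) = inv-cong (mod-sym e) (inv-* inv-g (inv-* (inv-^ k inv-g) (inv-^ k inv-g))) ,
    λ (y , q) → odd-power-nonsquare (suc (k ℕ.* 2)) (2∤1+2k k)
      (y , mod-trans q (mod-trans e (mod-reflexive (≡.cong (g ℤ.*_) (g^2k k)))))

  class : ∀ x → Inv p x → ∃ λ ε → Class ε x
  class x i = let (ε , v) = view x i in ε , View⇒Class ε v

  Class⇒View : ∀ {x} ε → Class ε x → View x ε
  Class⇒View {x} ε c = let (δ , v) = view x (Class⇒inv ε c) in
    ≡.subst (View x) (≡.sym (Class-unique ε δ c (View⇒Class δ v))) v

  View-* : ∀ {x y ε δ} → View x ε → View y δ → View (x ℤ.* y) (ε Sign.* δ)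
  View-* (even j e) (even k e′) = even (j ℕ.+ k)
    (mod-trans (mod-*-cong e e′) (mod-reflexive
      (≡.trans (lem (g ℤ.^ j) (g ℤ.^ k)) (≡.cong (λ z → z ℤ.* z) (≡.sym (ℤ.^-distribˡ-+-* g j k))))))
    where
    lem : ∀ x y → (x ℤ.* x) ℤ.* (y ℤ.* y) ≡ (x ℤ.* y) ℤ.* (x ℤ.* y)
    lem = solve-∀
  View-* (even j e) (odd k e′) = odd (j ℕ.+ k)
    (mod-trans (mod-*-cong e e′) (mod-reflexive
      (≡.trans (lem g (g ℤ.^ j) (g ℤ.^ k)) (≡.cong (λ z → g ℤ.* (z ℤ.* z))
          (≡.sym (ℤ.^-distribˡ-+-* g j k))))))
    where
    lem : ∀ g x y → (x ℤ.* x) ℤ.* (g ℤ.* (y ℤ.* y)) ≡ g ℤ.* ((x ℤ.* y) ℤ.* (x ℤ.* y))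
    lem = solve-∀
  View-* (odd j e) (even k e′) = odd (j ℕ.+ k)
    (mod-trans (mod-*-cong e e′) (mod-reflexive
      (≡.trans (lem g (g ℤ.^ j) (g ℤ.^ k)) (≡.cong (λ z → g ℤ.* (z ℤ.* z))
          (≡.sym (ℤ.^-distribˡ-+-* g j k))))))
    where
    lem : ∀ g x y → (g ℤ.* (x ℤ.* x)) ℤ.* (y ℤ.* y) ≡ g ℤ.* ((x ℤ.* y) ℤ.* (x ℤ.* y))
    lem = solve-∀
  View-* (odd j e) (odd k e′) = even (suc (j ℕ.+ k))
    (mod-trans (mod-*-cong e e′) (mod-reflexive
      (≡.trans (lem g (g ℤ.^ j) (g ℤ.^ k)) (≡.cong (λ z → (g ℤ.* z) ℤ.* (g ℤ.* z))
          (≡.sym (ℤ.^-distribˡ-+-* g j k))))))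
    where
    lem : ∀ g x y → (g ℤ.* (x ℤ.* x)) ℤ.* (g ℤ.* (y ℤ.* y)) ≡ (g ℤ.* (x ℤ.* y)) ℤ.* (g ℤ.* (x ℤ.* y))
    lem = solve-∀

  Class-* : ∀ ε δ {x y} → Class ε x → Class δ y → Class (ε Sign.* δ) (x ℤ.* y)
  Class-* ε δ c d = View⇒Class (ε Sign.* δ) (View-* (Class⇒View ε c) (Class⇒View δ d))

  Class-neg : ∀ ε {x} → Class ε x → Class (opposite ε) (ℤ.- x)
  Class-neg plus {x} c = Class-cong minus (mod-reflexive (ℤ.-1*i≡-i x)) (Class-* minus plus Class--1 c)
  Class-neg minus {x} c = Class-cong plus (mod-reflexive (ℤ.-1*i≡-i x)) (Class-* minus minus Class--1 c)

  -- A nonsquare has no odd power equal to 1, and l ^ H = 1.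
  Class-l : Class plus l
  Class-l = conclude (class l (inv-weaken p∣m (inv-order l-order)))
    where
    l^H-class : Class minus l → Class minus 1ℤ
    l^H-class c = Class-cong minus (begin
      l ℤ.* (l ℤ.^ (H / 2) ℤ.* l ℤ.^ (H / 2))
        ≈⟨ mod-reflexive (≡.cong (l ℤ.*_) (≡.sym (ℤ.^-distribˡ-+-* l (H / 2) (H / 2)))) ⟩
      l ℤ.^ suc (H / 2 ℕ.+ H / 2)
        ≈⟨ mod-reflexive (≡.cong (l ℤ.^_) (≡.sym (≡.trans (odd-half H H-odd)
             (≡.cong suc (≡.trans (ℕ.*-comm (H / 2) 2) (≡.cong (H / 2 ℕ.+_) (ℕ.+-identityʳ _))))))) ⟩
      l ℤ.^ H
        ≈⟨ mod-weaken p∣m (HasOrder.power l-order) ⟩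
      1ℤ ∎)
      (Class-* minus plus c (Class-square (inv-^ (H / 2) (Class⇒inv minus c))))
    conclude : ∃ (λ ε → Class ε l) → Class plus l
    conclude (plus  , c) = c
    conclude (minus , c) = ⊥-elim (proj₂ (l^H-class c) (1ℤ , mod-refl))

  Class-^ : ∀ {x} r → Class plus x → Class plus (x ℤ.^ r)
  Class-^ zero    c = inv-1 , 1ℤ , mod-refl
  Class-^ (suc r) c = Class-* plus plus c (Class-^ r c)

  private
    twist : ℕ → ℤ
    twist 0 = 1ℤ
    twist _ = g

    twist-class : ℕ → Sign
    twist-class 0 = plus
    twist-class _ = minus

    Class-twist : ∀ e → Class (twist-class e) (twist e)
    Class-twist 0       = inv-1 , 1ℤ , mod-refl
    Class-twist (suc _) = Class-g

    twist-class-injective : ∀ a b → a ℕ.< 2 → b ℕ.< 2 → twist-class a ≡ twist-class b → a ≡ b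
    twist-class-injective 0 0 _ _ _ = ≡.refl
    twist-class-injective 1 1 _ _ _ = ≡.refl
    twist-class-injective (suc (suc _)) _ (s≤s (s≤s ())) _ _
    twist-class-injective _ (suc (suc _)) _ (s≤s (s≤s ())) _

    twist-+ : ∀ e → twist-class e ≡ plus → twist e ≡ 1ℤ
    twist-+ 0 _ = ≡.refl

  -- The φ m = 2 H elements w l^r and w g l^r with r < H are distinct units,
  -- hence all of them; the class modulo p tells the two kinds apart.
  l-powers-exhaust-class : ∀ ε w v → Class ε w → Class ε v → ∃ λ r → w ℤ.* l ℤ.^ r ≡ v [mod m ]
  l-powers-exhaust-class ε w v cw cv = conclude
    (units-exhausted m f (λ k → inv-* (inv-* w-unit (twist-unit k)) (inv-^ (k / 2) (inv-order l-order)))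
      distinct v (lift (Class⇒inv ε cv)))
    where
    f : ℕ → ℤ
    -- `k` encodes a pair: its parity chooses the factor 1 or `g`, and `k / 2` is the exponent of
    -- `l`. The numbers below `2 * H` run through every pair once.
    f k = w ℤ.* twist (k % 2) ℤ.* l ℤ.^ (k / 2)
    w-unit : Inv m w
    w-unit = lift (Class⇒inv ε cw)
    twist-unit : ∀ k → Inv m (twist (k % 2))
    twist-unit k = lift (Class⇒inv (twist-class (k % 2)) (Class-twist (k % 2)))
    f-class : ∀ k → Class (ε Sign.* twist-class (k % 2) Sign.* plus) (f k)
    f-class k = Class-* (ε Sign.* twist-class (k % 2)) plus (Class-* ε (twist-class (k % 2)) cw
        (Class-twist (k % 2))) (Class-^ (k / 2) Class-l)
    same-twist : ∀ a b → f a ≡ f b [mod m ] → a % 2 ≡ b % 2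
    same-twist a b e = twist-class-injective (a % 2) (b % 2) (m%n<n a 2) (m%n<n b 2)
      (Sign.*-cancelˡ-≡ ε _ _ (Sign.*-cancelʳ-≡ plus _ _
        (Class-unique _ _ (Class-cong _ (mod-weaken p∣m e) (f-class a)) (f-class b))))
    distinct : ∀ a b → a ℕ.< b → b ℕ.< φ m → ¬ f a ≡ f b [mod m ]
    distinct a b a<b b<φ e with a / 2 ℕ.<? b / 2
    ... | yes lt = powers-distinct l-order (a / 2) (b / 2) lt
            (m<n*o⇒m/o<n (≡.subst (b ℕ.<_) (≡.trans φ≡2H (ℕ.*-comm 2 H)) b<φ))
            (mod-*-cancelˡ (inv-* w-unit (twist-unit a))
                (≡.subst (λ r → w ℤ.* twist (a % 2) ℤ.* l ℤ.^ (a / 2) ≡ w ℤ.* twist r ℤ.* l ℤ.^ (b / 2) [mod m ]) (≡.sym (same-twist a b e)) e))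
    ... | no ¬lt = ℕ.<-irrefl a≡b a<b
      where
      a≡b : a ≡ b
      a≡b = ≡.trans (m≡m%n+[m/n]*n a 2) (≡.trans
        (≡.cong₂ (λ x y → x ℕ.+ y ℕ.* 2) (same-twist a b e) (ℕ.≤-antisym (ℕ./-monoˡ-≤ 2 (ℕ.<⇒≤ a<b))
            (ℕ.≮⇒≥ ¬lt)))
        (≡.sym (m≡m%n+[m/n]*n b 2)))
    conclude : (∃ λ k → k ℕ.< φ m × f k ≡ v [mod m ]) → ∃ λ r → w ℤ.* l ℤ.^ r ≡ v [mod m ]
    conclude (k , _ , e) = k / 2 , mod-trans (mod-reflexive (≡.cong (ℤ._* l ℤ.^ (k / 2))
      (≡.trans (≡.sym (ℤ.*-identityʳ w)) (≡.cong (w ℤ.*_) (≡.sym (twist-+ (k % 2) untwisted)))))) e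
      where
      -- `v` and `w` have the same class and `l` is a residue, so the factor `g` cannot be present.
      untwisted : twist-class (k % 2) ≡ plus
      untwisted = Sign.*-cancelˡ-≡ ε _ _ (Sign.*-cancelʳ-≡ plus _ _ (≡.trans
        (Class-unique _ _ (f-class k) (Class-cong ε (mod-sym (mod-weaken p∣m e)) cv))
        (≡.sym (≡.trans (Sign.*-identityʳ _) (Sign.*-identityʳ ε)))))

-- Euler's function at prime powers

module ℤSums = Sums ℤ.+-*-commutativeRing
open ℤSums using () renaming (S to ℤS; ind to ℤind)

-- Counting is summation of ones in the integers, so cardinalities obey the rules for sums of
-- indicators.
length-as-sum : ∀ ks → + length ks ≡ ℤS ks (λ _ → 1ℤ)
length-as-sum []       = ≡.refl
length-as-sum (k ∷ ks) = ≡.cong (λ z → 1ℤ ℤ.+ z) (length-as-sum ks)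

length-filter-as-sum : ∀ {p} {P : ℕ → Set p} (P? : ∀ k → Dec (P k)) ks →
                       + length (filter P? ks) ≡ ℤS ks (λ k → ℤind (P? k) ℤ.* 1ℤ)
length-filter-as-sum P? ks =
  ≡.trans (length-as-sum (filter P? ks)) (ℤSums.S-filter P? ks (λ _ → 1ℤ))

-- Every number below the modulus is either coprime to it or one of the p^k multiples of `p`. The
-- additive form avoids truncated subtraction.
φ-prime-power : ∀ {p} → Prime p → ∀ k → φ (p ℕ.^ suc k) ℕ.+ p ℕ.^ k ≡ p ℕ.^ suc k
φ-prime-power {p} pr k = ℤ.+-injective (begin
  + (φ m ℕ.+ p ℕ.^ k)
    ≡⟨ ℤ.pos-+ (φ m) (p ℕ.^ k) ⟩
  + φ m ℤ.+ + (p ℕ.^ k)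
    ≡⟨ ≡.cong₂ ℤ._+_ (length-filter-as-sum (λ a → coprime? a m) (upTo m)) multiples ⟩
  ℤS (upTo m) (λ a → ℤind (coprime? a m) ℤ.* 1ℤ) ℤ.+ ℤS (upTo m) (λ a → ℤind (p ∣? a) ℤ.* 1ℤ)
    ≡⟨ ℤSums.S-+ (upTo m) (λ a → ℤind (coprime? a m) ℤ.* 1ℤ) (λ a → ℤind (p ∣? a) ℤ.* 1ℤ) ⟨
  ℤS (upTo m) (λ a → ℤind (coprime? a m) ℤ.* 1ℤ ℤ.+ ℤind (p ∣? a) ℤ.* 1ℤ)
    ≡⟨ ℤSums.S-cong (upTo m) (λ {a} _ → one a) ⟩
  ℤS (upTo m) (λ _ → 1ℤ)
    ≡⟨ length-as-sum (upTo m) ⟨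
  + length (upTo m)
    ≡⟨ ≡.cong +_ (List.length-upTo m) ⟩
  + m ∎)
  where
  open ≡-Reasoning
  m = p ℕ.^ suc k
  instance _ = prime⇒nonZero pr
  multiples : + (p ℕ.^ k) ≡ ℤS (upTo m) (λ a → ℤind (p ∣? a) ℤ.* 1ℤ)
  multiples = ≡.trans (≡.cong +_ (≡.sym (List.length-upTo (p ℕ.^ k))))
      (≡.trans (length-as-sum (upTo (p ℕ.^ k)))
    (≡.sym (ℤSums.S-multiples p (p ℕ.^ k) (λ _ → 1ℤ))))
  one : ∀ a → ℤind (coprime? a m) ℤ.* 1ℤ ℤ.+ ℤind (p ∣? a) ℤ.* 1ℤ ≡ 1ℤ
  one a with p ∣? a
  ... | yes p∣a rewrite ℤSums.ind-no (coprime? a m)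
      (λ c → ℕ.nonTrivial⇒≢1 {{prime⇒nonTrivial pr}} (c (p∣a , ℕ∣.m∣m*n (p ℕ.^ k)))) = ≡.refl
  ... | no  p∤a rewrite ℤSums.ind-yes (coprime? a m) (∤⇒coprime-^ pr (suc k) p∤a) = ≡.refl

odd-^ : ∀ {p} → ¬ 2 ∣ p → ∀ k → ¬ 2 ∣ p ℕ.^ k
odd-^ odd zero    d = ℕ.<⇒≱ (s≤s (s≤s z≤n)) (ℕ∣.∣⇒≤ d)
odd-^ {p} odd (suc k) = odd-* {p} odd (odd-^ odd k)

-- With p = 4c + 3 the value is 2 p^k (2c + 1), twice a product of odd numbers.
φ-half : ∀ {p} → Prime p → p % 4 ≡ 3 → ∀ k →
         φ (p ℕ.^ suc k) ≡ 2 ℕ.* (φ (p ℕ.^ suc k) / 2) × ¬ 2 ∣ φ (p ℕ.^ suc k) / 2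
φ-half {p} pr p%4≡3 k =
  ≡.trans φ≡ (≡.cong (2 ℕ.*_) (≡.sym half≡)) , ≡.subst (λ h → ¬ 2 ∣ h) (≡.sym half≡)
      (odd-* {p ℕ.^ k} (odd-^ p-odd k) (2∤1+2k c))
  where
  c = p / 4
  p≡ : p ≡ 3 ℕ.+ c ℕ.* 4
  p≡ = ≡.trans (m≡m%n+[m/n]*n p 4) (≡.cong (ℕ._+ c ℕ.* 4) p%4≡3)
  p-odd : ¬ 2 ∣ p
  p-odd d = 2∤1+2k (1 ℕ.+ c ℕ.* 2) (≡.subst (2 ∣_) (≡.trans p≡ (lem c)) d)
    where
    lem : ∀ c → 3 ℕ.+ c ℕ.* 4 ≡ suc ((1 ℕ.+ c ℕ.* 2) ℕ.* 2)
    lem = ℕSolver.solve-∀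
  φ≡ : φ (p ℕ.^ suc k) ≡ 2 ℕ.* (p ℕ.^ k ℕ.* suc (c ℕ.* 2))
  φ≡ = ℕ.+-cancelʳ-≡ (p ℕ.^ k) _ _ (≡.trans (φ-prime-power pr k)
    (≡.trans (≡.cong (ℕ._* p ℕ.^ k) p≡) (lem c (p ℕ.^ k))))
    where
    lem : ∀ c x → (3 ℕ.+ c ℕ.* 4) ℕ.* x ≡ 2 ℕ.* (x ℕ.* suc (c ℕ.* 2)) ℕ.+ x
    lem = ℕSolver.solve-∀
  half≡ : φ (p ℕ.^ suc k) / 2 ≡ p ℕ.^ k ℕ.* suc (c ℕ.* 2)
  half≡ = ≡.trans (≡.cong (_/ 2) (≡.trans φ≡ (ℕ.*-comm 2 o))) (ℕ.m*n/n≡m o 2)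
    where
    o = p ℕ.^ k ℕ.* suc (c ℕ.* 2)

-- Simultaneous congruences and division by prime powers

private
  bézout-assoc : ∀ r a x d → r ℕ.+ a ℕ.* (x ℕ.* d) ≡ r ℕ.+ x ℕ.* a ℕ.* d
  bézout-assoc = ℕSolver.solve-∀
  bézout-shift : ∀ r₁ r₂ y b → r₁ ℕ.+ (1 ℕ.+ y ℕ.* suc b) ℕ.* (r₂ ℕ.+ b ℕ.* r₁) ≡
                       r₂ ℕ.+ suc b ℕ.* (r₁ ℕ.+ y ℕ.* (r₂ ℕ.+ b ℕ.* r₁))
  bézout-shift = ℕSolver.solve-∀

-- The Chinese remainder theorem for exponents, which must stay natural numbers. In the first case
-- `d` stands for the difference r₂ - r₁ modulo `b`, in the second for r₁ - r₂ modulo `a`; Bézout's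
-- identity multiplies it to the right place.
common-exponent : ∀ a b .{{_ : NonZero a}} .{{_ : NonZero b}} → Coprime a b → ∀ r₁ r₂ →
                  ∃ λ k₁ → ∃ λ k₂ → r₁ ℕ.+ a ℕ.* k₁ ≡ r₂ ℕ.+ b ℕ.* k₂
common-exponent a@(suc a-1) b@(suc b-1) c r₁ r₂ with coprime-Bézout c
... | Bézout.+- x y eq = x ℕ.* d , r₁ ℕ.+ y ℕ.* d , (begin
  r₁ ℕ.+ a ℕ.* (x ℕ.* d)          ≡⟨ bézout-assoc r₁ a x d ⟩
  r₁ ℕ.+ x ℕ.* a ℕ.* d            ≡⟨ ≡.cong (λ z → r₁ ℕ.+ z ℕ.* d) (≡.sym eq) ⟩
  r₁ ℕ.+ (1 ℕ.+ y ℕ.* b) ℕ.* d    ≡⟨ bézout-shift r₁ r₂ y b-1 ⟩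
  r₂ ℕ.+ b ℕ.* (r₁ ℕ.+ y ℕ.* d)   ∎)
  where
  open ≡-Reasoning
  d = r₂ ℕ.+ b-1 ℕ.* r₁
... | Bézout.-+ x y eq = r₂ ℕ.+ x ℕ.* d , y ℕ.* d , (begin
  r₁ ℕ.+ a ℕ.* (r₂ ℕ.+ x ℕ.* d)   ≡⟨ bézout-shift r₂ r₁ x a-1 ⟨
  r₂ ℕ.+ (1 ℕ.+ x ℕ.* a) ℕ.* d    ≡⟨ ≡.cong (λ z → r₂ ℕ.+ z ℕ.* d) eq ⟩
  r₂ ℕ.+ y ℕ.* b ℕ.* d            ≡⟨ bézout-assoc r₂ b y d ⟨
  r₂ ℕ.+ b ℕ.* (y ℕ.* d)          ∎)
  where
  open ≡-Reasoning
  d = r₁ ℕ.+ a-1 ℕ.* r₂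

coprime-*-∣ : ∀ {m n k} → Coprime m n → m ∣ k → n ∣ k → m ℕ.* n ∣ k
coprime-*-∣ {m} {n} c m∣k (divides d ≡.refl) =
  ℕ∣.*-monoˡ-∣ n (coprime-divisor c (≡.subst (m ∣_) (ℕ.*-comm d n) m∣k))

mod-combine : ∀ {m n a b} → Coprime m n → a ≡ b [mod m ] → a ≡ b [mod n ] → a ≡ b [mod m ℕ.* n ]
mod-combine c (divides-difference e) (divides-difference e′) =
  divides-difference (ℤ∣.∣ᵤ⇒∣ (coprime-*-∣ c (ℤ∣.∣⇒∣ᵤ e) (ℤ∣.∣⇒∣ᵤ e′)))

prime∤prime : ∀ {p q} → Prime p → Prime q → p ≢ q → ¬ p ∣ q
prime∤prime pr qr p≢q p∣q with prime⇒irreducible qr p∣q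
... | inj₁ p≡1 = ℕ.nonTrivial⇒≢1 {{prime⇒nonTrivial pr}} p≡1
... | inj₂ p≡q = p≢q p≡q

∤-^ : ∀ {p q} → Prime p → ¬ p ∣ q → ∀ j → ¬ p ∣ q ℕ.^ j
∤-^ pr p∤q zero    d = ℕ.nonTrivial⇒≢1 {{prime⇒nonTrivial pr}} (ℕ∣.∣1⇒≡1 d)
∤-^ {q = q} pr p∤q (suc j) d with euclidsLemma q (q ℕ.^ j) pr d
... | inj₁ p∣q  = p∤q p∣q
... | inj₂ p∣q^ = ∤-^ pr p∤q j p∣q^

^-split : ∀ p {i s} → i ℕ.≤ s → p ℕ.^ s ≡ p ℕ.^ i ℕ.* p ℕ.^ (s ℕ.∸ i)
^-split p {i} {s} i≤s = ≡.trans (≡.cong (p ℕ.^_) (≡.sym (ℕ.m+[n∸m]≡n i≤s))) (ℕ.^-distribˡ-+-* p i (s ℕ.∸ i))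

^-∣ : ∀ p {i s} → i ℕ.≤ s → p ℕ.^ i ∣ p ℕ.^ s
^-∣ p {i} {s} i≤s = ≡.subst (p ℕ.^ i ∣_) (≡.sym (^-split p i≤s)) (ℕ∣.m∣m*n (p ℕ.^ (s ℕ.∸ i)))

-- Dividing by π^i lowers the modulus to π^(s-i), so a congruence modulo π survives only for `i`
-- below `s`. This is the origin of the guards in `PClass` and `QUnit`.
divide-congruence : ∀ π .{{_ : NonZero π}} {i s u Z} → i ℕ.≤ s →
  (+ u) ≡ + (π ℕ.^ i) ℤ.* Z [mod π ℕ.^ s ] →
  ∃ λ v → u ≡ π ℕ.^ i ℕ.* v × (i ℕ.< s → (+ v) ≡ Z [mod π ])
divide-congruence π {i} {s} {u} {Z} i≤s e = v , u≡ , reduce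
  where
  instance _ = ℕ.m^n≢0 π i
  d∣u : π ℕ.^ i ∣ u
  d∣u = ≡0⇒∣ (mod-trans (mod-weaken (^-∣ π i≤s) e)
    (mod-trans (mod-*-cong (∣⇒≡0 {a = π ℕ.^ i} ℕ∣.∣-refl) mod-refl) (mod-reflexive (ℤ.*-zeroˡ Z))))
  v = ℕ∣.quotient d∣u
  u≡ : u ≡ π ℕ.^ i ℕ.* v
  u≡ = ≡.trans (ℕ∣._∣_.equality d∣u) (ℕ.*-comm v (π ℕ.^ i))
  reduce : i ℕ.< s → (+ v) ≡ Z [mod π ]
  reduce i<s = divides-difference (ℤ∣.*-cancelˡ-∣ (+ (π ℕ.^ i)) (≡.subst₂ ℤ∣._∣_
    (≡.trans (≡.cong +_ (ℕ.*-comm π (π ℕ.^ i))) (ℤ.pos-* (π ℕ.^ i) π))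
    (≡.trans (≡.cong (ℤ._- + (π ℕ.^ i) ℤ.* Z) (≡.trans (≡.cong +_ u≡) (ℤ.pos-* (π ℕ.^ i) v)))
           (lem (+ (π ℕ.^ i)) (+ v) Z))
    (difference (mod-weaken (^-∣ π i<s) e))))
    where
    lem : ∀ d v z → d ℤ.* v ℤ.- d ℤ.* z ≡ d ℤ.* (v ℤ.- z)
    lem = solve-∀

-- Cyclotomic cosets modulo p ^ s * q ^ t

record Hypotheses (s t p q l : ℕ) (g : ℤ) : Set where
  field
    1≤s         : 1 ℕ.≤ s
    1≤t         : 1 ℕ.≤ t
    p-prime     : Prime p
    q-prime     : Prime q
    l-prime     : Prime l
    p≢q         : p ≢ q
    p≢l         : p ≢ l
    q≢l         : q ≢ l
    p-odd       : ¬ 2 ∣ p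
    p%4≡3       : p % 4 ≡ 3
    l-order-p   : HasOrder (p ℕ.^ s) (+ l) (φ (p ℕ.^ s) / 2)
    l-order-q   : HasOrder (q ℕ.^ t) (+ l) (φ (q ℕ.^ t))
    gcd≡2       : gcd (φ (p ℕ.^ s)) (φ (q ℕ.^ t)) ≡ 2
    q-residue   : IsQuadraticResidue p (+ q)
    g-order-p   : IsPrimitiveRoot (p ℕ.^ s) g
    g-order-q   : IsPrimitiveRoot (q ℕ.^ t) g

module CosetCharacterisation {s t p q l : ℕ} {g : ℤ} (hypotheses : Hypotheses s t p q l g) where
  open Hypotheses hypotheses

  instance
    p-nonZero = prime⇒nonZero p-prime
    q-nonZero = prime⇒nonZero q-prime
    p^s-nonZero = ℕ.m^n≢0 p s
    q^t-nonZero = ℕ.m^n≢0 q t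

  H = φ (p ℕ.^ s) / 2

  ^-∣-self : ∀ {π k} → 1 ℕ.≤ k → π ∣ π ℕ.^ k
  ^-∣-self {π} {k} 1≤k = ≡.subst (_∣ π ℕ.^ k) (ℕ.^-identityʳ π) (^-∣ π 1≤k)

  1≢-1 : ¬ 1ℤ ≡ -1ℤ [mod p ]
  1≢-1 (divides-difference e) with prime⇒irreducible prime[2] (ℤ∣.∣⇒∣ᵤ e)
  ... | inj₁ p≡1 = ℕ.nonTrivial⇒≢1 {{prime⇒nonTrivial p-prime}} p≡1
  ... | inj₂ p≡2 = p-odd (ℕ∣.∣-reflexive (≡.sym p≡2))

  inv-lift : ∀ {π} .{{_ : NonZero π}} → Prime π → ∀ k {y} → Inv π y → Inv (π ℕ.^ k) y
  inv-lift {π} pr k {y} i = inv-cong (mod-sym (%ℕ-mod (π ℕ.^ k) {{ℕ.m^n≢0 π k}} y)) (lem k)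
    where
    lem : ∀ k → Inv (π ℕ.^ k) (+ ((y %ℕ (π ℕ.^ k)) {{ℕ.m^n≢0 π k}}))
    -- Modulo 1 all integers are congruent, so 0 serves as an inverse.
    lem zero = inverted 0ℤ (divides-difference (ℤ∣.∣ᵤ⇒∣ (ℕ∣.1∣ _)))
    lem (suc k) = ∤⇒inv pr (suc k) (inv⇒∤ pr (inv-cong
      (mod-weaken (ℕ∣.m∣m*n (π ℕ.^ k)) (%ℕ-mod (π ℕ.^ suc k) {{ℕ.m^n≢0 π (suc k)}} y)) i))

  φ-p^s : φ (p ℕ.^ s) ≡ 2 ℕ.* H × ¬ 2 ∣ H
  φ-p^s = ≡.subst (λ s → φ (p ℕ.^ s) ≡ 2 ℕ.* (φ (p ℕ.^ s) / 2) × ¬ 2 ∣ φ (p ℕ.^ s) / 2)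
    (ℕ.m+[n∸m]≡n 1≤s) (φ-half p-prime p%4≡3 (s ℕ.∸ 1))

  open QuadraticCharacter p (p ℕ.^ s) H (+ l) g (^-∣-self 1≤s) (inv-lift p-prime s)
    (proj₁ φ-p^s) (proj₂ φ-p^s) 1≢-1 g-order-p l-order-p public

  orders-coprime : Coprime H (φ (q ℕ.^ t))
  orders-coprime {d} (d∣H , d∣φ)
    with prime⇒irreducible prime[2] (≡.subst (d ∣_) gcd≡2
           (gcd-greatest (≡.subst (d ∣_) (≡.sym (proj₁ φ-p^s)) (ℕ∣.∣n⇒∣m*n 2 d∣H)) d∣φ))
  ... | inj₁ d≡1  = d≡1
  ... | inj₂ ≡.refl = ⊥-elim (proj₂ φ-p^s d∣H)

  -- Translates between square roots among all integers and the finite search by which the statement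
  -- defines residues; the root is reduced modulo `p`.
  Square-Fin : ∀ {a} → Square a → ∃ λ (x : Fin p) → (+ toℕ x) ℤ.^ 2 ≡ a [mod p ]
  Square-Fin {a} (y , e) = Fin.fromℕ< (n%ℕd<d y p) , mod-trans
    (mod-trans (mod-reflexive (≡.trans (≡.cong (λ x → (+ x) ℤ.^ 2) (Fin.toℕ-fromℕ< (n%ℕd<d y p)))
      (≡.cong (+ (y %ℕ p) ℤ.*_) (ℤ.*-identityʳ (+ (y %ℕ p))))))
      (mod-sym (mod-*-cong (%ℕ-mod p y) (%ℕ-mod p y)))) e

  Fin-Square : ∀ {a} → (∃ λ (x : Fin p) → (+ toℕ x) ℤ.^ 2 ≡ a [mod p ]) → Square a
  Fin-Square (x , e) = + toℕ x ,
    mod-trans (mod-reflexive (≡.cong (+ toℕ x ℤ.*_) (≡.sym (ℤ.*-identityʳ (+ toℕ x))))) e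

  inv⇒≢0 : ∀ {a} → Inv p a → ¬ a ≡ 0ℤ [mod p ]
  inv⇒≢0 {a} i e = inv⇒∤ p-prime (inv-cong e i) (ℕ∣._∣0 p)

  ≢0⇒inv : ∀ {a} → ¬ a ≡ 0ℤ [mod p ] → Inv p a
  ≢0⇒inv {a} a≢0 = inv-cong (mod-sym (%ℕ-mod p a)) (≡.subst (λ n → Inv n (+ (a %ℕ p))) (ℕ.^-identityʳ p)
    (∤⇒inv p-prime 1 (λ p∣ → a≢0 (mod-trans (%ℕ-mod p a) (∣⇒≡0 p∣)))))

  Class-q : Class plus (+ q)
  Class-q = ≢0⇒inv (proj₁ q-residue) , Fin-Square (proj₂ q-residue)

  opaque
    Class? : ∀ ε a → Dec (Class ε a)
    Class? plus  a = map′ (λ (n , x) → ≢0⇒inv n , Fin-Square x) (λ (i , x) → inv⇒≢0 i , Square-Fin x)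
      (¬? (a ≡? 0ℤ [mod p ]) ×-dec square? p a)
    Class? minus a = map′ (λ (n , x) → ≢0⇒inv n , λ q → x (Square-Fin q)) (λ (i , x) → inv⇒≢0 i , λ q → x
        (Fin-Square q))
      (¬? (a ≡? 0ℤ [mod p ]) ×-dec ¬? (square? p a))

  -- For `i` equal to `s` the guard is vacuous and both signs describe the multiples of p^s, in
  -- accordance with the coincidence of the starred and unstarred cosets there.
  PClass : Sign → ℕ → ℕ → Set
  PClass ε i u = ∃ λ v → u ≡ p ℕ.^ i ℕ.* v × (i ℕ.< s → Class ε (+ v))

  QUnit : ℕ → ℕ → Set
  QUnit j u = ∃ λ w → u ≡ q ℕ.^ j ℕ.* w × (j ℕ.< t → ¬ q ∣ w)

  multiple? : ∀ d .{{_ : NonZero d}} u {ℓ} {B : ℕ → Set ℓ} → (∀ v → Dec (B v)) → Dec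
      (∃ λ v → u ≡ d ℕ.* v × B v)
  multiple? d u {B = B} B? with d ∣? u
  ... | no d∤u = no λ (v , e , _) → d∤u (divides v (≡.trans e (ℕ.*-comm d v)))
  ... | yes (divides v e) = map′ (λ b → v , ≡.trans e (ℕ.*-comm v d) , b)
    (λ (v′ , e′ , b) → ≡.subst B (ℕ.*-cancelˡ-≡ v′ v d (≡.trans (≡.sym e′) (≡.trans e (ℕ.*-comm v d)))) b)
        (B? v)

  opaque
    PClass? : ∀ ε i u → Dec (PClass ε i u)
    PClass? ε i u = multiple? (p ℕ.^ i) {{ℕ.m^n≢0 p i}} u (λ v → (i ℕ.<? s) →-dec Class? ε (+ v))

    QUnit? : ∀ j u → Dec (QUnit j u)
    QUnit? j u = multiple? (q ℕ.^ j) {{ℕ.m^n≢0 q j}} u (λ w → (j ℕ.<? t) →-dec ¬? (q ∣? w))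

  open Cosets l (p ℕ.^ s ℕ.* q ℕ.^ t)

  twist : Sign → ℤ
  twist plus  = 1ℤ
  twist minus = g

  Class-twist : ∀ ε → Class ε (twist ε)
  Class-twist plus  = inv-1 , 1ℤ , mod-refl
  Class-twist minus = Class-g

  inv-twist-q : ∀ ε → Inv (q ℕ.^ t) (twist ε)
  inv-twist-q plus  = inv-1
  inv-twist-q minus = inv-order g-order-q

  -- Given by cases, not as a product with `twist ε`, so that the two clauses are `γ` and `γ*` by
  -- definition.
  rep : Sign → ℕ → ℕ → ℤ
  rep plus  i j = + (p ℕ.^ i ℕ.* q ℕ.^ j)
  rep minus i j = + (p ℕ.^ i ℕ.* q ℕ.^ j) ℤ.* g

  Class-q^ : ∀ j → Class plus (+ (q ℕ.^ j))
  Class-q^ zero    = inv-1 , 1ℤ , mod-refl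
  Class-q^ (suc j) = Class-cong plus (mod-reflexive (≡.sym (ℤ.pos-* q (q ℕ.^ j))))
      (Class-* plus plus Class-q (Class-q^ j))

  inv-p^ : ∀ i → Inv (q ℕ.^ t) (+ (p ℕ.^ i))
  inv-p^ i = ∤⇒inv q-prime t (∤-^ q-prime (prime∤prime q-prime p-prime (λ e → p≢q (≡.sym e))) i)

  γ-factor-p : ∀ ε i j r → rep ε i j ℤ.* (+ l) ℤ.^ r ≡ + (p ℕ.^ i) ℤ.* (+ (q ℕ.^ j) ℤ.* twist ε ℤ.* (+ l)
      ℤ.^ r)
  γ-factor-p plus  i j r = ≡.trans (≡.cong (ℤ._* (+ l) ℤ.^ r) (ℤ.pos-* (p ℕ.^ i) (q ℕ.^ j)))
    (lem (+ (p ℕ.^ i)) (+ (q ℕ.^ j)) ((+ l) ℤ.^ r))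
    where
    lem : ∀ a b c → a ℤ.* b ℤ.* c ≡ a ℤ.* (b ℤ.* 1ℤ ℤ.* c)
    lem = solve-∀
  γ-factor-p minus i j r = ≡.trans (≡.cong (λ z → z ℤ.* g ℤ.* (+ l) ℤ.^ r) (ℤ.pos-* (p ℕ.^ i) (q ℕ.^ j)))
    (lem (+ (p ℕ.^ i)) (+ (q ℕ.^ j)) g ((+ l) ℤ.^ r))
    where
    lem : ∀ a b c d → a ℤ.* b ℤ.* c ℤ.* d ≡ a ℤ.* (b ℤ.* c ℤ.* d)
    lem = solve-∀

  γ-factor-q : ∀ ε i j r → rep ε i j ℤ.* (+ l) ℤ.^ r ≡ + (q ℕ.^ j) ℤ.* (+ (p ℕ.^ i) ℤ.* twist ε ℤ.* (+ l)
      ℤ.^ r)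
  γ-factor-q ε i j r = ≡.trans (γ-factor-p ε i j r) (lem (+ (p ℕ.^ i)) (+ (q ℕ.^ j)) (twist ε)
      ((+ l) ℤ.^ r))
    where
    lem : ∀ a b c d → a ℤ.* (b ℤ.* c ℤ.* d) ≡ b ℤ.* (a ℤ.* c ℤ.* d)
    lem = solve-∀

  power-periodic : ∀ {m d} → HasOrder m (+ l) d → ∀ r k →
                   (+ l) ℤ.^ (r ℕ.+ d ℕ.* k) ≡ (+ l) ℤ.^ r [mod m ]
  power-periodic {m} {d} o r k = mod-trans
    (mod-reflexive (≡.trans (ℤ.^-distribˡ-+-* (+ l) r (d ℕ.* k))
      (≡.cong ((+ l) ℤ.^ r ℤ.*_) (≡.sym (ℤ.^-*-assoc (+ l) d k)))))
    (mod-trans (mod-*-cong (mod-refl {a = (+ l) ℤ.^ r}) (mod-trans (mod-^-cong k (HasOrder.power o))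
        (mod-reflexive (ℤ.^-zeroˡ k))))
      (mod-reflexive (ℤ.*-identityʳ ((+ l) ℤ.^ r))))

  private
    multiply : ∀ {m} d w {v y y′} → w ℤ.* y ≡ + v [mod m ] → y′ ≡ y [mod m ] →
               (+ (d ℕ.* v)) ≡ + d ℤ.* (w ℤ.* y′) [mod m ]
    multiply d w {v} e e′ = mod-trans (mod-reflexive (ℤ.pos-* d v))
      (mod-*-cong (mod-refl {a = + d}) (mod-trans (mod-sym e) (mod-*-cong (mod-refl {a = w}) (mod-sym e′))))

    vanish : ∀ m {v z} → (+ (m ℕ.* v)) ≡ + m ℤ.* z [mod m ]
    vanish m {v} {z} = mod-trans (∣⇒≡0 (ℕ∣.m∣m*n v))
      (mod-sym (mod-trans (mod-*-cong (∣⇒≡0 {a = m} ℕ∣.∣-refl) (mod-refl {a = z}))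
          (mod-reflexive (ℤ.*-zeroˡ z))))

  -- The exponent matters only modulo the period `H`. The free `k` is kept for the later adjustment
  -- to an exponent that also works modulo q^t.
  exponent-mod-p : ∀ ε i j u → i ℕ.≤ s → PClass ε i u → ∃ λ r → ∀ k →
    (+ u) ≡ + (p ℕ.^ i) ℤ.* (+ (q ℕ.^ j) ℤ.* twist ε ℤ.* (+ l) ℤ.^ (r ℕ.+ H ℕ.* k)) [mod p ℕ.^ s ]
  exponent-mod-p ε i j u i≤s (v , ≡.refl , c) = cases i≤s c (i ℕ.≟ s)
    where
    cases : ∀ {i} → i ℕ.≤ s → (i ℕ.< s → Class ε (+ v)) → Dec (i ≡ s) → ∃ λ r → ∀ k → (+ (p ℕ.^ i ℕ.* v)) ≡
      + (p ℕ.^ i) ℤ.* (+ (q ℕ.^ j) ℤ.* twist ε ℤ.* (+ l) ℤ.^ (r ℕ.+ H ℕ.* k)) [mod p ℕ.^ s ]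
    -- Both sides vanish modulo p^s, so any exponent will do.
    cases     i≤s c (yes ≡.refl) = 0 , λ k → vanish (p ℕ.^ s)
    cases {i} i≤s c (no  i≢s)  = let (r , e) = exhaust in r , λ k → multiply (p ℕ.^ i)
        (+ (q ℕ.^ j) ℤ.* twist ε) e (power-periodic l-order-p r k)
      where
      exhaust = l-powers-exhaust-class ε (+ (q ℕ.^ j) ℤ.* twist ε) (+ v)
        (≡.subst (λ δ → Class δ (+ (q ℕ.^ j) ℤ.* twist ε)) (Sign.*-identityˡ ε)
            (Class-* plus ε (Class-q^ j) (Class-twist ε)))
        (c (ℕ.≤∧≢⇒< i≤s i≢s))

  exponent-mod-q : ∀ ε i j u → j ℕ.≤ t → QUnit j u → ∃ λ r → ∀ k →
    (+ u) ≡ + (q ℕ.^ j) ℤ.* (+ (p ℕ.^ i) ℤ.* twist ε ℤ.* (+ l) ℤ.^ (r ℕ.+ φ (q ℕ.^ t) ℕ.* k)) [mod q ℕ.^ t ]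
  exponent-mod-q ε i j u j≤t (w , ≡.refl , c) = cases j≤t c (j ℕ.≟ t)
    where
    cases : ∀ {j} → j ℕ.≤ t → (j ℕ.< t → ¬ q ∣ w) → Dec (j ≡ t) → ∃ λ r → ∀ k → (+ (q ℕ.^ j ℕ.* w)) ≡
      + (q ℕ.^ j) ℤ.* (+ (p ℕ.^ i) ℤ.* twist ε ℤ.* (+ l) ℤ.^ (r ℕ.+ φ (q ℕ.^ t) ℕ.* k)) [mod q ℕ.^ t ]
    cases     j≤t c (yes ≡.refl) = 0 , λ k → vanish (q ℕ.^ t)
    cases {j} j≤t c (no  j≢t)  = let (r , e) = exhaust in r , λ k → multiply (q ℕ.^ j)
        (+ (p ℕ.^ i) ℤ.* twist ε) e (power-periodic l-order-q r k)
      where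
      exhaust = primitive-log (q ℕ.^ t) l-order-q (+ (p ℕ.^ i) ℤ.* twist ε)
          (inv-* (inv-p^ i) (inv-twist-q ε))
        (+ w) (∤⇒inv q-prime t (c (ℕ.≤∧≢⇒< j≤t j≢t)))

  H-nonZero : NonZero H
  H-nonZero = ℕ.>-nonZero (HasOrder.positive l-order-p)

  φ-nonZero : NonZero (φ (q ℕ.^ t))
  φ-nonZero = ℕ.>-nonZero (HasOrder.positive l-order-q)

  p^⊥q^ : ∀ i j → Coprime (p ℕ.^ i) (q ℕ.^ j)
  p^⊥q^ i j = ∤⇒coprime-^ q-prime j (∤-^ q-prime (prime∤prime q-prime p-prime (λ e → p≢q (≡.sym e))) i)

  -- Each prime power admits a whole progression of exponents; the two progressions meet because
  -- their periods are coprime.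
  ∈C⁺ : ∀ ε i j u → i ℕ.≤ s → j ℕ.≤ t → PClass ε i u → QUnit j u → u ∈C rep ε i j
  ∈C⁺ ε i j u i≤s j≤t cp cq =
    let (r₁ , e₁) = exponent-mod-p ε i j u i≤s cp
        (r₂ , e₂) = exponent-mod-q ε i j u j≤t cq
        (k₁ , k₂ , e) = common-exponent H (φ (q ℕ.^ t)) {{H-nonZero}} {{φ-nonZero}} orders-coprime r₁ r₂
    in r₁ ℕ.+ H ℕ.* k₁ , mod-combine (p^⊥q^ s t)
      (mod-trans (e₁ k₁) (mod-reflexive (≡.sym (γ-factor-p ε i j (r₁ ℕ.+ H ℕ.* k₁)))))
      (mod-trans (e₂ k₂) (mod-reflexive (≡.trans (≡.sym (γ-factor-q ε i j (r₂ ℕ.+ φ (q ℕ.^ t) ℕ.* k₂)))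
        (≡.cong (λ r → rep ε i j ℤ.* (+ l) ℤ.^ r) (≡.sym e)))))

  -- After division by p^i the cofactor is q^j times the twist times a power of `l`. As `q` and `l`
  -- are residues, the twist alone determines the class.
  ∈C⁻-p : ∀ ε i j u → i ℕ.≤ s → u ∈C rep ε i j → PClass ε i u
  ∈C⁻-p ε i j u i≤s (r , e) =
    let (v , u≡ , v≡) = divide-congruence p i≤s (mod-trans
          (mod-weaken (ℕ∣.m∣m*n (q ℕ.^ t)) e) (mod-reflexive (γ-factor-p ε i j r)))
    in v , u≡ , λ i<s → Class-cong ε (mod-sym (v≡ i<s))
      (≡.subst (λ δ → Class δ (+ (q ℕ.^ j) ℤ.* twist ε ℤ.* (+ l) ℤ.^ r))
          (≡.trans (Sign.*-identityʳ _) (Sign.*-identityˡ ε))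
        (Class-* (plus Sign.* ε) plus (Class-* plus ε (Class-q^ j) (Class-twist ε)) (Class-^ r Class-l)))

  ∈C⁻-q : ∀ ε i j u → j ℕ.≤ t → u ∈C rep ε i j → QUnit j u
  ∈C⁻-q ε i j u j≤t (r , e) =
    let (w , u≡ , w≡) = divide-congruence q j≤t (mod-trans
          (mod-weaken (ℕ∣.n∣m*n (p ℕ.^ s)) e) (mod-reflexive (γ-factor-q ε i j r)))
    in w , u≡ , λ j<t → inv⇒∤ q-prime (inv-cong (mod-sym (w≡ j<t))
      (inv-weaken (^-∣-self 1≤t) (inv-* (inv-* (inv-p^ i) (inv-twist-q ε))
          (inv-^ r (inv-order l-order-q)))))

ordered-mod-unique : ∀ {m x y} → y ℕ.≤ x → x ℕ.< m → (+ x) ≡ + y [mod m ] → x ≡ y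
ordered-mod-unique {m} {x} {y} y≤x x<m e = cases (x ℕ.∸ y) ≡.refl
  where
  m∣x∸y : m ∣ x ℕ.∸ y
  m∣x∸y = ≡.subst (m ∣_) (≡.cong ℤ.∣_∣ (≡.trans (ℤ.m-n≡m⊖n x y) (ℤ.⊖-≥ y≤x))) (ℤ∣.∣⇒∣ᵤ (difference e))
  cases : ∀ d → x ℕ.∸ y ≡ d → x ≡ y
  cases zero    eq = ℕ.≤-antisym (ℕ.m∸n≡0⇒m≤n eq) y≤x
  cases (suc d) eq = ⊥-elim (ℕ∣.>⇒∤ (≡.subst (ℕ._< m) eq (ℕ.≤-<-trans (ℕ.m∸n≤m x y) x<m))
    (≡.subst (m ∣_) eq m∣x∸y))

mod-unique : ∀ {m x y} → x ℕ.< m → y ℕ.< m → (+ x) ≡ + y [mod m ] → x ≡ y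
mod-unique {m} {x} {y} x<m y<m e with ℕ.≤-total x y
... | inj₁ x≤y = ≡.sym (ordered-mod-unique x≤y y<m (mod-sym e))
... | inj₂ y≤x = ordered-mod-unique y≤x x<m e

-- Sums over the quadratic classes modulo p

module ClassSums {s t p q l : ℕ} {g : ℤ} (hypotheses : Hypotheses s t p q l g)
                 {c ℓ} (R : CommutativeRing c ℓ) where
  open Hypotheses hypotheses
  open CosetCharacterisation hypotheses
  open CommutativeRing R
  open Sums R
  open import Relation.Binary.Reasoning.Setoid setoid

  class-indicator : Sign → ℕ → Carrier
  class-indicator ε x = ind (Class? ε (+ x))

  Class⇒∤ : ∀ ε {x} → Class ε (+ x) → ¬ p ∣ x
  Class⇒∤ ε c = inv⇒∤ p-prime (Class⇒inv ε c)

  ∤⇒Class : ∀ {x} → ¬ p ∣ x → ∃ λ ε → Class ε (+ x)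
  ∤⇒Class {x} p∤x = class (+ x) (≡.subst (λ m → Inv m (+ x)) (ℕ.^-identityʳ p) (∤⇒inv p-prime 1 p∤x))

  class-partition : ∀ x → class-indicator plus x + class-indicator minus x + ind (p ∣? x) ≈ 1#
  class-partition x with p ∣? x
  ... | yes p∣x = begin
    class-indicator plus x + class-indicator minus x + 1#
      ≈⟨ +-congʳ (+-cong (ind-no (Class? plus (+ x)) (λ c → Class⇒∤ plus c p∣x))
                         (ind-no (Class? minus (+ x)) (λ c → Class⇒∤ minus c p∣x))) ⟩
    0# + 0# + 1#  ≈⟨ trans (+-congʳ (+-identityˡ 0#)) (+-identityˡ 1#) ⟩
    1#            ∎
  ... | no p∤x = trans (+-identityʳ _) (cases (∤⇒Class p∤x))
    where
    cases : (∃ λ ε → Class ε (+ x)) → class-indicator plus x + class-indicator minus x ≈ 1#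
    cases (plus , c) = trans (+-cong (ind-yes (Class? plus (+ x)) c)
      (ind-no (Class? minus (+ x)) (λ d → proj₂ d (proj₂ c)))) (+-identityʳ 1#)
    cases (minus , c) = trans (+-cong (ind-no (Class? plus (+ x)) (λ d → proj₂ c (proj₂ d)))
      (ind-yes (Class? minus (+ x)) c)) (+-identityˡ 1#)

  -- Multiplication by `a` permutes the units modulo `p` and multiplies their classes by δ. Over the
  -- integers this compares the sizes of the classes, over `K` it relates Gauss periods.
  class-multiply : ∀ δ a → Class δ (+ a) → ∀ ε (w : ℕ → Carrier) →
    S (upTo p) (λ x → class-indicator ε x * w ((a ℕ.* x) % p)) ≈
    S (upTo p) (λ y → class-indicator (δ Sign.* ε) y * w y)
  class-multiply δ a ca ε = S-reindex (λ x → Class? ε (+ x)) (λ y → Class? (δ Sign.* ε) (+ y))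
    p p f f⁻¹ fwd bwd
    where
    a⁻¹ = Inv.inverse (Class⇒inv δ ca)
    a*a⁻¹ : (+ a) ℤ.* a⁻¹ ≡ 1ℤ [mod p ]
    a*a⁻¹ = Inv.*inverse (Class⇒inv δ ca)
    f f⁻¹ : ℕ → ℕ
    f x = (a ℕ.* x) % p
    f⁻¹ y = (a⁻¹ ℤ.* + y) %ℕ p
    f≡ : ∀ x → (+ f x) ≡ + a ℤ.* + x [mod p ]
    f≡ x = mod-trans (mod-sym (%ℕ-mod p (+ (a ℕ.* x)))) (mod-reflexive (ℤ.pos-* a x))
    f⁻¹≡ : ∀ y → (+ f⁻¹ y) ≡ a⁻¹ ℤ.* + y [mod p ]
    f⁻¹≡ y = mod-sym (%ℕ-mod p (a⁻¹ ℤ.* + y))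
    a*f⁻¹ : ∀ y → (+ a) ℤ.* + f⁻¹ y ≡ + y [mod p ]
    a*f⁻¹ y = mod-trans (mod-*-cong (mod-refl {a = + a}) (f⁻¹≡ y))
      (mod-trans (mod-reflexive (≡.sym (ℤ.*-assoc (+ a) a⁻¹ (+ y))))
        (mod-trans (mod-*-cong a*a⁻¹ (mod-refl {a = + y})) (mod-reflexive (ℤ.*-identityˡ (+ y)))))
    fwd : ∀ x → x ℕ.< p → Class ε (+ x) → f x ℕ.< p × Class (δ Sign.* ε) (+ f x) × f⁻¹ (f x) ≡ x
    fwd x x<p cx = m%n<n (a ℕ.* x) p , Class-cong (δ Sign.* ε) (mod-sym (f≡ x)) (Class-* δ ε ca cx) ,
      mod-unique (n%ℕd<d (a⁻¹ ℤ.* + f x) p) x<p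
        (mod-*-cancelˡ (Class⇒inv δ ca) (mod-trans (a*f⁻¹ (f x)) (f≡ x)))
    bwd : ∀ y → y ℕ.< p → Class (δ Sign.* ε) (+ y) → f⁻¹ y ℕ.< p × Class ε (+ f⁻¹ y) × f (f⁻¹ y) ≡ y
    bwd y y<p cy = n%ℕd<d (a⁻¹ ℤ.* + y) p , class-f⁻¹ ,
      mod-unique (m%n<n (a ℕ.* f⁻¹ y) p) y<p (mod-trans (f≡ (f⁻¹ y)) (a*f⁻¹ y))
      where
      inv-f⁻¹ : Inv p (+ f⁻¹ y)
      inv-f⁻¹ = inv-factor (+ f⁻¹ y) (inv-cong (mod-trans (mod-sym (a*f⁻¹ y))
        (mod-reflexive (ℤ.*-comm (+ a) (+ f⁻¹ y)))) (Class⇒inv (δ Sign.* ε) cy))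
      class-f⁻¹ : Class ε (+ f⁻¹ y)
      -- The preimage has some class ε′; multiplying back by `a` gives δ ε′ = δ ε, and δ cancels.
      class-f⁻¹ = let (ε′ , c) = class (+ f⁻¹ y) inv-f⁻¹ in
        ≡.subst (λ ε → Class ε (+ f⁻¹ y)) (Sign.*-cancelˡ-≡ δ ε′ ε (Class-unique (δ Sign.* ε′) (δ Sign.* ε)
          (Class-cong (δ Sign.* ε′) (a*f⁻¹ y) (Class-* δ ε′ ca c)) cy)) c

module _ {s t p q l : ℕ} {g : ℤ} (hypotheses : Hypotheses s t p q l g) where
  open Hypotheses hypotheses
  open CosetCharacterisation hypotheses
  private module ℤClass = ClassSums hypotheses ℤ.+-*-commutativeRing

  classSize : Sign → ℕ
  classSize ε = length (filter (λ x → Class? ε (+ x)) (upTo p))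

  -- Multiplication by the nonresidue `g` exchanges the two classes, so they have equal size;
  -- together with the class of 0 they fill the `p` residues.
  classSize-value : ∀ ε → classSize ε ≡ (p ℕ.∸ 1) / 2
  classSize-value ε = ≡.trans (half (classSize ε)) (≡.cong (λ x → (x ℕ.∸ 1) / 2) total)
    where
    open ≡-Reasoning
    size-sum : ∀ ε → + classSize ε ≡ ℤS (upTo p) (λ x → ℤClass.class-indicator ε x ℤ.* 1ℤ)
    size-sum ε = length-filter-as-sum (λ x → Class? ε (+ x)) (upTo p)
    g′ : ℕ
    g′ = g %ℕ p
    Class-g′ : Class minus (+ g′)
    Class-g′ = Class-cong minus (%ℕ-mod p g) Class-g
    sizes-equal : ∀ ε → classSize ε ≡ classSize (opposite ε)
    sizes-equal ε = ℤ.+-injective (≡.trans (size-sum ε) (≡.trans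
      (ℤClass.class-multiply minus g′ Class-g′ ε (λ _ → 1ℤ)) (≡.sym (size-sum (opposite ε)))))
    multiples : ℤS (upTo p) (λ x → ℤind (p ∣? x) ℤ.* 1ℤ) ≡ 1ℤ
    multiples = ℤSums.S-single (p ∣?_) p (λ _ → 1ℤ) 0 (ℕ.>-nonZero⁻¹ p) (ℕ∣._∣0 p)
      (λ { zero _ _ → ≡.refl ; (suc k) k<p p∣k → ⊥-elim (ℕ∣.>⇒∤ k<p p∣k) })
    sum : classSize plus ℕ.+ classSize minus ℕ.+ 1 ≡ p
    sum = ℤ.+-injective (begin
      + (classSize plus ℕ.+ classSize minus ℕ.+ 1)
        ≡⟨ ≡.trans (ℤ.pos-+ (classSize plus ℕ.+ classSize minus) 1)
             (≡.cong (λ z → z ℤ.+ 1ℤ) (ℤ.pos-+ (classSize plus) (classSize minus))) ⟩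
      + classSize plus ℤ.+ + classSize minus ℤ.+ 1ℤ
        ≡⟨ ≡.cong₂ ℤ._+_ (≡.cong₂ ℤ._+_ (size-sum plus) (size-sum minus)) (≡.sym multiples) ⟩
      ℤS (upTo p) (weight plus) ℤ.+ ℤS (upTo p) (weight minus) ℤ.+ ℤS (upTo p) zero-weight
        ≡⟨ ≡.trans (≡.cong (λ z → z ℤ.+ ℤS (upTo p) zero-weight)
             (≡.sym (ℤSums.S-+ (upTo p) (weight plus) (weight minus))))
             (≡.sym (ℤSums.S-+ (upTo p) (λ x → weight plus x ℤ.+ weight minus x) zero-weight)) ⟩
      ℤS (upTo p) (λ x → weight plus x ℤ.+ weight minus x ℤ.+ zero-weight x)
        ≡⟨ ℤSums.S-cong (upTo p) (λ {x} _ → ≡.trans (lem (ℤClass.class-indicator plus x)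
             (ℤClass.class-indicator minus x) (ℤind (p ∣? x))) (ℤClass.class-partition x)) ⟩
      ℤS (upTo p) (λ _ → 1ℤ)
        ≡⟨ length-as-sum (upTo p) ⟨
      + length (upTo p)
        ≡⟨ ≡.cong +_ (List.length-upTo p) ⟩
      + p ∎)
      where
      weight : Sign → ℕ → ℤ
      weight ε x = ℤClass.class-indicator ε x ℤ.* 1ℤ
      zero-weight : ℕ → ℤ
      zero-weight x = ℤind (p ∣? x) ℤ.* 1ℤ
      lem : ∀ a b c → a ℤ.* 1ℤ ℤ.+ b ℤ.* 1ℤ ℤ.+ c ℤ.* 1ℤ ≡ a ℤ.+ b ℤ.+ c
      lem = solve-∀
    half : ∀ m → m ≡ (m ℕ.* 2 ℕ.+ 1 ℕ.∸ 1) / 2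
    half m = ≡.sym (≡.trans (≡.cong (_/ 2) (ℕ.m+n∸n≡m (m ℕ.* 2) 1)) (ℕ.m*n/n≡m m 2))
    total : classSize ε ℕ.* 2 ℕ.+ 1 ≡ p
    total = ≡.trans (twice ε) sum
      where
      double : ∀ m → m ℕ.* 2 ℕ.+ 1 ≡ m ℕ.+ m ℕ.+ 1
      double = ℕSolver.solve-∀
      twice : ∀ ε → classSize ε ℕ.* 2 ℕ.+ 1 ≡ classSize plus ℕ.+ classSize minus ℕ.+ 1
      twice plus  = ≡.trans (double (classSize plus))
        (≡.cong (λ n → classSize plus ℕ.+ n ℕ.+ 1) (sizes-equal plus))
      twice minus = ≡.trans (double (classSize minus))
        (≡.cong (λ n → n ℕ.+ classSize minus ℕ.+ 1) (sizes-equal minus))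

-- The cyclic algebra and its primitive idempotents

module ExtensionFieldProperties {l : ℕ} {c ℓ} (l-prime : Prime l) (K : ExtensionField l c ℓ) where
  open ExtensionField K
  open import Relation.Binary.Reasoning.Setoid setoid
  open PolynomialProperties commutativeRing
  module K[x] = Polynomial commutativeRing
  open Polynomial (ℤ/ l) hiding (eval)
  private
    module F = PolynomialProperties (ℤ/ l)
    module 𝔽 = CommutativeRing (ℤ/ l)
  open RingMorphisms.IsRingHomomorphism ι-hom public
    using () renaming (⟦⟧-cong to ι-cong; +-homo to ι-+; *-homo to ι-*; -‿homo to ι-neg; 0#-homo to ι-0;
        1#-homo to ι-1)

  private
    -- The integers modulo `l` have the integers themselves as carrier, so `ι` is also a
    -- homomorphism from the integers. This supplies integer coefficients for ring identities in
    -- `K`.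
    ι-morphism : CommutativeRing.rawRing ℤ.+-*-commutativeRing -Raw-AlmostCommutative⟶ fromCommutativeRing
        commutativeRing
    ι-morphism = record
      { ⟦_⟧ = ι ; +-homo = ι-+ ; *-homo = ι-* ; -‿homo = ι-neg ; 0-homo = ι-0 ; 1-homo = ι-1 }

  ι-≡ : ∀ {a b} → a ≡ b → ι a ≈ ι b
  ι-≡ e = reflexive (≡.cong ι e)

  module Solver = RingSolver (CommutativeRing.rawRing ℤ.+-*-commutativeRing)
    (fromCommutativeRing commutativeRing) ι-morphism (λ a b → Maybe.map ι-≡ (dec⇒maybe (a ℤ.≟ b)))

  evalAt : Poly → Carrier → Carrier
  evalAt f x = K[x].eval (map ι f) x

  coeff-map : ∀ f k → K[x].coeff (map ι f) k ≈ ι (coeff f k)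
  coeff-map []      k       = sym ι-0
  coeff-map (a ∷ f) zero    = refl
  coeff-map (a ∷ f) (suc k) = coeff-map f k

  map-cong : ∀ f g → f ≋ g → map ι f K[x].≋ map ι g
  map-cong f g p k = trans (coeff-map f k) (trans (ι-cong (p k)) (sym (coeff-map g k)))

  map-⊕ : ∀ f g → map ι (f ⊕ g) K[x].≋ map ι f K[x].⊕ map ι g
  map-⊕ f g k = begin
    K[x].coeff (map ι (f ⊕ g)) k                          ≈⟨ coeff-map (f ⊕ g) k ⟩
    ι (coeff (f ⊕ g) k)                                   ≈⟨ ι-cong (F.coeff-⊕ f g k) ⟩
    ι (coeff f k ℤ.+ coeff g k)                           ≈⟨ ι-+ _ _ ⟩
    ι (coeff f k) + ι (coeff g k)                         ≈⟨ +-cong (coeff-map f k) (coeff-map g k) ⟨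
    K[x].coeff (map ι f) k + K[x].coeff (map ι g) k       ≈⟨ coeff-⊕ (map ι f) (map ι g) k ⟨
    K[x].coeff (map ι f K[x].⊕ map ι g) k                 ∎

  map-⊗ : ∀ f g → map ι (f ⊗ g) K[x].≋ map ι f K[x].⊗ map ι g
  map-⊗ []      g k = refl
  map-⊗ (a ∷ f) g zero = begin
    K[x].coeff (map ι ((a ∷ f) ⊗ g)) 0                    ≈⟨ coeff-map ((a ∷ f) ⊗ g) 0 ⟩
    ι (coeff ((a ∷ f) ⊗ g) 0)                             ≈⟨ ι-cong (F.coeff-∷⊗-zero a f g) ⟩
    ι (a ℤ.* coeff g 0)                                   ≈⟨ ι-* a _ ⟩
    ι a * ι (coeff g 0)                                   ≈⟨ *-congˡ (coeff-map g 0) ⟨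
    ι a * K[x].coeff (map ι g) 0                          ≈⟨ coeff-∷⊗-zero (ι a) (map ι f) (map ι g) ⟨
    K[x].coeff (map ι (a ∷ f) K[x].⊗ map ι g) 0           ∎
  map-⊗ (a ∷ f) g (suc k) = begin
    K[x].coeff (map ι ((a ∷ f) ⊗ g)) (suc k)
      ≈⟨ coeff-map ((a ∷ f) ⊗ g) (suc k) ⟩
    ι (coeff ((a ∷ f) ⊗ g) (suc k))
      ≈⟨ ι-cong (F.coeff-∷⊗-suc a f g k) ⟩
    ι (a ℤ.* coeff g (suc k) ℤ.+ coeff (f ⊗ g) k)
      ≈⟨ trans (ι-+ _ _) (+-congʳ (ι-* a _)) ⟩
    ι a * ι (coeff g (suc k)) + ι (coeff (f ⊗ g) k)
      ≈⟨ +-cong (*-congˡ (coeff-map g (suc k))) (trans (sym (map-⊗ f g k)) (coeff-map (f ⊗ g) k)) ⟨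
    ι a * K[x].coeff (map ι g) (suc k) + K[x].coeff (map ι f K[x].⊗ map ι g) k
      ≈⟨ coeff-∷⊗-suc (ι a) (map ι f) (map ι g) k ⟨
    K[x].coeff (map ι (a ∷ f) K[x].⊗ map ι g) (suc k)
      ∎

  evalAt-cong : ∀ f g x → f ≋ g → evalAt f x ≈ evalAt g x
  evalAt-cong f g x p = eval-cong (map ι f) (map ι g) x (map-cong f g p)

  evalAt-⊕ : ∀ f g x → evalAt (f ⊕ g) x ≈ evalAt f x + evalAt g x
  evalAt-⊕ f g x = trans (eval-cong (map ι (f ⊕ g)) (map ι f K[x].⊕ map ι g) x (map-⊕ f g))
      (eval-⊕ (map ι f) (map ι g) x)

  evalAt-⊗ : ∀ f g x → evalAt (f ⊗ g) x ≈ evalAt f x * evalAt g x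
  evalAt-⊗ f g x = trans (eval-cong (map ι (f ⊗ g)) (map ι f K[x].⊗ map ι g) x (map-⊗ f g))
      (eval-⊗ (map ι f) (map ι g) x)

  evalAt-∙ : ∀ a f x → evalAt (a ∙ f) x ≈ ι a * evalAt f x
  evalAt-∙ a []      x = sym (zeroʳ (ι a))
  evalAt-∙ a (b ∷ f) x = trans (+-cong (ι-* a b) (*-congˡ (evalAt-∙ a f x)))
    (solve 4 (λ a b x u → a :* b :+ x :* (a :* u) := a :* (b :+ x :* u)) refl (ι a) (ι b) x (evalAt f x))
    where open Solver

  evalAt-neg : ∀ f x → evalAt (map ℤ.-_ f) x ≈ - evalAt f x
  evalAt-neg []      x = sym (RingProperties.-0#≈0# ring)
  evalAt-neg (b ∷ f) x = trans (+-cong (ι-neg b) (*-congˡ (evalAt-neg f x)))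
    (solve 3 (λ b x u → :- b :+ x :* (:- u) := :- (b :+ x :* u)) refl (ι b) x (evalAt f x))
    where open Solver

  evalAt-⊖ : ∀ f g x → evalAt (f ⊖ g) x ≈ evalAt f x - evalAt g x
  evalAt-⊖ f g x = trans (evalAt-⊕ f (map ℤ.-_ g) x) (+-congˡ (evalAt-neg g x))

  evalAt-X^ : ∀ k x → evalAt (X^ k) x ≈ x ^ k
  evalAt-X^ zero    x = trans (+-cong ι-1 (zeroʳ x)) (+-identityʳ 1#)
  evalAt-X^ (suc k) x = trans (+-cong ι-0 (*-congˡ (evalAt-X^ k x))) (+-identityˡ _)

  open Sums commutativeRing

  evalAt-∑ : ∀ ks f x → evalAt (∑ ks f) x ≈ S ks (λ k → evalAt (f k) x)
  evalAt-∑ []       f x = refl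
  evalAt-∑ (k ∷ ks) f x = trans (evalAt-⊕ (f k) (∑ ks f) x) (+-congˡ (evalAt-∑ ks f x))

  S-ones : ∀ ks → S ks (λ _ → 1#) ≈ ι (+ length ks)
  S-ones []       = sym ι-0
  S-ones (k ∷ ks) = trans (+-cong (sym ι-1) (S-ones ks)) (sym (ι-+ 1ℤ (+ length ks)))

  difference-zero : ∀ {x y} → x - y ≈ 0# → x ≈ y
  difference-zero {x} {y} d = begin
    x            ≈⟨ solve 2 (λ x y → x := (x :- y) :+ y) refl x y ⟩
    x - y + y    ≈⟨ trans (+-congʳ d) (+-identityˡ y) ⟩
    y            ∎
    where open Solver

  unit-cancel : ∀ {a b} → (∃ λ a⁻¹ → a⁻¹ * a ≈ 1#) → a * b ≈ 0# → b ≈ 0#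
  unit-cancel {a} {b} (a⁻¹ , e) ab≈0 = begin
    b              ≈⟨ *-identityˡ b ⟨
    1# * b         ≈⟨ *-congʳ e ⟨
    a⁻¹ * a * b    ≈⟨ *-assoc a⁻¹ a b ⟩
    a⁻¹ * (a * b)  ≈⟨ trans (*-congˡ ab≈0) (zeroʳ a⁻¹) ⟩
    0#             ∎

  zero? : ∀ a → a ≈ 0# ⊎ (∃ λ a⁻¹ → a⁻¹ * a ≈ 1#)
  zero? a with IsField.zero⊎unit isField a
  ... | inj₁ a≈0           = inj₁ a≈0
  ... | inj₂ (a⁻¹ , e , _) = inj₂ (a⁻¹ , e)

  nonzero-cancel : ∀ {a b} → ¬ a ≈ 0# → a * b ≈ 0# → b ≈ 0#
  nonzero-cancel {a} a≉0 ab≈0 with zero? a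
  ... | inj₁ a≈0 = ⊥-elim (a≉0 a≈0)
  ... | inj₂ u   = unit-cancel u ab≈0

  ι-recip : ∀ d → Coprime d l → ι (recip l d) * ι (+ d) ≈ 1#
  ι-recip d d⊥l = trans (sym (ι-* (recip l d) (+ d))) (trans (ι-cong (recip-inverse l d d⊥l)) ι-1)

  -- A nonzero residue modulo the prime `l` has a reciprocal; if it were sent to 0, then 0 and 1
  -- would agree in `K`.
  ι-injective : ∀ a → ι a ≈ 0# → a ≡ 0ℤ [mod l ]
  ι-injective a ιa≈0 = cases (l ∣? (a %ℕ l))
    where
    instance _ = prime⇒nonZero l-prime
    cases : Dec (l ∣ a %ℕ l) → a ≡ 0ℤ [mod l ]
    cases (yes l∣) = mod-trans (%ℕ-mod l a) (∣⇒≡0 l∣)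
    cases (no l∤)  = ⊥-elim (IsField.0≉1 isField
        (trans (sym (trans (*-congˡ (trans (sym (ι-cong (%ℕ-mod l a))) ιa≈0)) (zeroʳ _)))
      (ι-recip (a %ℕ l) (≡.subst (Coprime (a %ℕ l)) (ℕ.^-identityʳ l) (∤⇒coprime-^ l-prime 1 l∤)))))

  open SemiringExp semiring using (^-homo-*; ^-assocʳ; ^-congˡ) public

  one-^ : ∀ k → 1# ^ k ≈ 1#
  one-^ zero    = refl
  one-^ (suc k) = trans (*-identityˡ _) (one-^ k)

  -- Either `z - 1` is zero and every term is 1, or it is invertible and can be cancelled from the
  -- geometric series identity. The case is returned along with the value, to be read as a
  -- divisibility later.
  S-root-of-unity : ∀ z N → z ^ N ≈ 1# → (z ≈ 1# × S (upTo N) (z ^_) ≈ ι (+ N)) ⊎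
      (¬ z ≈ 1# × S (upTo N) (z ^_) ≈ 0#)
  S-root-of-unity z N z^N≈1 with zero? (z - 1#)
  ... | inj₁ e = inj₁ (z≈1 , (begin
      S (upTo N) (z ^_)        ≈⟨ S-cong (upTo N) (λ {k} _ → trans (^-congˡ k z≈1) (one-^ k)) ⟩
      S (upTo N) (λ _ → 1#)    ≈⟨ S-ones (upTo N) ⟩
      ι (+ length (upTo N))    ≈⟨ ι-≡ (≡.cong +_ (List.length-upTo N)) ⟩
      ι (+ N)                  ∎))
    where
    z≈1 = difference-zero e
  ... | inj₂ u = inj₂ ((λ z≈1 → IsField.0≉1 isField
      (trans (sym (trans (*-congˡ (trans (+-congʳ z≈1) (-‿inverseʳ 1#))) (zeroʳ _))) (proj₂ u))) ,
    unit-cancel u (trans (S-geometric z N) (trans (+-congʳ z^N≈1) (-‿inverseʳ 1#))))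

-- Reduction modulo x^n - 1

module CyclicReduction {c ℓ} (R : CommutativeRing c ℓ) where
  open CommutativeRing R
  open Polynomial R
  open PolynomialProperties R
  open Sums R
  open RingProperties ring using (-1*x≈-x)
  open import Algebra.Properties.Semiring.Exp semiring using (_^_)
  open import Relation.Binary.Reasoning.Setoid setoid

  eval-as-sum : ∀ f N x → length f ℕ.≤ N → eval f x ≈ S (upTo N) (λ k → coeff f k * x ^ k)
  eval-as-sum []      N       x _         = sym (trans (S-cong (upTo N) (λ _ → zeroˡ _)) (S-zero (upTo N)))
  eval-as-sum (a ∷ f) (suc N) x (s≤s f≤N) = begin
    a + x * eval f x
      ≈⟨ +-cong (sym (*-identityʳ a)) (trans (*-congˡ (eval-as-sum f N x f≤N)) (sym (S-*ˡ x (upTo N) _))) ⟩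
    a * 1# + S (upTo N) (λ k → x * (coeff f k * x ^ k))
      ≈⟨ +-congˡ (S-cong (upTo N) (λ {k} _ → trans (sym (*-assoc _ _ _))
           (trans (*-congʳ (*-comm x _)) (*-assoc _ _ _)))) ⟩
    a * 1# + S (upTo N) (λ k → coeff f k * (x * x ^ k))
      ≈⟨ S-upTo-0∷ N (λ k → coeff (a ∷ f) k * x ^ k) ⟨
    S (upTo (suc N)) (λ k → coeff (a ∷ f) k * x ^ k)
      ∎

  length-⊕ : ∀ f g {N} → length f ℕ.≤ N → length g ℕ.≤ N → length (f ⊕ g) ℕ.≤ N
  length-⊕ []      g       _       q       = q
  length-⊕ (a ∷ f) []      p       _       = p
  length-⊕ (a ∷ f) (b ∷ g) (s≤s p) (s≤s q) = s≤s (length-⊕ f g p q)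

  zero-tail : ∀ k → coeff (0# ∷ []) k ≈ 0#
  zero-tail zero    = refl
  zero-tail (suc k) = refl

  𝟙⊗ : ∀ f → 𝟙 ⊗ f ≋ f
  𝟙⊗ f k = trans (coeff-⊕ (1# ∙ f) (0# ∷ []) k)
      (trans (+-cong (trans (coeff-∙ 1# f k) (*-identityˡ _)) (zero-tail k)) (+-identityʳ _))

  take-drop : ∀ n f → f ≋ take n f ⊕ (X^ n) ⊗ drop n f
  take-drop zero    f       k = sym (𝟙⊗ f k)
  take-drop (suc n) []      k = sym (⊗-[] (X^ suc n) k)
  take-drop (suc n) (a ∷ f) zero = sym (trans (coeff-⊕ (a ∷ take n f) ((0# ∷ X^ n) ⊗ drop n f) 0)
    (trans (+-congˡ (0∷-⊗ (X^ n) (drop n f) 0)) (+-identityʳ a)))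
  take-drop (suc n) (a ∷ f) (suc k) = begin
    coeff f k
      ≈⟨ trans (take-drop n f k) (coeff-⊕ (take n f) ((X^ n) ⊗ drop n f) k) ⟩
    coeff (take n f) k + coeff ((X^ n) ⊗ drop n f) k
      ≈⟨ +-congˡ (0∷-⊗ (X^ n) (drop n f) (suc k)) ⟨
    coeff (take n f) k + coeff ((0# ∷ X^ n) ⊗ drop n f) (suc k)
      ≈⟨ coeff-⊕ (a ∷ take n f) ((0# ∷ X^ n) ⊗ drop n f) (suc k) ⟨
    coeff ((a ∷ take n f) ⊕ (0# ∷ X^ n) ⊗ drop n f) (suc k)
      ∎

  coeff-⊗[X^n-1] : ∀ n h k → coeff (h ⊗ ((X^ n) ⊖ 𝟙)) k ≈ coeff ((X^ n) ⊗ h) k - coeff h k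
  coeff-⊗[X^n-1] n h k = begin
    coeff (h ⊗ ((X^ n) ⊖ 𝟙)) k
      ≈⟨ ⊗-comm h ((X^ n) ⊖ 𝟙) k ⟩
    coeff (((X^ n) ⊖ 𝟙) ⊗ h) k
      ≈⟨ trans (⊗-distribʳ h (X^ n) (map -_ 𝟙) k) (coeff-⊕ ((X^ n) ⊗ h) (map -_ 𝟙 ⊗ h) k) ⟩
    coeff ((X^ n) ⊗ h) k + coeff (map -_ 𝟙 ⊗ h) k
      ≈⟨ +-congˡ (trans (coeff-⊕ (- 1# ∙ h) (0# ∷ []) k)
           (trans (+-cong (trans (coeff-∙ (- 1#) h k) (-1*x≈-x _)) (zero-tail k)) (+-identityʳ _))) ⟩
    coeff ((X^ n) ⊗ h) k - coeff h k
      ∎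

  -- f = lo + x^n hi = (lo + hi) + (x^n - 1) hi, and hi is shorter than f.
  reduce : ∀ n .{{_ : NonZero n}} b f → length f ℕ.≤ b →
           ∃ λ h → ∃ λ r → length r ℕ.≤ n × f ≋ r ⊕ h ⊗ ((X^ n) ⊖ 𝟙)
  reduce n b       []      _         = [] , [] , z≤n , λ k → refl
  reduce n (suc b) f@(a ∷ f′) (s≤s f′≤b) =
    let hi = drop n f
        lo = take n f
        (h , r , r≤n , e) = reduce n b hi (ℕ.≤-trans (shorter n) f′≤b)
    in hi ⊕ h , lo ⊕ r , length-⊕ lo r (ℕ.≤-trans (ℕ.≤-reflexive (List.length-take n f))
        (ℕ.m⊓n≤m n (length f))) r≤n ,
       λ k → begin
         coeff f k
           ≈⟨ trans (take-drop n f k) (coeff-⊕ lo ((X^ n) ⊗ hi) k) ⟩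
         coeff lo k + coeff ((X^ n) ⊗ hi) k
           ≈⟨ +-congˡ (add-subtract (coeff ((X^ n) ⊗ hi) k) (coeff hi k)) ⟩
         coeff lo k + ((coeff ((X^ n) ⊗ hi) k - coeff hi k) + coeff hi k)
           ≈⟨ +-congˡ (+-cong (coeff-⊗[X^n-1] n hi k)
                (sym (trans (e k) (coeff-⊕ r (h ⊗ ((X^ n) ⊖ 𝟙)) k)))) ⟨
         coeff lo k + (coeff (hi ⊗ ((X^ n) ⊖ 𝟙)) k + (coeff r k + coeff (h ⊗ ((X^ n) ⊖ 𝟙)) k))
           ≈⟨ solve 4 (λ a b c d → a :+ (b :+ (c :+ d)) := (a :+ c) :+ (b :+ d)) refl _ _ _ _ ⟩
         (coeff lo k + coeff r k) + (coeff (hi ⊗ ((X^ n) ⊖ 𝟙)) k + coeff (h ⊗ ((X^ n) ⊖ 𝟙)) k)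
           ≈⟨ +-cong (coeff-⊕ lo r k) (trans (⊗-distribʳ ((X^ n) ⊖ 𝟙) hi h k)
                (coeff-⊕ (hi ⊗ ((X^ n) ⊖ 𝟙)) (h ⊗ ((X^ n) ⊖ 𝟙)) k)) ⟨
         coeff (lo ⊕ r) k + coeff ((hi ⊕ h) ⊗ ((X^ n) ⊖ 𝟙)) k
           ≈⟨ coeff-⊕ (lo ⊕ r) ((hi ⊕ h) ⊗ ((X^ n) ⊖ 𝟙)) k ⟨
         coeff ((lo ⊕ r) ⊕ (hi ⊕ h) ⊗ ((X^ n) ⊖ 𝟙)) k
           ∎
    where
    open import Algebra.Solver.Ring.NaturalCoefficients.Default commutativeSemiring using
        (solve; _:+_; _:=_)
    shorter : ∀ n .{{_ : NonZero n}} → length (drop n f) ℕ.≤ length f′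
    shorter (suc n) = ℕ.≤-trans (ℕ.≤-reflexive (List.length-drop n f′)) (ℕ.m∸n≤m (length f′) n)
    add-subtract : ∀ x y → x ≈ (x - y) + y
    add-subtract x y = sym (trans (+-assoc x (- y) y) (trans (+-congˡ (-‿inverseˡ y)) (+-identityʳ x)))

-- Values at the n-th roots of unity

module CyclicProperties {l n : ℕ} .{{n-nonZero : NonZero n}} (l-prime : Prime l) (n⊥l : Coprime n l)
  {c ℓ} (K : ExtensionField l c ℓ) (α : ExtensionField.Carrier K)
  (α-primitive : CyclicAlgebra.IsPrimitiveRootOfUnity l n K α) where

  open ExtensionField K hiding (zero)
  open CyclicAlgebra l n hiding (evalAt; eval)
  open ExtensionFieldProperties l-prime K
  open PolynomialProperties commutativeRing
  open Sums commutativeRing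
  open import Relation.Binary.Reasoning.Setoid setoid
  private
    module F = PolynomialProperties (ℤ/ l)
    module R = CyclicReduction (ℤ/ l)

  α^-multiple : ∀ {a} → n ∣ a → α ^ a ≈ 1#
  α^-multiple (divides d ≡.refl) = begin
    α ^ (d ℕ.* n)   ≡⟨ ≡.cong (α ^_) (ℕ.*-comm d n) ⟩
    α ^ (n ℕ.* d)   ≈⟨ ^-assocʳ α n d ⟨
    (α ^ n) ^ d     ≈⟨ trans (^-congˡ d (proj₁ α-primitive)) (one-^ d) ⟩
    1#              ∎

  α^-% : ∀ a → α ^ a ≈ α ^ (a % n)
  α^-% a = begin
    α ^ a                                ≡⟨ ≡.cong (α ^_) (m≡m%n+[m/n]*n a n) ⟩
    α ^ (a % n ℕ.+ a / n ℕ.* n)          ≈⟨ ^-homo-* α (a % n) (a / n ℕ.* n) ⟩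
    α ^ (a % n) * α ^ (a / n ℕ.* n)      ≈⟨ *-congˡ (α^-multiple (ℕ∣.n∣m*n (a / n))) ⟩
    α ^ (a % n) * 1#                     ≈⟨ *-identityʳ _ ⟩
    α ^ (a % n)                          ∎

  α^≈1⇒∣ : ∀ a → α ^ a ≈ 1# → n ∣ a
  α^≈1⇒∣ a e = cases (a % n) ≡.refl
    where
    cases : ∀ r → a % n ≡ r → n ∣ a
    cases zero    eq = m%n≡0⇒n∣m a n eq
    cases (suc r) eq = ⊥-elim (proj₂ α-primitive (suc r) (s≤s z≤n) (≡.subst (ℕ._< n) eq (m%n<n a n))
      (trans (sym (trans (α^-% a) (reflexive (≡.cong (α ^_) eq)))) e))

  α^-cong : ∀ {a b} → (+ a) ≡ + b [mod n ] → α ^ a ≈ α ^ b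
  α^-cong {a} {b} e = begin
    α ^ a         ≈⟨ α^-% a ⟩
    α ^ (a % n)   ≡⟨ ≡.cong (α ^_) (mod-unique (m%n<n a n) (m%n<n b n)
                       (mod-trans (mod-sym (%ℕ-mod n (+ a))) (mod-trans e (%ℕ-mod n (+ b))))) ⟩
    α ^ (b % n)   ≈⟨ α^-% b ⟨
    α ^ b         ∎

  α-unit : ∀ u → ∃ λ β → β * α ^ u ≈ 1#
  -- The exponent n u - u is a natural number that represents -u modulo `n`.
  α-unit u = α ^ (n ℕ.* u ℕ.∸ u) , (begin
    α ^ (n ℕ.* u ℕ.∸ u) * α ^ u       ≈⟨ ^-homo-* α (n ℕ.* u ℕ.∸ u) u ⟨
    α ^ (n ℕ.* u ℕ.∸ u ℕ.+ u)         ≡⟨ ≡.cong (α ^_) (ℕ.m∸n+n≡m (ℕ.m≤n*m u n)) ⟩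
    α ^ (n ℕ.* u)                     ≈⟨ α^-multiple (ℕ∣.m∣m*n u) ⟩
    1#                                ∎)

  α^-injective : ∀ a b → α ^ a ≈ α ^ b → (+ a) ≡ + b [mod n ]
  α^-injective a b e = mod-trans (%ℕ-mod n (+ a)) (mod-trans (mod-reflexive (≡.cong +_ r≡))
      (mod-sym (%ℕ-mod n (+ b))))
    where
    d = n ℕ.* b ℕ.∸ b
    n∣b+d : n ∣ b ℕ.+ d
    n∣b+d = ≡.subst (n ∣_) (≡.sym (≡.trans (ℕ.+-comm b d) (ℕ.m∸n+n≡m (ℕ.m≤n*m b n)))) (ℕ∣.m∣m*n b)
    n∣a+d : n ∣ a ℕ.+ d
    n∣a+d = α^≈1⇒∣ (a ℕ.+ d) (trans (^-homo-* α a d) (trans (*-congʳ e)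
      (trans (sym (^-homo-* α b d)) (α^-multiple n∣b+d))))
    r≡ : a % n ≡ b % n
    r≡ = mod-unique (m%n<n a n) (m%n<n b n) (mod-trans (mod-sym (%ℕ-mod n (+ a)))
      (mod-trans (cancel (mod-trans (∣⇒≡0 n∣a+d) (mod-sym (∣⇒≡0 n∣b+d)))) (%ℕ-mod n (+ b))))
      where
      cancel : (+ (a ℕ.+ d)) ≡ + (b ℕ.+ d) [mod n ] → (+ a) ≡ + b [mod n ]
      cancel e = mod-trans (mod-reflexive (lem a)) (mod-trans (mod-+-cong e (mod-refl {a = ℤ.- (+ d)}))
          (mod-reflexive (≡.sym (lem b))))
        where
        lem : ∀ x → + x ≡ + (x ℕ.+ d) ℤ.+ ℤ.- (+ d)
        lem x = ≡.sym (≡.trans (≡.cong (λ z → z ℤ.- + d) (ℤ.pos-+ x d))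
          (≡.trans (ℤ.+-assoc (+ x) (+ d) (ℤ.- (+ d)))
              (≡.trans (≡.cong (λ z → + x ℤ.+ z) (ℤ.+-inverseʳ (+ d))) (ℤ.+-identityʳ (+ x)))))

  -- The number of terms is not fixed to be `n`, since sums over the multiples of a divisor of `n`
  -- lead to shorter series.
  orthogonality : ∀ N e → n ∣ e ℕ.* N → S (upTo N) ((α ^ e) ^_) ≈ ι (+ N) * ind (n ∣? e)
  orthogonality N e n∣eN with S-root-of-unity (α ^ e) N (trans (^-assocʳ α e N) (α^-multiple n∣eN))
  ... | inj₁ (α^e≈1 , sum) = trans sum
      (sym (trans (*-congˡ (ind-yes (n ∣? e) (α^≈1⇒∣ e α^e≈1))) (*-identityʳ _)))
  ... | inj₂ (α^e≉1 , sum) = trans sum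
      (sym (trans (*-congˡ (ind-no (n ∣? e) (λ n∣e → α^e≉1 (α^-multiple n∣e)))) (zeroʳ _)))

  root-of-X^n-1 : ∀ u → evalAt X^n-1 (α ^ u) ≈ 0#
  root-of-X^n-1 u = begin
    evalAt X^n-1 (α ^ u)                                 ≈⟨ evalAt-⊖ (X^ n) 𝟙 (α ^ u) ⟩
    evalAt (X^ n) (α ^ u) - evalAt (X^ 0) (α ^ u)
      ≈⟨ +-cong (trans (evalAt-X^ n (α ^ u)) (trans (^-assocʳ α u n) (α^-multiple (ℕ∣.n∣m*n u))))
           (-‿cong (evalAt-X^ 0 (α ^ u))) ⟩
    1# - 1#                                              ≈⟨ -‿inverseʳ 1# ⟩
    0#                                                   ∎

  ≃⇒evalAt : ∀ f f′ → f ≃ f′ → ∀ u → evalAt f (α ^ u) ≈ evalAt f′ (α ^ u)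
  ≃⇒evalAt f f′ (h , e) u = begin
    evalAt f (α ^ u)
      ≈⟨ trans (evalAt-cong f (f′ ⊕ h ⊗ X^n-1) (α ^ u) e) (evalAt-⊕ f′ (h ⊗ X^n-1) (α ^ u)) ⟩
    evalAt f′ (α ^ u) + evalAt (h ⊗ X^n-1) (α ^ u)
      ≈⟨ +-congˡ (trans (evalAt-⊗ h X^n-1 (α ^ u)) (trans (*-congˡ (root-of-X^n-1 u)) (zeroʳ _))) ⟩
    evalAt f′ (α ^ u) + 0#
      ≈⟨ +-identityʳ _ ⟩
    evalAt f′ (α ^ u)
      ∎

  -- Inverse discrete Fourier transform.
  coefficients-vanish : ∀ r → length r ℕ.≤ n → (∀ u → evalAt r (α ^ u) ≈ 0#) → r ≋ []
  coefficients-vanish r r≤n vanish k with k ℕ.<? n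
  ... | no  k≮n = mod-reflexive (beyond r k (ℕ.≤-trans r≤n (ℕ.≮⇒≥ k≮n)))
    where
    beyond : ∀ f k → length f ℕ.≤ k → coeff f k ≡ 0ℤ
    beyond []      k       _       = ≡.refl
    beyond (a ∷ f) (suc k) (s≤s p) = beyond f k p
  -- `n` is a unit because it is coprime to `l`, and `n` times the coefficient at `k` is the sum
  -- over `u` of r(α^u) α^(-uk), where every term is zero.
  ... | yes k<n = ι-injective (coeff r k) (unit-cancel (ι (recip l n) , ι-recip n n⊥l) (begin
    ι (+ n) * ι (coeff r k)
      ≈⟨ *-congˡ (coeff-map r k) ⟨
    ι (+ n) * ρ k
      ≈⟨ S-single (λ m → m ℕ.≟ k) n (λ m → ι (+ n) * ρ m) k k<n ≡.refl (λ _ _ e → e) ⟨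
    S (upTo n) (λ m → ind (m ℕ.≟ k) * (ι (+ n) * ρ m))
      ≈⟨ S-upTo-cong n (λ m m<n → trans (column m m<n) (*-comm _ _)) ⟨
    S (upTo n) (λ m → ρ m * S (upTo n) (λ u → (α ^ shift m) ^ u))
      ≈⟨ S-cong (upTo n) (λ _ → sym (S-*ˡ _ (upTo n) _)) ⟩
    S (upTo n) (λ m → S (upTo n) (λ u → ρ m * (α ^ shift m) ^ u))
      ≈⟨ S-swap (upTo n) (upTo n) _ ⟩
    S (upTo n) (λ u → S (upTo n) (λ m → ρ m * (α ^ shift m) ^ u))
      ≈⟨ S-cong (upTo n) (λ {u} _ → row u) ⟩
    S (upTo n) (λ _ → 0#)
      ≈⟨ S-zero (upTo n) ⟩
    0# ∎))
    where
    ρ : ℕ → Carrier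
    ρ = K[x].coeff (map ι r)
    shift : ℕ → ℕ
    -- Stands for m - k modulo `n`.
    shift m = m ℕ.+ (n ℕ.∸ k)
    n∣shift⇒≡ : ∀ m → m ℕ.< n → n ∣ shift m → m ≡ k
    n∣shift⇒≡ m m<n d = mod-unique m<n k<n (mod-trans (mod-reflexive (lem m))
      (mod-trans (mod-+-cong (∣⇒≡0 {a = shift m} d) (mod-refl {a = + k ℤ.- + n}))
        (mod-trans (mod-reflexive (ℤ.+-identityˡ (+ k ℤ.- + n)))
            (mod-trans (mod-+-cong (mod-refl {a = + k}) (mod-neg-cong (∣⇒≡0 {a = n} ℕ∣.∣-refl)))
          (mod-reflexive (ℤ.+-identityʳ (+ k)))))))
      where
      lem : ∀ m → + m ≡ + shift m ℤ.+ (+ k ℤ.- + n)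
      lem m = ≡.sym (≡.trans (≡.cong (λ z → z ℤ.+ (+ k ℤ.- + n))
          (≡.trans (ℤ.pos-+ m (n ℕ.∸ k))
          (≡.cong (λ z → + m ℤ.+ z) (≡.sym (≡.trans (ℤ.m-n≡m⊖n n k) (ℤ.⊖-≥ (ℕ.<⇒≤ k<n)))))))
        (lem′ (+ m) (+ n) (+ k)))
        where
        lem′ : ∀ m n k → m ℤ.+ (n ℤ.- k) ℤ.+ (k ℤ.- n) ≡ m
        lem′ = solve-∀
    ≡⇒n∣shift : ∀ m → m ≡ k → n ∣ shift m
    ≡⇒n∣shift m ≡.refl = ℕ∣.∣-reflexive (≡.sym (ℕ.m+[n∸m]≡n (ℕ.<⇒≤ k<n)))
    column : ∀ m → m ℕ.< n → ρ m * S (upTo n) (λ u → (α ^ shift m) ^ u) ≈ (ι (+ n) * ρ m) * ind (m ℕ.≟ k)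
    column m m<n = begin
      ρ m * S (upTo n) ((α ^ shift m) ^_)
        ≈⟨ *-congˡ (trans (orthogonality n (shift m) (ℕ∣.n∣m*n (shift m)))
             (*-congˡ (ind-cong (n ∣? shift m) (m ℕ.≟ k) (n∣shift⇒≡ m m<n) (≡⇒n∣shift m)))) ⟩
      ρ m * (ι (+ n) * ind (m ℕ.≟ k))
        ≈⟨ trans (sym (*-assoc _ _ _)) (*-congʳ (*-comm _ _)) ⟩
      (ι (+ n) * ρ m) * ind (m ℕ.≟ k)
        ∎
    power : ∀ u m → (α ^ shift m) ^ u ≈ (α ^ u) ^ m * α ^ (u ℕ.* (n ℕ.∸ k))
    power u m = begin
      (α ^ shift m) ^ u                            ≈⟨ ^-assocʳ α (shift m) u ⟩
      α ^ (shift m ℕ.* u)                          ≡⟨ ≡.cong (α ^_) (≡.trans (ℕ.*-comm (shift m) u)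
          (ℕ.*-distribˡ-+ u m (n ℕ.∸ k))) ⟩
      α ^ (u ℕ.* m ℕ.+ u ℕ.* (n ℕ.∸ k))            ≈⟨ ^-homo-* α (u ℕ.* m) (u ℕ.* (n ℕ.∸ k)) ⟩
      α ^ (u ℕ.* m) * α ^ (u ℕ.* (n ℕ.∸ k))        ≈⟨ *-congʳ (^-assocʳ α u m) ⟨
      (α ^ u) ^ m * α ^ (u ℕ.* (n ℕ.∸ k))          ∎
    row : ∀ u → S (upTo n) (λ m → ρ m * (α ^ shift m) ^ u) ≈ 0#
    row u = begin
      S (upTo n) (λ m → ρ m * (α ^ shift m) ^ u)
        ≈⟨ S-cong (upTo n) (λ {m} _ → trans (*-congˡ (power u m)) (sym (*-assoc _ _ _))) ⟩
      S (upTo n) (λ m → ρ m * (α ^ u) ^ m * α ^ (u ℕ.* (n ℕ.∸ k)))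
        ≈⟨ S-*ʳ _ (upTo n) _ ⟩
      S (upTo n) (λ m → ρ m * (α ^ u) ^ m) * α ^ (u ℕ.* (n ℕ.∸ k))
        ≈⟨ *-congʳ (CyclicReduction.eval-as-sum commutativeRing (map ι r) n (α ^ u)
             (ℕ.≤-trans (ℕ.≤-reflexive (List.length-map ι r)) r≤n)) ⟨
      evalAt r (α ^ u) * α ^ (u ℕ.* (n ℕ.∸ k))
        ≈⟨ trans (*-congʳ (vanish u)) (zeroˡ _) ⟩
      0#
        ∎

  -- The remainder of the difference has at most `n` coefficients and vanishes at all powers of `α`,
  -- hence is zero; the quotient is the witness `h`.
  evalAt⇒≃ : ∀ f f′ → (∀ u → evalAt f (α ^ u) ≈ evalAt f′ (α ^ u)) → f ≃ f′
  evalAt⇒≃ f f′ agree = finish (R.reduce n (length (f ⊖ f′)) (f ⊖ f′) ℕ.≤-refl)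
    where
    module 𝔽 = CommutativeRing (ℤ/ l)
    finish : (∃ λ h → ∃ λ r → length r ℕ.≤ n × f ⊖ f′ ≋ r ⊕ h ⊗ X^n-1) → f ≃ f′
    finish (h , r , r≤n , e) = h , λ k → 𝔽.trans (𝔽.reflexive (lem (coeff f k) (coeff f′ k)))
      (𝔽.trans (𝔽.+-cong (𝔽.refl {coeff f′ k}) (𝔽.trans (𝔽.sym (F.coeff-⊖ f f′ k))
          (𝔽.trans (e k) (𝔽.trans (F.coeff-⊕ r (h ⊗ X^n-1) k)
        (𝔽.trans (𝔽.+-cong (r≋[] k) 𝔽.refl) (𝔽.+-identityˡ _))))))
        (𝔽.sym (F.coeff-⊕ f′ (h ⊗ X^n-1) k)))
      where
      lem : ∀ x y → x ≡ y ℤ.+ (x ℤ.- y)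
      lem = solve-∀
      r≋[] : r ≋ []
      r≋[] = coefficients-vanish r r≤n λ u → begin
        evalAt r (α ^ u)                          ≈⟨ +-identityʳ _ ⟨
        evalAt r (α ^ u) + 0#                     ≈⟨ +-congˡ (trans (evalAt-⊗ h X^n-1 (α ^ u))
            (trans (*-congˡ (root-of-X^n-1 u)) (zeroʳ _))) ⟨
        evalAt r (α ^ u) + evalAt (h ⊗ X^n-1) (α ^ u)
          ≈⟨ trans (evalAt-cong (f ⊖ f′) (r ⊕ h ⊗ X^n-1) (α ^ u) e) (evalAt-⊕ r (h ⊗ X^n-1) (α ^ u)) ⟨
        evalAt (f ⊖ f′) (α ^ u)                   ≈⟨ evalAt-⊖ f f′ (α ^ u) ⟩
        evalAt f (α ^ u) - evalAt f′ (α ^ u)      ≈⟨ trans (+-congʳ (agree u)) (-‿inverseʳ _) ⟩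
        0#                                        ∎

  -- A linear factor x - a with a a unit can be cancelled: compare coefficients from degree 0 upwards.
  linear-cancel : ∀ {a} → (∃ λ a⁻¹ → a⁻¹ * a ≈ 1#) → ∀ f g →
    ((- a) ∷ 1# ∷ []) K[x].⊗ f K[x].≋ ((- a) ∷ 1# ∷ []) K[x].⊗ g → f K[x].≋ g
  linear-cancel {a} a-unit f g e = λ k → difference-zero (step k)
    where
    open Solver
    L = (- a) ∷ 1# ∷ []
    coeff-L-zero : ∀ f → K[x].coeff (L K[x].⊗ f) 0 ≈ - a * K[x].coeff f 0
    coeff-L-zero f = coeff-∷⊗-zero (- a) (1# ∷ []) f
    coeff-L-suc : ∀ f k → K[x].coeff (L K[x].⊗ f) (suc k) ≈ - a * K[x].coeff f (suc k) + K[x].coeff f k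
    coeff-L-suc f k = trans (coeff-∷⊗-suc (- a) (1# ∷ []) f k)
        (+-congˡ (CyclicReduction.𝟙⊗ commutativeRing f k))
    step : ∀ k → K[x].coeff f k - K[x].coeff g k ≈ 0#
    step zero = unit-cancel a-unit (begin
      a * (K[x].coeff f 0 - K[x].coeff g 0)
        ≈⟨ solve 3 (λ a x y → a :* (x :- y) := (:- a :* y) :- (:- a :* x)) refl a _ _ ⟩
      - a * K[x].coeff g 0 - - a * K[x].coeff f 0
        ≈⟨ +-cong (coeff-L-zero g) (-‿cong (coeff-L-zero f)) ⟨
      K[x].coeff (L K[x].⊗ g) 0 - K[x].coeff (L K[x].⊗ f) 0
        ≈⟨ trans (+-congˡ (-‿cong (e 0))) (-‿inverseʳ _) ⟩
      0# ∎)
    step (suc k) = unit-cancel a-unit (begin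
      a * (K[x].coeff f (suc k) - K[x].coeff g (suc k))
        ≈⟨ solve 5 (λ a x y x′ y′ → a :* (x :- y) := ((:- a :* y :+ y′) :- (:- a :* x :+ x′)) :+ (x′ :- y′))
             refl a _ _ _ _ ⟩
      ((- a * K[x].coeff g (suc k) + K[x].coeff g k) - (- a * K[x].coeff f (suc k) + K[x].coeff f k)) +
          (K[x].coeff f k - K[x].coeff g k)
        ≈⟨ +-congʳ (+-cong (coeff-L-suc g k) (-‿cong (coeff-L-suc f k))) ⟨
      (K[x].coeff (L K[x].⊗ g) (suc k) - K[x].coeff (L K[x].⊗ f) (suc k)) +
          (K[x].coeff f k - K[x].coeff g k)
        ≈⟨ +-cong (trans (+-congˡ (-‿cong (e (suc k)))) (-‿inverseʳ _)) (step k) ⟩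
      0# + 0#
        ≈⟨ +-identityʳ 0# ⟩
      0# ∎)

  linear : ℕ → K[x].Poly
  linear u = (- (α ^ u)) ∷ 1# ∷ []

  ∏-cancel : ∀ us f g → K[x].∏ us linear K[x].⊗ f K[x].≋ K[x].∏ us linear K[x].⊗ g → f K[x].≋ g
  ∏-cancel []       f g e k = trans (sym (𝟙⊗ f k)) (trans (e k) (𝟙⊗ g k))
    where open CyclicReduction commutativeRing using (𝟙⊗)
  ∏-cancel (u ∷ us) f g e = ∏-cancel us f g (linear-cancel (α-unit u)
    (K[x].∏ us linear K[x].⊗ f) (K[x].∏ us linear K[x].⊗ g) λ k → trans
    (sym (⊗-assoc (linear u) (K[x].∏ us linear) f k))
        (trans (e k) (⊗-assoc (linear u) (K[x].∏ us linear) g k)))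

  eval-linear : ∀ v x → K[x].eval (linear v) x ≈ x - α ^ v
  eval-linear v x = trans (+-congˡ (*-congˡ (trans (+-congˡ (zeroʳ x)) (+-identityʳ 1#))))
    (trans (+-congˡ (*-identityʳ x)) (+-comm _ _))

  ∏-root : ∀ us v x → v ∈ us → x ≈ α ^ v → K[x].eval (K[x].∏ us linear) x ≈ 0#
  ∏-root (u ∷ us) v x (here ≡.refl) x≈ = trans (eval-⊗ (linear u) (K[x].∏ us linear) x)
    (trans (*-congʳ (trans (eval-linear u x) (trans (+-congʳ x≈) (-‿inverseʳ _)))) (zeroˡ _))
  ∏-root (u ∷ us) v x (there v∈) x≈ = trans (eval-⊗ (linear u) (K[x].∏ us linear) x)
    (trans (*-congˡ (∏-root us v x v∈ x≈)) (zeroʳ _))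

  -- Phrased as a cancellation law, so that the nonzero factors are removed one after another.
  ∏-nonroot : ∀ us x → (∀ {v} → v ∈ us → ¬ x ≈ α ^ v) →
    ∀ y → K[x].eval (K[x].∏ us linear) x * y ≈ 0# → y ≈ 0#
  ∏-nonroot []       x _      y e = trans (sym (trans (*-congʳ (trans (+-congˡ (zeroʳ x)) (+-identityʳ 1#)))
      (*-identityˡ y))) e
  ∏-nonroot (u ∷ us) x avoids y e = ∏-nonroot us x (avoids ∘ there) y
    (nonzero-cancel (λ d → avoids (here ≡.refl) (difference-zero (trans (sym (eval-linear u x)) d)))
      (trans (sym (*-assoc _ _ y)) (trans (*-congʳ (sym (eval-⊗ (linear u) (K[x].∏ us linear) x))) e)))

  module _ {γ : ℤ} (∈C? : ∀ u → Dec (u ∈C γ)) (m : MinimalPolynomial K α γ) where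
    open MinimalPolynomial m

    ∈C-cong : ∀ {u v} → (+ u) ≡ + v [mod n ] → u ∈C γ → v ∈C γ
    ∈C-cong e (r , e′) = r , mod-trans (mod-sym e) e′

    u≡u%n : ∀ u → (+ u) ≡ + (u % n) [mod n ]
    u≡u%n u = %ℕ-mod n (+ u)

    eval-M : ∀ u → evalAt M (α ^ u) ≈ K[x].eval (K[x].∏ (coset γ) linear) (α ^ u)
    eval-M u = eval-cong (map ι M) (K[x].∏ (coset γ) linear) (α ^ u) M≋∏

    -- The product defining `M` runs over representatives below `n`, so `u` is first replaced by its
    -- remainder.
    M-vanishes : ∀ u → u ∈C γ → evalAt M (α ^ u) ≈ 0#
    M-vanishes u u∈ = trans (eval-M u) (∏-root (coset γ) (u % n) (α ^ u)
      (Equivalence.from (∈-coset γ (m%n<n u n)) (∈C-cong (u≡u%n u) u∈)) (α^-cong (u≡u%n u)))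

    cofactor*M : ∀ u → evalAt cofactor (α ^ u) * evalAt M (α ^ u) ≈ 0#
    cofactor*M u = trans (sym (evalAt-⊗ cofactor M (α ^ u)))
      (trans (evalAt-cong (cofactor ⊗ M) X^n-1 (α ^ u) cofactor⊗M≋) (root-of-X^n-1 u))

    -- α^u is a root of x^n - 1, the product of `cofactor` and `M`, but of no linear factor of `M`.
    cofactor-vanishes : ∀ u → ¬ u ∈C γ → evalAt cofactor (α ^ u) ≈ 0#
    cofactor-vanishes u u∉ = ∏-nonroot (coset γ) (α ^ u) avoids (evalAt cofactor (α ^ u))
      (trans (*-congʳ (sym (eval-M u))) (trans (*-comm _ _) (cofactor*M u)))
      where
      avoids : ∀ {v} → v ∈ coset γ → ¬ α ^ u ≈ α ^ v
      avoids {v} v∈ e with ∈-filter⁻ _ {xs = upTo n} v∈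
      ... | v∈upTo , _ = u∉ (∈C-cong (mod-sym (α^-injective u v e))
          (Equivalence.to (∈-coset γ (∈-upTo⁻ v∈upTo)) v∈))

    -- M e vanishes at every power of α, hence M e = h (xⁿ - 1) = h cofactor M.
    zero-off-C⇒∈⟨cofactor⟩ : ∀ e → (∀ u → ¬ u ∈C γ → evalAt e (α ^ u) ≈ 0#) →
      ∃ λ h → ∀ u → evalAt e (α ^ u) ≈ evalAt (h ⊗ cofactor) (α ^ u)
    zero-off-C⇒∈⟨cofactor⟩ e zero-off = finish (evalAt⇒≃ (M ⊗ e) [] vanish)
      where
      vanish : ∀ u → evalAt (M ⊗ e) (α ^ u) ≈ 0#
      vanish u with ∈C? u
      ... | yes u∈ = trans (evalAt-⊗ M e (α ^ u)) (trans (*-congʳ (M-vanishes u u∈)) (zeroˡ _))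
      ... | no  u∉ = trans (evalAt-⊗ M e (α ^ u)) (trans (*-congˡ (zero-off u u∉)) (zeroʳ _))
      finish : (M ⊗ e) ≃ [] → ∃ λ h → ∀ u → evalAt e (α ^ u) ≈ evalAt (h ⊗ cofactor) (α ^ u)
      finish (h , q) = h , λ u → eval-cong (map ι e) (map ι (h ⊗ cofactor)) (α ^ u)
          (∏-cancel (coset γ) (map ι e) (map ι (h ⊗ cofactor)) λ k → begin
          K[x].coeff (∏M K[x].⊗ map ι e) k
            ≈⟨ ⊗-congʳ (map ι M) ∏M (map ι e) M≋∏ k ⟨
          K[x].coeff (map ι M K[x].⊗ map ι e) k
            ≈⟨ map-⊗ M e k ⟨
          K[x].coeff (map ι (M ⊗ e)) k
            ≈⟨ map-cong (M ⊗ e) (M ⊗ (h ⊗ cofactor)) rearrange k ⟩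
          K[x].coeff (map ι (M ⊗ (h ⊗ cofactor))) k
            ≈⟨ map-⊗ M (h ⊗ cofactor) k ⟩
          K[x].coeff (map ι M K[x].⊗ map ι (h ⊗ cofactor)) k
            ≈⟨ ⊗-congʳ (map ι M) ∏M (map ι (h ⊗ cofactor)) M≋∏ k ⟩
          K[x].coeff (∏M K[x].⊗ map ι (h ⊗ cofactor)) k
            ∎)
        where
        module 𝔽 = CommutativeRing (ℤ/ l)
        ∏M = K[x].∏ (coset γ) linear
        rearrange : M ⊗ e ≋ M ⊗ (h ⊗ cofactor)
        rearrange k = 𝔽.trans (q k) (𝔽.trans (F.⊗-congˡ h X^n-1 (cofactor ⊗ M) (λ k → 𝔽.sym (cofactor⊗M≋ k))
            k)
          (𝔽.trans (𝔽.sym (F.⊗-assoc h cofactor M k)) (F.⊗-comm (h ⊗ cofactor) M k)))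

    -- The ideals agree because each generator is a multiple of the other: `e` vanishes off the
    -- coset and is therefore a multiple of `cofactor`, while `cofactor` also vanishes there and is
    -- unchanged by multiplication with `e`.
    primitive-idempotent : ∀ e → (∀ u → u ∈C γ → evalAt e (α ^ u) ≈ 1#) →
      (∀ u → ¬ u ∈C γ → evalAt e (α ^ u) ≈ 0#) → IsPrimitiveIdempotent K α m e
    primitive-idempotent e one zero-off = record
      { idempotent = evalAt⇒≃ (e ⊗ e) e square
      ; generates  = λ f → mk⇔ (to f) (from f)
      ; one-on-C   = one
      ; zero-off-C = zero-off
      }
      where
      square : ∀ u → evalAt (e ⊗ e) (α ^ u) ≈ evalAt e (α ^ u)
      square u with ∈C? u
      ... | yes u∈ = trans (evalAt-⊗ e e (α ^ u)) (trans (*-congʳ (one u u∈)) (*-identityˡ _))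
      ... | no  u∉ = trans (evalAt-⊗ e e (α ^ u))
        (trans (*-congʳ (zero-off u u∉)) (trans (zeroˡ _) (sym (zero-off u u∉))))
      to : ∀ f → f ∈⟨ e ⟩ → f ∈⟨ cofactor ⟩
      to f (a , q) = let (h , e≈) = zero-off-C⇒∈⟨cofactor⟩ e zero-off in
        a ⊗ h , evalAt⇒≃ f ((a ⊗ h) ⊗ cofactor) λ u → begin
          evalAt f (α ^ u)                                       ≈⟨ trans (≃⇒evalAt f (a ⊗ e) q u)
              (evalAt-⊗ a e (α ^ u)) ⟩
          evalAt a (α ^ u) * evalAt e (α ^ u)                    ≈⟨ *-congˡ
              (trans (e≈ u) (evalAt-⊗ h cofactor (α ^ u))) ⟩
          evalAt a (α ^ u) * (evalAt h (α ^ u) * evalAt cofactor (α ^ u))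
            ≈⟨ trans (*-congʳ (evalAt-⊗ a h (α ^ u))) (*-assoc _ _ _) ⟨
          evalAt (a ⊗ h) (α ^ u) * evalAt cofactor (α ^ u)       ≈⟨ evalAt-⊗ (a ⊗ h) cofactor (α ^ u) ⟨
          evalAt ((a ⊗ h) ⊗ cofactor) (α ^ u)                    ∎
      absorb : ∀ u → evalAt cofactor (α ^ u) ≈ evalAt cofactor (α ^ u) * evalAt e (α ^ u)
      absorb u with ∈C? u
      ... | yes u∈ = sym (trans (*-congˡ (one u u∈)) (*-identityʳ _))
      ... | no  u∉ = trans (cofactor-vanishes u u∉) (sym (trans (*-congˡ (zero-off u u∉)) (zeroʳ _)))
      from : ∀ f → f ∈⟨ cofactor ⟩ → f ∈⟨ e ⟩
      from f (a , q) = a ⊗ cofactor , evalAt⇒≃ f ((a ⊗ cofactor) ⊗ e) λ u → begin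
          evalAt f (α ^ u)                                       ≈⟨ trans (≃⇒evalAt f (a ⊗ cofactor) q u)
              (evalAt-⊗ a cofactor (α ^ u)) ⟩
          evalAt a (α ^ u) * evalAt cofactor (α ^ u)             ≈⟨ *-congˡ (absorb u) ⟩
          evalAt a (α ^ u) * (evalAt cofactor (α ^ u) * evalAt e (α ^ u))
            ≈⟨ trans (*-congʳ (evalAt-⊗ a cofactor (α ^ u))) (*-assoc _ _ _) ⟨
          evalAt (a ⊗ cofactor) (α ^ u) * evalAt e (α ^ u)       ≈⟨ evalAt-⊗ (a ⊗ cofactor) e (α ^ u) ⟨
          evalAt ((a ⊗ cofactor) ⊗ e) (α ^ u)                    ∎

    -- Prescribed values at all powers of `α` fix an element of the quotient, so computing the
    -- values of a candidate settles existence and uniqueness at once.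
    idempotent-characterised : ∀ f → (∀ u → evalAt f (α ^ u) ≈ ind (∈C? u)) →
      ∀ e → IsPrimitiveIdempotent K α m e ⇔ e ≃ f
    idempotent-characterised f f≈ e = mk⇔ unique is
      where
      f-one : ∀ u → u ∈C γ → evalAt f (α ^ u) ≈ 1#
      f-one u u∈ = trans (f≈ u) (ind-yes (∈C? u) u∈)
      f-zero : ∀ u → ¬ u ∈C γ → evalAt f (α ^ u) ≈ 0#
      f-zero u u∉ = trans (f≈ u) (ind-no (∈C? u) u∉)
      unique : IsPrimitiveIdempotent K α m e → e ≃ f
      unique p = evalAt⇒≃ e f agree
        where
        open IsPrimitiveIdempotent p
        agree : ∀ u → evalAt e (α ^ u) ≈ evalAt f (α ^ u)
        agree u with ∈C? u
        ... | yes u∈ = trans (one-on-C u u∈) (sym (f-one u u∈))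
        ... | no  u∉ = trans (zero-off-C u u∉) (sym (f-zero u u∉))
      is : e ≃ f → IsPrimitiveIdempotent K α m e
      is q = primitive-idempotent e
        (λ u u∈ → trans (≃⇒evalAt e f q u) (f-one u u∈))
        (λ u u∉ → trans (≃⇒evalAt e f q u) (f-zero u u∉))

-- Transforms of the coefficient functions

module CoefficientSums {s t p q l : ℕ} {g : ℤ} (hypotheses : Hypotheses s t p q l g)
  {c ℓ} (K : ExtensionField l c ℓ) (α : ExtensionField.Carrier K)
  (α-primitive : CyclicAlgebra.IsPrimitiveRootOfUnity l (p ℕ.^ s ℕ.* q ℕ.^ t) K α) where

  open Hypotheses hypotheses
  open CosetCharacterisation hypotheses public
  open ExtensionField K hiding (zero)

  n : ℕ
  n = p ℕ.^ s ℕ.* q ℕ.^ t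

  instance
    n-nonZero : NonZero n
    n-nonZero = ℕ.m*n≢0 (p ℕ.^ s) (q ℕ.^ t)

  l∤p^q^ : ∀ i j → ¬ l ∣ p ℕ.^ i ℕ.* q ℕ.^ j
  l∤p^q^ i j d with euclidsLemma (p ℕ.^ i) (q ℕ.^ j) l-prime d
  ... | inj₁ d = ∤-^ l-prime (prime∤prime l-prime p-prime (λ e → p≢l (≡.sym e))) i d
  ... | inj₂ d = ∤-^ l-prime (prime∤prime l-prime q-prime (λ e → q≢l (≡.sym e))) j d

  ∤⇒coprime-l : ∀ {m} → ¬ l ∣ m → Coprime m l
  ∤⇒coprime-l {m} l∤m = ≡.subst (Coprime m) (ℕ.^-identityʳ l) (∤⇒coprime-^ l-prime 1 l∤m)

  open CyclicProperties l-prime (∤⇒coprime-l (l∤p^q^ s t)) K α α-primitive public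
  open ExtensionFieldProperties l-prime K public
  open ClassSums hypotheses commutativeRing public
  open Sums commutativeRing public
  open import Relation.Binary.Reasoning.Setoid setoid

  P∣ Q∣ : ℕ → ℕ → Carrier
  P∣ a k = ind (p ℕ.^ a ∣? k)
  Q∣ b k = ind (q ℕ.^ b ∣? k)

  -- `A` and `B` are the two factors of the indicator of the coset of `rep ε i j`.
  A : Sign → ℕ → ℕ → Carrier
  A ε i k = ind (PClass? ε i k)

  B : ℕ → ℕ → Carrier
  B j k = ind (QUnit? j k)

  A-multiple : ∀ ε {i} → i ℕ.< s → ∀ v → A ε i (p ℕ.^ i ℕ.* v) ≈ class-indicator ε v
  A-multiple ε {i} i<s v = ind-cong (PClass? ε i (p ℕ.^ i ℕ.* v)) (Class? ε (+ v))
    (λ (v′ , e , c) → ≡.subst (λ v → Class ε (+ v))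
      (≡.sym (ℕ.*-cancelˡ-≡ v v′ (p ℕ.^ i) {{ℕ.m^n≢0 p i}} e)) (c i<s))
    (λ c → v , ≡.refl , λ _ → c)

  A-nonmultiple : ∀ ε {i k} → ¬ p ℕ.^ i ∣ k → A ε i k ≈ 0#
  A-nonmultiple ε {i} {k} d = ind-no (PClass? ε i k)
    (λ (v , e , _) → d (divides v (≡.trans e (ℕ.*-comm (p ℕ.^ i) v))))

  ^-suc-∣ : ∀ π .{{_ : NonZero π}} i {v} → π ℕ.^ suc i ∣ π ℕ.^ i ℕ.* v → π ∣ v
  ^-suc-∣ π i {v} d = ℕ∣.*-cancelˡ-∣ (π ℕ.^ i) {{ℕ.m^n≢0 π i}}
      (≡.subst (_∣ π ℕ.^ i ℕ.* v) (ℕ.*-comm π (π ℕ.^ i)) d)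

  ∣-^-suc : ∀ π i {v} → π ∣ v → π ℕ.^ suc i ∣ π ℕ.^ i ℕ.* v
  ∣-^-suc π i {v} d = ≡.subst (_∣ π ℕ.^ i ℕ.* v) (ℕ.*-comm (π ℕ.^ i) π) (ℕ∣.*-monoʳ-∣ (π ℕ.^ i) d)

  ^-∣-suc : ∀ π i {k} → π ℕ.^ suc i ∣ k → π ℕ.^ i ∣ k
  ^-∣-suc π i d = ℕ∣.∣-trans (ℕ∣.n∣m*n π) d

  -- The two classes together exhaust the numbers with exact p-part p^i; the difference form is what
  -- telescopes over `i`.
  A-sum : ∀ {i} → i ℕ.< s → ∀ k → A plus i k + A minus i k ≈ P∣ i k - P∣ (suc i) k
  A-sum {i} i<s k = cases (p ℕ.^ i ∣? k)
    where
    open Solver using (solve; _:=_; _:+_; _:-_)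
    cases : Dec (p ℕ.^ i ∣ k) → A plus i k + A minus i k ≈ P∣ i k - P∣ (suc i) k
    cases (no d) = trans (+-cong (A-nonmultiple plus d) (A-nonmultiple minus d))
      (sym (+-cong (ind-no (p ℕ.^ i ∣? k) d)
        (trans (-‿cong (ind-no (p ℕ.^ suc i ∣? k) (d ∘ ^-∣-suc p i))) (RingProperties.-0#≈0# ring))))
    cases (yes d@(divides v eq)) with k≡ ← ≡.trans eq (ℕ.*-comm v (p ℕ.^ i)) = begin
      A plus i k + A minus i k
        ≡⟨ ≡.cong (λ k → A plus i k + A minus i k) k≡ ⟩
      A plus i (p ℕ.^ i ℕ.* v) + A minus i (p ℕ.^ i ℕ.* v)
        ≈⟨ +-cong (A-multiple plus i<s v) (A-multiple minus i<s v) ⟩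
      class-indicator plus v + class-indicator minus v
        ≈⟨ solve 3 (λ x y z → x :+ y := (x :+ y :+ z) :- z) refl _ _ (ind (p ∣? v)) ⟩
      class-indicator plus v + class-indicator minus v + ind (p ∣? v) - ind (p ∣? v)
        ≈⟨ +-cong (class-partition v) (-‿cong (ind-cong (p ∣? v) (p ℕ.^ suc i ∣? k)
             (λ e → ≡.subst (p ℕ.^ suc i ∣_) (≡.sym k≡) (∣-^-suc p i e))
             (λ e → ^-suc-∣ p i (≡.subst (p ℕ.^ suc i ∣_) k≡ e)))) ⟩
      1# - P∣ (suc i) k
        ≈⟨ +-congʳ (ind-yes (p ℕ.^ i ∣? k) d) ⟨
      P∣ i k - P∣ (suc i) k
        ∎

  A-top : ∀ k → A plus s k ≈ P∣ s k
  A-top k = ind-cong (PClass? plus s k) (p ℕ.^ s ∣? k)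
    (λ (v , e , _) → divides v (≡.trans e (ℕ.*-comm (p ℕ.^ s) v)))
    (λ (divides v e) → v , ≡.trans e (ℕ.*-comm v (p ℕ.^ s)) , λ s<s → ⊥-elim (ℕ.<-irrefl ≡.refl s<s))

  B-top : ∀ k → B t k ≈ Q∣ t k
  B-top k = ind-cong (QUnit? t k) (q ℕ.^ t ∣? k)
    (λ (v , e , _) → divides v (≡.trans e (ℕ.*-comm (q ℕ.^ t) v)))
    (λ (divides v e) → v , ≡.trans e (ℕ.*-comm v (q ℕ.^ t)) , λ t<t → ⊥-elim (ℕ.<-irrefl ≡.refl t<t))

  B-difference : ∀ {j} → j ℕ.< t → ∀ k → B j k ≈ Q∣ j k - Q∣ (suc j) k
  B-difference {j} j<t k = cases (q ℕ.^ j ∣? k) (q ℕ.^ suc j ∣? k)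
    where
    unit : QUnit j k → q ℕ.^ j ∣ k × ¬ q ℕ.^ suc j ∣ k
    unit (w , ≡.refl , c) = ℕ∣.m∣m*n w , λ d → c j<t (^-suc-∣ q j d)
    cases : Dec (q ℕ.^ j ∣ k) → Dec (q ℕ.^ suc j ∣ k) → B j k ≈ Q∣ j k - Q∣ (suc j) k
    cases (no d) _ = trans (ind-no (QUnit? j k) (d ∘ proj₁ ∘ unit))
      (sym (trans (+-cong (ind-no (q ℕ.^ j ∣? k) d)
        (trans (-‿cong (ind-no (q ℕ.^ suc j ∣? k) (d ∘ ^-∣-suc q j))) (RingProperties.-0#≈0# ring)))
            (+-identityʳ 0#)))
    cases (yes d) (yes d′) = trans (ind-no (QUnit? j k) (λ u → proj₂ (unit u) d′))
      (sym (trans (+-cong (ind-yes (q ℕ.^ j ∣? k) d) (-‿cong (ind-yes (q ℕ.^ suc j ∣? k) d′)))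
          (-‿inverseʳ 1#)))
    cases (yes d@(divides w e)) (no d′) = trans
        (ind-yes (QUnit? j k)
        (w , k≡ , λ _ q∣w → d′ (≡.subst (q ℕ.^ suc j ∣_) (≡.sym k≡) (∣-^-suc q j q∣w))))
      (sym (trans (+-cong (ind-yes (q ℕ.^ j ∣? k) d) (trans (-‿cong (ind-no (q ℕ.^ suc j ∣? k) d′))
          (RingProperties.-0#≈0# ring))) (+-identityʳ 1#)))
      where
      k≡ = ≡.trans e (ℕ.*-comm w (q ℕ.^ j))

  β : Carrier
  β = α ^ (p ℕ.^ (s ℕ.∸ 1) ℕ.* q ℕ.^ t)

  gaussPeriod : Sign → Carrier
  gaussPeriod ε = S (upTo p) (λ x → class-indicator ε x * β ^ x)

  -- The Gauss period with β replaced by β^a. For `a` prime to `p` this is again a Gauss period; for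
  -- `a` divisible by `p` it counts the class.
  twistedPeriod : Sign → ℕ → Carrier
  twistedPeriod ε a = S (upTo p) (λ x → class-indicator ε x * β ^ (x ℕ.* a))

  β^-multiple : ∀ {a} → p ∣ a → β ^ a ≈ 1#
  β^-multiple (divides d ≡.refl) = begin
    β ^ (d ℕ.* p)                                          ≈⟨ ^-assocʳ α (p ℕ.^ (s ℕ.∸ 1) ℕ.* q ℕ.^ t)
        (d ℕ.* p) ⟩
    α ^ (p ℕ.^ (s ℕ.∸ 1) ℕ.* q ℕ.^ t ℕ.* (d ℕ.* p))        ≡⟨ ≡.cong (α ^_) (lem (p ℕ.^ (s ℕ.∸ 1)) (q ℕ.^ t)
        d p) ⟩
    α ^ (d ℕ.* (p ℕ.^ suc (s ℕ.∸ 1) ℕ.* q ℕ.^ t))          ≈⟨ α^-multiple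
        (≡.subst (λ s → n ∣ d ℕ.* (p ℕ.^ s ℕ.* q ℕ.^ t))
                                                                (≡.sym (ℕ.m+[n∸m]≡n 1≤s)) (ℕ∣.n∣m*n d)) ⟩
    1#                                                     ∎
    where
    lem : ∀ P Q d p → P ℕ.* Q ℕ.* (d ℕ.* p) ≡ d ℕ.* (p ℕ.* P ℕ.* Q)
    lem = ℕSolver.solve-∀

  β^-% : ∀ a → β ^ a ≈ β ^ (a % p)
  β^-% a = begin
    β ^ a                                ≡⟨ ≡.cong (β ^_) (m≡m%n+[m/n]*n a p) ⟩
    β ^ (a % p ℕ.+ a / p ℕ.* p)          ≈⟨ ^-homo-* β (a % p) (a / p ℕ.* p) ⟩
    β ^ (a % p) * β ^ (a / p ℕ.* p)      ≈⟨ *-congˡ (β^-multiple (ℕ∣.n∣m*n (a / p))) ⟩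
    β ^ (a % p) * 1#                     ≈⟨ *-identityʳ _ ⟩
    β ^ (a % p)                          ∎

  h : ℤ
  h = + ((p ℕ.∸ 1) / 2)

  twistedPeriod-multiple : ∀ ε {a} → p ∣ a → twistedPeriod ε a ≈ ι h
  twistedPeriod-multiple ε {a} p∣a = begin
    S (upTo p) (λ x → class-indicator ε x * β ^ (x ℕ.* a))    ≈⟨ S-cong (upTo p)
        (λ {x} _ → *-congˡ (β^-multiple (ℕ∣.∣n⇒∣m*n x p∣a))) ⟩
    S (upTo p) (λ x → class-indicator ε x * 1#)               ≈⟨ S-filter (λ x → Class? ε (+ x)) (upTo p)
        (λ _ → 1#) ⟨
    S (filter (λ x → Class? ε (+ x)) (upTo p)) (λ _ → 1#)     ≈⟨ S-ones
        (filter (λ x → Class? ε (+ x)) (upTo p)) ⟩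
    ι (+ classSize hypotheses ε)                              ≈⟨ ι-≡
        (≡.cong +_ (classSize-value hypotheses ε)) ⟩
    ι h                                                       ∎

  twistedPeriod-class : ∀ δ ε {a} → Class δ (+ a) → twistedPeriod ε a ≈ gaussPeriod (δ Sign.* ε)
  twistedPeriod-class δ ε {a} c = trans
    (S-cong (upTo p) (λ {x} _ → *-congˡ (trans (reflexive (≡.cong (β ^_) (ℕ.*-comm x a)))
        (β^-% (a ℕ.* x)))))
    (class-multiply δ a c ε (β ^_))

  -- The p-part of the coefficient of x^k in θ_{ij} (ε = +) or θ*_{ij} (ε = -), where b = s - i - 1.
  pCoefficient : Sign → ℕ → ℕ → Carrier
  pCoefficient ε b k = ι h * P∣ (suc b) k + (gaussPeriod (opposite ε) * A plus b k + gaussPeriod ε * A minus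
      b k)

  -- At most one of the three terms survives: a multiple `a` of `p` yields the class size, and a
  -- unit `a` moves the class of summation by its own sign. The three cases are thus one character
  -- sum, ready for an exchange of summations.
  pCoefficient-multiple : ∀ ε {b} → b ℕ.< s → ∀ a → pCoefficient ε b (p ℕ.^ b ℕ.* a) ≈ twistedPeriod
      (opposite ε) a
  pCoefficient-multiple ε {b} b<s a = trans
    (+-cong (*-congˡ (ind-cong (p ℕ.^ suc b ∣? (p ℕ.^ b ℕ.* a)) (p ∣? a) (^-suc-∣ p b) (∣-^-suc p b)))
      (+-cong (*-congˡ (A-multiple plus b<s a)) (*-congˡ (A-multiple minus b<s a))))
    (cases (p ∣? a))
    where
    open Solver using (solve; _:=_; _:+_; _:*_)
    value : Carrier → Carrier → Carrier → Carrier
    value x y z = ι h * x + (gaussPeriod (opposite ε) * y + gaussPeriod ε * z)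
    value-cong : ∀ {x y z x′ y′ z′} → x ≈ x′ → y ≈ y′ → z ≈ z′ → value x y z ≈ value x′ y′ z′
    value-cong e f g = +-cong (*-congˡ e) (+-cong (*-congˡ f) (*-congˡ g))
    cases : Dec (p ∣ a) → value (ind (p ∣? a)) (class-indicator plus a) (class-indicator minus a) ≈
        twistedPeriod (opposite ε) a
    cases (yes p∣a) = begin
      value (ind (p ∣? a)) (class-indicator plus a) (class-indicator minus a)
        ≈⟨ value-cong (ind-yes (p ∣? a) p∣a) (ind-no (Class? plus (+ a)) (λ c → Class⇒∤ plus c p∣a))
             (ind-no (Class? minus (+ a)) (λ c → Class⇒∤ minus c p∣a)) ⟩
      value 1# 0# 0#
        ≈⟨ trans (+-cong (*-identityʳ _) (trans (+-cong (zeroʳ _) (zeroʳ _)) (+-identityʳ 0#)))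
             (+-identityʳ _) ⟩
      ι h
        ≈⟨ twistedPeriod-multiple (opposite ε) p∣a ⟨
      twistedPeriod (opposite ε) a
        ∎
    cases (no p∤a) = by-class (∤⇒Class p∤a)
      where
      by-class : (∃ λ δ → Class δ (+ a)) →
        value (ind (p ∣? a)) (class-indicator plus a) (class-indicator minus a) ≈ twistedPeriod (opposite ε)
            a
      by-class (plus , c) = begin
        value (ind (p ∣? a)) (class-indicator plus a) (class-indicator minus a)
          ≈⟨ value-cong (ind-no (p ∣? a) p∤a) (ind-yes (Class? plus (+ a)) c)
               (ind-no (Class? minus (+ a)) (λ d → proj₂ d (proj₂ c))) ⟩
        value 0# 1# 0#
          ≈⟨ trans (+-cong (zeroʳ _) (trans (+-cong (*-identityʳ _) (zeroʳ _)) (+-identityʳ _)))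
               (+-identityˡ _) ⟩
        gaussPeriod (opposite ε)
          ≡⟨ ≡.cong gaussPeriod (≡.sym (Sign.*-identityˡ (opposite ε))) ⟩
        gaussPeriod (plus Sign.* opposite ε)
          ≈⟨ twistedPeriod-class plus (opposite ε) c ⟨
        twistedPeriod (opposite ε) a
          ∎
      by-class (minus , c) = begin
        value (ind (p ∣? a)) (class-indicator plus a) (class-indicator minus a)
          ≈⟨ value-cong (ind-no (p ∣? a) p∤a) (ind-no (Class? plus (+ a)) (λ d → proj₂ c (proj₂ d)))
               (ind-yes (Class? minus (+ a)) c) ⟩
        value 0# 0# 1#
          ≈⟨ trans (+-cong (zeroʳ _) (trans (+-cong (zeroʳ _) (*-identityʳ _)) (+-identityˡ _)))
               (+-identityˡ _) ⟩
        gaussPeriod ε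
          ≡⟨ ≡.cong gaussPeriod (negate ε) ⟩
        gaussPeriod (minus Sign.* opposite ε)
          ≈⟨ twistedPeriod-class minus (opposite ε) c ⟨
        twistedPeriod (opposite ε) a
          ∎
        where
        negate : ∀ ε → ε ≡ minus Sign.* opposite ε
        negate plus  = ≡.refl
        negate minus = ≡.refl

  pCoefficient-nonmultiple : ∀ ε {b k} → ¬ p ℕ.^ b ∣ k → pCoefficient ε b k ≈ 0#
  pCoefficient-nonmultiple ε {b} {k} d = trans
    (+-cong (trans (*-congˡ (ind-no (p ℕ.^ suc b ∣? k) (d ∘ ^-∣-suc p b))) (zeroʳ _))
      (+-cong (trans (*-congˡ (A-nonmultiple plus d)) (zeroʳ _)) (trans (*-congˡ (A-nonmultiple minus d))
          (zeroʳ _))))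
    (trans (+-identityˡ _) (+-identityˡ 0#))

  private
    -- The solution below `p` of q^t x + v = 0 modulo `p`.
    quotientBy-q^t : ℕ → ℕ
    quotientBy-q^t v = (Inv.inverse (Class⇒inv plus (Class-q^ t)) ℤ.* ℤ.- (+ v)) %ℕ p

    quotient<p : ∀ v → quotientBy-q^t v ℕ.< p
    quotient<p v = n%ℕd<d (Inv.inverse (Class⇒inv plus (Class-q^ t)) ℤ.* ℤ.- (+ v)) p

    q^t*quotient : ∀ v → (+ (q ℕ.^ t)) ℤ.* + quotientBy-q^t v ≡ ℤ.- (+ v) [mod p ]
    q^t*quotient v = mod-trans (mod-*-cong (mod-refl {a = + (q ℕ.^ t)}) (mod-sym (%ℕ-mod p _)))
      (mod-trans (mod-reflexive (≡.sym (ℤ.*-assoc (+ (q ℕ.^ t)) _ (ℤ.- (+ v)))))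
        (mod-trans (mod-*-cong (Inv.*inverse (Class⇒inv plus (Class-q^ t))) (mod-refl {a = ℤ.- (+ v)}))
          (mod-reflexive (ℤ.*-identityˡ (ℤ.- (+ v))))))

    sum≡0 : ∀ {x v} → p ∣ q ℕ.^ t ℕ.* x ℕ.+ v → (+ v) ≡ ℤ.- (+ (q ℕ.^ t) ℤ.* + x) [mod p ]
    sum≡0 {x} {v} d = mod-trans (mod-reflexive (lem (+ (q ℕ.^ t) ℤ.* + x) (+ v)))
      (mod-trans (mod-+-cong (mod-trans (mod-reflexive (≡.sym (≡.trans (ℤ.pos-+ (q ℕ.^ t ℕ.* x) v)
        (≡.cong (λ z → z ℤ.+ + v) (ℤ.pos-* (q ℕ.^ t) x))))) (∣⇒≡0 d))
            (mod-refl {a = ℤ.- (+ (q ℕ.^ t) ℤ.* + x)}))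
        (mod-reflexive (ℤ.+-identityˡ _)))
      where
      lem : ∀ a b → b ≡ (a ℤ.+ b) ℤ.+ ℤ.- a
      lem = solve-∀

    ≡0-sum : ∀ {x v} → (+ (q ℕ.^ t)) ℤ.* + x ≡ ℤ.- (+ v) [mod p ] → p ∣ q ℕ.^ t ℕ.* x ℕ.+ v
    ≡0-sum {x} {v} e = ≡0⇒∣ (mod-trans (mod-reflexive (≡.trans (ℤ.pos-+ (q ℕ.^ t ℕ.* x) v)
      (≡.cong (λ z → z ℤ.+ + v) (ℤ.pos-* (q ℕ.^ t) x))))
      (mod-trans (mod-+-cong e (mod-refl {a = + v})) (mod-reflexive (ℤ.+-inverseˡ (+ v)))))

    opposite-involutive : ∀ ε → opposite (plus Sign.* opposite ε) ≡ ε
    opposite-involutive plus  = ≡.refl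
    opposite-involutive minus = ≡.refl

    regroup : ∀ P Q x v → P ℕ.* Q ℕ.* x ℕ.+ P ℕ.* v ≡ P ℕ.* (Q ℕ.* x ℕ.+ v)
    regroup = ℕSolver.solve-∀

  -- Since q is a residue and -1 is not, u + p^i q^t x = 0 mod p^(i+1) has a solution x in the
  -- class opposite to ε exactly when u / p^i lies in the class ε.
  class-solutions : ∀ ε {i} → i ℕ.< s → ∀ u →
    S (upTo p) (λ x → class-indicator (opposite ε) x * ind
        (p ℕ.^ suc i ∣? (p ℕ.^ i ℕ.* q ℕ.^ t ℕ.* x ℕ.+ u))) ≈ A ε i u
  class-solutions ε {i} i<s u = trans
      (S-cong (upTo p) (λ {x} _ → trans (sym (ind-× (Class? (opposite ε) (+ x)) (hit? x)))
      (sym (*-identityʳ _))))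
    (cases (PClass? ε i u))
    where
    hit? : ∀ x → Dec (p ℕ.^ suc i ∣ p ℕ.^ i ℕ.* q ℕ.^ t ℕ.* x ℕ.+ u)
    hit? x = p ℕ.^ suc i ∣? (p ℕ.^ i ℕ.* q ℕ.^ t ℕ.* x ℕ.+ u)
    solution? : ∀ x → Dec (Class (opposite ε) (+ x) × p ℕ.^ suc i ∣ p ℕ.^ i ℕ.* q ℕ.^ t ℕ.* x ℕ.+ u)
    solution? x = Class? (opposite ε) (+ x) ×-dec hit? x
    cases : Dec (PClass ε i u) → S (upTo p) (λ x → ind (solution? x) * 1#) ≈ A ε i u
    cases (yes pc@(v , ≡.refl , c)) = trans
      (S-single solution? p (λ _ → 1#) (quotientBy-q^t v) (quotient<p v) (class-x₀ , hit) unique)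
      (sym (ind-yes (PClass? ε i u) pc))
      where
      x₀ = quotientBy-q^t v
      -v-class : Class (opposite ε) (ℤ.- (+ v))
      -v-class = Class-neg ε (c i<s)
      class-x₀ : Class (opposite ε) (+ x₀)
      class-x₀ = let
          inv-x₀ = inv-factor (+ x₀) (inv-cong (mod-trans (mod-sym (q^t*quotient v))
            (mod-reflexive (ℤ.*-comm (+ (q ℕ.^ t)) (+ x₀)))) (Class⇒inv (opposite ε) -v-class))
          (δ , d) = class (+ x₀) inv-x₀
        in ≡.subst (λ δ → Class δ (+ x₀)) (≡.trans (≡.sym (Sign.*-identityˡ δ))
            (Class-unique (plus Sign.* δ) (opposite ε)
          (Class-cong (plus Sign.* δ) (q^t*quotient v) (Class-* plus δ (Class-q^ t) d)) -v-class)) d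
      hit : p ℕ.^ suc i ∣ p ℕ.^ i ℕ.* q ℕ.^ t ℕ.* x₀ ℕ.+ p ℕ.^ i ℕ.* v
      hit = ≡.subst (p ℕ.^ suc i ∣_) (≡.sym (regroup (p ℕ.^ i) (q ℕ.^ t) x₀ v))
        (∣-^-suc p i (≡0-sum (q^t*quotient v)))
      unique : ∀ x → x ℕ.< p → Class (opposite ε) (+ x) × p ℕ.^ suc i ∣ p ℕ.^ i ℕ.* q ℕ.^ t ℕ.* x ℕ.+ p ℕ.^
          i ℕ.* v → x ≡ x₀
      unique x x<p (_ , d) = mod-unique x<p (quotient<p v) (mod-*-cancelˡ (Class⇒inv plus (Class-q^ t))
        (mod-trans (mod-trans (mod-reflexive (≡.sym (ℤ.neg-involutive _)))
          (mod-neg-cong (mod-sym (sum≡0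
              (^-suc-∣ p i (≡.subst (p ℕ.^ suc i ∣_) (regroup (p ℕ.^ i) (q ℕ.^ t) x v) d))))))
          (mod-sym (q^t*quotient v))))
    cases (no ¬pc) = trans (S-none solution? p (λ _ → 1#) (λ x _ (c , d) → ¬pc (solve-for-u x c d)))
      (sym (ind-no (PClass? ε i u) ¬pc))
      where
      solve-for-u : ∀ x → Class (opposite ε) (+ x) → p ℕ.^ suc i ∣ p ℕ.^ i ℕ.* q ℕ.^ t ℕ.* x ℕ.+ u → PClass
          ε i u
      solve-for-u x c d = v , u≡ , λ _ → ≡.subst (λ δ → Class δ (+ v)) (opposite-involutive ε)
        (Class-cong (opposite (plus Sign.* opposite ε))
            (mod-sym (sum≡0 (^-suc-∣ p i (≡.subst (p ℕ.^ suc i ∣_)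
          (≡.trans (≡.cong (p ℕ.^ i ℕ.* q ℕ.^ t ℕ.* x ℕ.+_) u≡) (regroup (p ℕ.^ i) (q ℕ.^ t) x v)) d))))
          (Class-neg (plus Sign.* opposite ε) (Class-* plus (opposite ε) (Class-q^ t) c)))
        where
        p^i∣u : p ℕ.^ i ∣ u
        p^i∣u = ℕ∣.∣m+n∣m⇒∣n (^-∣-suc p i d) (ℕ∣.∣m⇒∣m*n x (ℕ∣.m∣m*n (q ℕ.^ t)))
        v = ℕ∣.quotient p^i∣u
        u≡ : u ≡ p ℕ.^ i ℕ.* v
        u≡ = ≡.trans (ℕ∣._∣_.equality p^i∣u) (ℕ.*-comm v (p ℕ.^ i))

  -- The discrete Fourier transform of a `K`-valued function on the exponents below `n`.
  Φ : ℕ → (ℕ → Carrier) → Carrier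
  Φ u w = S (upTo n) (λ k → w k * (α ^ u) ^ k)

  private
    -- The first factor divides every exponent in the support of a coefficient function; the second
    -- is the number of its multiples below `n`.
    n-factors : ∀ b b′ j j′ → b ℕ.+ b′ ≡ s → j ℕ.+ j′ ≡ t →
                n ≡ p ℕ.^ b ℕ.* q ℕ.^ j′ ℕ.* (p ℕ.^ b′ ℕ.* q ℕ.^ j)
    n-factors b b′ j j′ ≡.refl ≡.refl = ≡.trans
      (≡.cong₂ ℕ._*_ (ℕ.^-distribˡ-+-* p b b′) (ℕ.^-distribˡ-+-* q j j′))
      (lem (p ℕ.^ b) (p ℕ.^ b′) (q ℕ.^ j) (q ℕ.^ j′))
      where
      lem : ∀ a b c d → (a ℕ.* b) ℕ.* (c ℕ.* d) ≡ a ℕ.* d ℕ.* (b ℕ.* c)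
      lem = ℕSolver.solve-∀

  ind-product : ∀ i j k → ind (p ℕ.^ i ℕ.* q ℕ.^ j ∣? k) ≈ P∣ i k * Q∣ j k
  ind-product i j k = trans (ind-cong (p ℕ.^ i ℕ.* q ℕ.^ j ∣? k) ((p ℕ.^ i ∣? k) ×-dec (q ℕ.^ j ∣? k))
    (λ d → ℕ∣.∣-trans (ℕ∣.m∣m*n (q ℕ.^ j)) d , ℕ∣.∣-trans (ℕ∣.n∣m*n (p ℕ.^ i)) d)
    (λ (d , d′) → coprime-*-∣ (p^⊥q^ i j) d d′)) (ind-× (p ℕ.^ i ∣? k) (q ℕ.^ j ∣? k))

  multiples-sum : ∀ D E .{{_ : NonZero D}} → n ≡ D ℕ.* E → ∀ w →
    S (upTo n) (λ k → ind (D ∣? k) * w k) ≈ S (upTo E) (λ k → w (D ℕ.* k))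
  multiples-sum D E n≡ w = trans (reflexive (≡.cong (λ n → S (upTo n) (λ k → ind (D ∣? k) * w k)) n≡))
      (S-multiples D E w)

  -- Orthogonality for α^D, a primitive `E`-th root of unity.
  shifted-orthogonality : ∀ D E .{{_ : NonZero D}} → n ≡ D ℕ.* E → ∀ e →
    S (upTo E) ((α ^ (D ℕ.* e)) ^_) ≈ ι (+ E) * ind (E ∣? e)
  shifted-orthogonality D E n≡ e = trans (orthogonality E (D ℕ.* e) (≡.subst (_∣ D ℕ.* e ℕ.* E) (≡.sym n≡)
      (≡.subst (D ℕ.* E ∣_) (lem D E e) (ℕ∣.m∣m*n e))))
    (*-congˡ (ind-cong (n ∣? (D ℕ.* e)) (E ∣? e)
      (λ d → ℕ∣.*-cancelˡ-∣ D (≡.subst (_∣ D ℕ.* e) n≡ d))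
      (λ d → ≡.subst (_∣ D ℕ.* e) (≡.sym n≡) (ℕ∣.*-monoʳ-∣ D d))))
    where
    lem : ∀ D E e → D ℕ.* E ℕ.* e ≡ D ℕ.* e ℕ.* E
    lem = ℕSolver.solve-∀

  Φ-top : ∀ {j j′} → j ℕ.+ j′ ≡ t → ∀ u → Φ u (Q∣ j′) ≈ ι (+ (p ℕ.^ s ℕ.* q ℕ.^ j)) * (P∣ s u * Q∣ j u)
  Φ-top {j} {j′} j+j′ u = begin
    S (upTo n) (λ k → Q∣ j′ k * (α ^ u) ^ k)
      ≈⟨ S-cong (upTo n) (λ {k} _ → *-congʳ (ind-cong (q ℕ.^ j′ ∣? k) (D ∣? k) (≡.subst (_∣ k) (≡.sym D≡))
           (≡.subst (_∣ k) D≡))) ⟩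
    S (upTo n) (λ k → ind (D ∣? k) * (α ^ u) ^ k)
      ≈⟨ multiples-sum D E (n-factors 0 s j j′ ≡.refl j+j′) ((α ^ u) ^_) ⟩
    S (upTo E) (λ k → (α ^ u) ^ (D ℕ.* k))
      ≈⟨ S-cong (upTo E) (λ {k} _ → trans (sym (^-assocʳ (α ^ u) D k))
           (^-congˡ k (trans (^-assocʳ α u D) (reflexive (≡.cong (α ^_) (ℕ.*-comm u D)))))) ⟩
    S (upTo E) ((α ^ (D ℕ.* u)) ^_)
      ≈⟨ shifted-orthogonality D E (n-factors 0 s j j′ ≡.refl j+j′) u ⟩
    ι (+ E) * ind (E ∣? u)
      ≈⟨ *-congˡ (ind-product s j u) ⟩
    ι (+ E) * (P∣ s u * Q∣ j u)
      ∎
    where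
    -- The factor p^0 is kept to match the general factorisation of `n`.
    D = p ℕ.^ 0 ℕ.* q ℕ.^ j′
    E = p ℕ.^ s ℕ.* q ℕ.^ j
    D≡ : D ≡ q ℕ.^ j′
    D≡ = ℕ.*-identityˡ (q ℕ.^ j′)
    instance _ = ℕ.m*n≢0 (p ℕ.^ 0) (q ℕ.^ j′) {{ℕ.m^n≢0 p 0}} {{ℕ.m^n≢0 q j′}}

  module _ (ε : Sign) {b i j j′} (b+i : b ℕ.+ suc i ≡ s) (j+j′ : j ℕ.+ j′ ≡ t) (u : ℕ) where
    private
      open Solver using (solve; _:=_; _:*_)
      D = p ℕ.^ b ℕ.* q ℕ.^ j′
      E = p ℕ.^ suc i ℕ.* q ℕ.^ j
      instance
        D-nonZero : NonZero D
        D-nonZero = ℕ.m*n≢0 (p ℕ.^ b) (q ℕ.^ j′) {{ℕ.m^n≢0 p b}} {{ℕ.m^n≢0 q j′}}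
      cl : ℕ → Carrier
      cl = class-indicator (opposite ε)
      e : ℕ → ℕ
      -- Chosen so that the factor from β at exponent x q^j′ k and the factor (α^u)^(D k) combine to
      -- α^(D (e x) k), using b + i = s - 1.
      e x = p ℕ.^ i ℕ.* q ℕ.^ t ℕ.* x ℕ.+ u
      i<s : i ℕ.< s
      i<s = ≡.subst (suc i ℕ.≤_) b+i (ℕ.m≤n+m (suc i) b)
      b<s : b ℕ.< s
      b<s = ≡.subst (b ℕ.<_) b+i (ℕ.m<m+n b (s≤s z≤n))
      -- The p-part vanishes off the multiples of p^b, so the indicator of these may be inserted
      -- freely.
      restrict : ∀ k → pCoefficient ε b k * Q∣ j′ k ≈ ind (D ∣? k) * pCoefficient ε b k
      restrict k = trans (cases (p ℕ.^ b ∣? k)) (*-congʳ (sym (ind-product b j′ k)))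
        where
        cases : Dec (p ℕ.^ b ∣ k) → pCoefficient ε b k * Q∣ j′ k ≈ P∣ b k * Q∣ j′ k * pCoefficient ε b k
        cases (yes d) = trans (*-comm _ _)
            (*-congʳ (sym (trans (*-congʳ (ind-yes (p ℕ.^ b ∣? k) d)) (*-identityˡ _))))
        cases (no  d) = trans (*-congʳ (pCoefficient-nonmultiple ε d)) (trans (zeroˡ _)
          (sym (trans (*-congˡ (pCoefficient-nonmultiple ε d)) (zeroʳ _))))
      -- As `j` is at most `t`, q^j divides the first summand of `e x`, and the condition at `q`
      -- concerns `u` alone.
      split : ∀ x → ind (E ∣? e x) ≈ P∣ (suc i) (e x) * Q∣ j u
      split x = trans (ind-product (suc i) j (e x)) (*-congˡ (ind-cong (q ℕ.^ j ∣? e x) (q ℕ.^ j ∣? u)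
        (λ d → ℕ∣.∣m+n∣m⇒∣n d q^j∣) (λ d → ℕ∣.∣m∣n⇒∣m+n q^j∣ d)))
        where
        q^j∣ : q ℕ.^ j ∣ p ℕ.^ i ℕ.* q ℕ.^ t ℕ.* x
        q^j∣ = ℕ∣.∣m⇒∣m*n x (ℕ∣.∣n⇒∣m*n (p ℕ.^ i) (^-∣ q (≡.subst (j ℕ.≤_) j+j′ (ℕ.m≤m+n j j′))))
      exponents : ∀ x k → p ℕ.^ (s ℕ.∸ 1) ℕ.* q ℕ.^ t ℕ.* (x ℕ.* (q ℕ.^ j′ ℕ.* k)) ℕ.+ u ℕ.* (D ℕ.* k) ≡ D
          ℕ.* e x ℕ.* k
      exponents x k = ≡.trans (≡.cong (λ P → P ℕ.* q ℕ.^ t ℕ.* (x ℕ.* (q ℕ.^ j′ ℕ.* k)) ℕ.+ u ℕ.* (D ℕ.* k))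
          p^s-1≡)
        (lem (p ℕ.^ b) (p ℕ.^ i) (q ℕ.^ t) (q ℕ.^ j′) x k u)
        where
        p^s-1≡ : p ℕ.^ (s ℕ.∸ 1) ≡ p ℕ.^ b ℕ.* p ℕ.^ i
        p^s-1≡ = ≡.trans (≡.cong (λ s → p ℕ.^ (s ℕ.∸ 1)) (≡.sym (≡.trans (≡.sym (ℕ.+-suc b i)) b+i)))
            (ℕ.^-distribˡ-+-* p b i)
        lem : ∀ b i t j x k u → b ℕ.* i ℕ.* t ℕ.* (x ℕ.* (j ℕ.* k)) ℕ.+ u ℕ.* (b ℕ.* j ℕ.* k) ≡
                                b ℕ.* j ℕ.* (i ℕ.* t ℕ.* x ℕ.+ u) ℕ.* k
        lem = ℕSolver.solve-∀
      term : ∀ x k → β ^ (x ℕ.* (q ℕ.^ j′ ℕ.* k)) * (α ^ u) ^ (D ℕ.* k) ≈ (α ^ (D ℕ.* e x)) ^ k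
      term x k = begin
        β ^ (x ℕ.* (q ℕ.^ j′ ℕ.* k)) * (α ^ u) ^ (D ℕ.* k)
          ≈⟨ *-cong (^-assocʳ α (p ℕ.^ (s ℕ.∸ 1) ℕ.* q ℕ.^ t) (x ℕ.* (q ℕ.^ j′ ℕ.* k)))
               (^-assocʳ α u (D ℕ.* k)) ⟩
        α ^ (p ℕ.^ (s ℕ.∸ 1) ℕ.* q ℕ.^ t ℕ.* (x ℕ.* (q ℕ.^ j′ ℕ.* k))) * α ^ (u ℕ.* (D ℕ.* k))
          ≈⟨ ^-homo-* α (p ℕ.^ (s ℕ.∸ 1) ℕ.* q ℕ.^ t ℕ.* (x ℕ.* (q ℕ.^ j′ ℕ.* k))) (u ℕ.* (D ℕ.* k)) ⟨
        α ^ (p ℕ.^ (s ℕ.∸ 1) ℕ.* q ℕ.^ t ℕ.* (x ℕ.* (q ℕ.^ j′ ℕ.* k)) ℕ.+ u ℕ.* (D ℕ.* k))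
          ≡⟨ ≡.cong (α ^_) (exponents x k) ⟩
        α ^ (D ℕ.* e x ℕ.* k)
          ≈⟨ ^-assocʳ α (D ℕ.* e x) k ⟨
        (α ^ (D ℕ.* e x)) ^ k
          ∎
      expand : ∀ k → pCoefficient ε b (D ℕ.* k) * (α ^ u) ^ (D ℕ.* k) ≈ S (upTo p)
          (λ x → cl x * (α ^ (D ℕ.* e x)) ^ k)
      expand k = begin
        pCoefficient ε b (D ℕ.* k) * (α ^ u) ^ (D ℕ.* k)
          ≈⟨ *-congʳ (trans (reflexive (≡.cong (pCoefficient ε b) (ℕ.*-assoc (p ℕ.^ b) (q ℕ.^ j′) k)))
               (pCoefficient-multiple ε b<s (q ℕ.^ j′ ℕ.* k))) ⟩
        twistedPeriod (opposite ε) (q ℕ.^ j′ ℕ.* k) * (α ^ u) ^ (D ℕ.* k)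
          ≈⟨ S-*ʳ ((α ^ u) ^ (D ℕ.* k)) (upTo p) (λ x → cl x * β ^ (x ℕ.* (q ℕ.^ j′ ℕ.* k))) ⟨
        S (upTo p) (λ x → cl x * β ^ (x ℕ.* (q ℕ.^ j′ ℕ.* k)) * (α ^ u) ^ (D ℕ.* k))
          ≈⟨ S-cong (upTo p) (λ {x} _ → trans (*-assoc (cl x) (β ^ (x ℕ.* (q ℕ.^ j′ ℕ.* k)))
               ((α ^ u) ^ (D ℕ.* k))) (*-congˡ (term x k))) ⟩
        S (upTo p) (λ x → cl x * (α ^ (D ℕ.* e x)) ^ k)
          ∎

      shuffle : ∀ c n a b → c * (n * (a * b)) ≈ (n * b) * (c * a)
      shuffle = solve 4 (λ c n a b → c :* (n :* (a :* b)) := (n :* b) :* (c :* a)) refl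

      gather : ∀ n b a → (n * b) * a ≈ n * (a * b)
      gather = solve 3 (λ n b a → (n :* b) :* a := n :* (a :* b)) refl

      n≡DE : n ≡ D ℕ.* E
      n≡DE = n-factors b (suc i) j j′ b+i j+j′

      restrict-term : ∀ k → pCoefficient ε b k * Q∣ j′ k * (α ^ u) ^ k ≈ ind (D ∣? k) *
          (pCoefficient ε b k * (α ^ u) ^ k)
      restrict-term k = trans (*-congʳ (restrict k)) (*-assoc (ind (D ∣? k)) (pCoefficient ε b k)
          ((α ^ u) ^ k))

      inner : ∀ x → S (upTo E) (λ k → cl x * (α ^ (D ℕ.* e x)) ^ k) ≈ (ι (+ E) * Q∣ j u) *
          (cl x * P∣ (suc i) (e x))
      inner x = begin
        S (upTo E) (λ k → cl x * (α ^ (D ℕ.* e x)) ^ k)       ≈⟨ S-*ˡ (cl x) (upTo E)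
            ((α ^ (D ℕ.* e x)) ^_) ⟩
        cl x * S (upTo E) ((α ^ (D ℕ.* e x)) ^_)              ≈⟨ *-congˡ (shifted-orthogonality D E n≡DE
            (e x)) ⟩
        cl x * (ι (+ E) * ind (E ∣? e x))                     ≈⟨ *-congˡ (*-congˡ (split x)) ⟩
        cl x * (ι (+ E) * (P∣ (suc i) (e x) * Q∣ j u))        ≈⟨ shuffle (cl x) (ι (+ E)) (P∣ (suc i) (e x))
            (Q∣ j u) ⟩
        (ι (+ E) * Q∣ j u) * (cl x * P∣ (suc i) (e x))        ∎

    Φ-pCoefficient : Φ u (λ k → pCoefficient ε b k * Q∣ j′ k) ≈ ι (+ (p ℕ.^ suc i ℕ.* q ℕ.^ j)) *
        (A ε i u * Q∣ j u)
    Φ-pCoefficient = begin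
      S (upTo n) (λ k → pCoefficient ε b k * Q∣ j′ k * (α ^ u) ^ k)
        ≈⟨ S-cong (upTo n) (λ {k} _ → restrict-term k) ⟩
      S (upTo n) (λ k → ind (D ∣? k) * (pCoefficient ε b k * (α ^ u) ^ k))
        ≈⟨ multiples-sum D E n≡DE (λ k → pCoefficient ε b k * (α ^ u) ^ k) ⟩
      S (upTo E) (λ k → pCoefficient ε b (D ℕ.* k) * (α ^ u) ^ (D ℕ.* k))
        ≈⟨ S-cong (upTo E) (λ {k} _ → expand k) ⟩
      S (upTo E) (λ k → S (upTo p) (λ x → cl x * (α ^ (D ℕ.* e x)) ^ k))
        ≈⟨ S-swap (upTo E) (upTo p) (λ k x → cl x * (α ^ (D ℕ.* e x)) ^ k) ⟩
      S (upTo p) (λ x → S (upTo E) (λ k → cl x * (α ^ (D ℕ.* e x)) ^ k))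
        ≈⟨ S-cong (upTo p) (λ {x} _ → inner x) ⟩
      S (upTo p) (λ x → (ι (+ E) * Q∣ j u) * (cl x * P∣ (suc i) (e x)))
        ≈⟨ S-*ˡ (ι (+ E) * Q∣ j u) (upTo p) (λ x → cl x * P∣ (suc i) (e x)) ⟩
      (ι (+ E) * Q∣ j u) * S (upTo p) (λ x → cl x * P∣ (suc i) (e x))
        ≈⟨ *-congˡ (class-solutions ε i<s u) ⟩
      (ι (+ E) * Q∣ j u) * A ε i u
        ≈⟨ gather (ι (+ E)) (Q∣ j u) (A ε i u) ⟩
      ι (+ E) * (A ε i u * Q∣ j u)
        ∎

-- Evaluation of the candidates

∈-⋯ : ∀ {a b m} → a ℕ.≤ suc b → m ∈ a ⋯ b → m ℕ.≤ b
∈-⋯ {a} {b} a≤1+b m∈ with ∈-map⁻ (a ℕ.+_) m∈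
... | x , x∈ , ≡.refl = ℕ.≤-pred (ℕ.≤-trans (ℕ.+-monoʳ-< a (∈-upTo⁻ x∈))
  (ℕ.≤-reflexive (ℕ.m+[n∸m]≡n a≤1+b)))

module CandidateEvaluation {s t p q l : ℕ} {g : ℤ} (hypotheses : Hypotheses s t p q l g)
  {c ℓ} (K : ExtensionField l c ℓ) (α : ExtensionField.Carrier K)
  (α-primitive : CyclicAlgebra.IsPrimitiveRootOfUnity l (p ℕ.^ s ℕ.* q ℕ.^ t) K α) where

  open Hypotheses hypotheses
  open ExtensionField K hiding (zero)
  open CoefficientSums hypotheses K α α-primitive public
  open Idempotents p q s t l g hiding (evalAt; eval)
  open import Relation.Binary.Reasoning.Setoid setoid
  open Solver using (solve; _:=_; _:+_; _:*_; _:-_)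

  ∈C? : ∀ ε {i j} → i ℕ.≤ s → j ℕ.≤ t → ∀ u → Dec (u ∈C rep ε i j)
  ∈C? ε {i} {j} i≤s j≤t u = map′ (λ (c , d) → ∈C⁺ ε i j u i≤s j≤t c d)
    (λ u∈ → ∈C⁻-p ε i j u i≤s u∈ , ∈C⁻-q ε i j u j≤t u∈) (PClass? ε i u ×-dec QUnit? j u)

  ind-∈C : ∀ ε {i j} (i≤s : i ℕ.≤ s) (j≤t : j ℕ.≤ t) u → ind (∈C? ε i≤s j≤t u) ≈ A ε i u * B j u
  ind-∈C ε {i} {j} i≤s j≤t u = trans (ind-cong (∈C? ε i≤s j≤t u) (PClass? ε i u ×-dec QUnit? j u)
    (λ u∈ → ∈C⁻-p ε i j u i≤s u∈ , ∈C⁻-q ε i j u j≤t u∈)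
    (λ (c , d) → ∈C⁺ ε i j u i≤s j≤t c d)) (ind-× (PClass? ε i u) (QUnit? j u))

  infix 4 _represents_
  -- Expresses that `w` gives the coefficients of `f` modulo x^n - 1. Comparing transforms instead
  -- of coefficients allows `w` to be written with arbitrary elements of `K`.
  record _represents_ (f : Poly) (w : ℕ → Carrier) : Set ℓ where
    constructor by-transform
    field transform : ∀ u → evalAt f (α ^ u) ≈ Φ u w
  open _represents_

  Φ-cong : ∀ u {w v} → (∀ k → w k ≈ v k) → Φ u w ≈ Φ u v
  Φ-cong u e = S-cong (upTo n) (λ {k} _ → *-congʳ (e k))

  Φ-+ : ∀ u w v → Φ u (λ k → w k + v k) ≈ Φ u w + Φ u v
  Φ-+ u w v = trans (S-cong (upTo n) (λ {k} _ → distribʳ ((α ^ u) ^ k) (w k) (v k)))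
    (S-+ (upTo n) (λ k → w k * (α ^ u) ^ k) (λ k → v k * (α ^ u) ^ k))

  Φ-* : ∀ u a w → Φ u (λ k → a * w k) ≈ a * Φ u w
  Φ-* u a w = trans (S-cong (upTo n) (λ {k} _ → *-assoc a (w k) ((α ^ u) ^ k)))
      (S-*ˡ a (upTo n) (λ k → w k * (α ^ u) ^ k))

  Φ-minus : ∀ u w v → Φ u (λ k → w k - v k) ≈ Φ u w - Φ u v
  Φ-minus u w v = trans (Φ-+ u w (λ k → - v k)) (+-congˡ
    (trans (S-cong (upTo n) (λ {k} _ → sym (RingProperties.-‿distribˡ-* ring (v k) ((α ^ u) ^ k))))
      (S-neg (upTo n) (λ k → v k * (α ^ u) ^ k))))

  represents-cong : ∀ {f w v} → f represents w → (∀ k → w k ≈ v k) → f represents v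
  represents-cong r e = by-transform λ u → trans (transform r u) (Φ-cong u e)

  represents-⊕ : ∀ {f g w v} → f represents w → g represents v → (f ⊕ g) represents λ k → w k + v k
  represents-⊕ {f} {g} {w} {v} r r′ = by-transform λ u →
    trans (evalAt-⊕ f g (α ^ u)) (trans (+-cong (transform r u) (transform r′ u)) (sym (Φ-+ u w v)))

  represents-⊖ : ∀ {f g w v} → f represents w → g represents v → (f ⊖ g) represents λ k → w k - v k
  represents-⊖ {f} {g} {w} {v} r r′ = by-transform λ u →
    trans (evalAt-⊖ f g (α ^ u)) (trans (+-cong (transform r u) (-‿cong (transform r′ u)))
        (sym (Φ-minus u w v)))

  represents-∙ : ∀ a {f w} → f represents w → (a ∙ f) represents λ k → ι a * w k
  represents-∙ a {f} {w} r = by-transform λ u →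
    trans (evalAt-∙ a f (α ^ u)) (trans (*-congˡ (transform r u)) (sym (Φ-* u (ι a) w)))

  represents-∑ : ∀ ks {f : ℕ → Poly} {w : ℕ → ℕ → Carrier} → (∀ {m} → m ∈ ks → f m represents w m) →
                 ∑ ks f represents λ k → S ks (λ m → w m k)
  represents-∑ ks {f} {w} r = by-transform λ u → begin
    evalAt (∑ ks f) (α ^ u)                                     ≈⟨ evalAt-∑ ks f (α ^ u) ⟩
    S ks (λ m → evalAt (f m) (α ^ u))                           ≈⟨ S-cong ks (λ m∈ → transform (r m∈) u) ⟩
    S ks (λ m → S (upTo n) (λ k → w m k * (α ^ u) ^ k))         ≈⟨ S-swap ks (upTo n) _ ⟩
    S (upTo n) (λ k → S ks (λ m → w m k * (α ^ u) ^ k))         ≈⟨ S-cong (upTo n) (λ _ → S-*ʳ _ ks _) ⟩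
    Φ u (λ k → S ks (λ m → w m k))                              ∎

  cosetSum-represents : ∀ ε {i j} → i ℕ.≤ s → j ℕ.≤ t → cosetSum (rep ε i j) represents λ k → A ε i k * B j
      k
  cosetSum-represents ε {i} {j} i≤s j≤t = by-transform λ u → let y = α ^ u in begin
    evalAt (cosetSum γ₀) y
      ≈⟨ evalAt-∑ (coset γ₀) (λ a → X^ a) y ⟩
    S (coset γ₀) (λ a → evalAt (X^ a) y)
      ≈⟨ S-cong (coset γ₀) (λ {a} _ → evalAt-X^ a y) ⟩
    S (filter member? (upTo n)) (y ^_)
      ≈⟨ S-filter member? (upTo n) (y ^_) ⟩
    S (upTo n) (λ k → ind (member? k) * y ^ k)
      ≈⟨ S-upTo-cong n (λ k k<n → *-congʳ (trans (ind-cong (member? k) (∈C? ε i≤s j≤t k)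
           (λ (r , _ , e) → r , e)
           (λ k∈ → proj₂ (∈-filter⁻ member? {xs = upTo n} (Equivalence.from (∈-coset γ₀ k<n) k∈))))
           (ind-∈C ε i≤s j≤t k))) ⟩
    Φ u (λ k → A ε i k * B j k)
      ∎
    where
    γ₀ = rep ε i j
    -- The decision by which `coset` filters, repeated so that the coset unfolds to a filtered list.
    member? : ∀ k → Dec (∃ λ r → r ℕ.< n × (+ k) ≡ (γ₀ ℤ.* (+ l) ℤ.^ r) [mod n ])
    member? = λ u → ℕ.anyUpTo? (λ r → (+ u) ≡? (γ₀ ℤ.* (+ l) ℤ.^ r) [mod n ]) n

  S-⋯ : ∀ a b w → S (a ⋯ b) w ≈ S (upTo (suc b ℕ.∸ a)) (λ m → w (a ℕ.+ m))
  S-⋯ a b w = reflexive (S-map (a ℕ.+_) (upTo (suc b ℕ.∸ a)) w)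

  -- The terms below `t` telescope to `Q∣ a k - Q∣ t k`; the last term has a vacuous guard and
  -- supplies exactly `Q∣ t k`.
  B-sum : ∀ {a} → a ℕ.≤ t → ∀ k → S (a ⋯ t) (λ m → B m k) ≈ Q∣ a k
  B-sum {a} a≤t k = begin
    S (a ⋯ t) (λ m → B m k)
      ≈⟨ S-⋯ a t _ ⟩
    S (upTo (suc t ℕ.∸ a)) (λ m → B (a ℕ.+ m) k)
      ≡⟨ ≡.cong (λ N → S (upTo N) (λ m → B (a ℕ.+ m) k)) (ℕ.+-∸-assoc 1 a≤t) ⟩
    S (upTo (suc (t ℕ.∸ a))) (λ m → B (a ℕ.+ m) k)
      ≈⟨ S-upTo-suc (t ℕ.∸ a) _ ⟩
    S (upTo (t ℕ.∸ a)) (λ m → B (a ℕ.+ m) k) + B (a ℕ.+ (t ℕ.∸ a)) k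
      ≈⟨ +-cong (S-upTo-cong (t ℕ.∸ a) (λ m m< → trans (B-difference (a+m<t m<) k)
           (+-congˡ (-‿cong (reflexive (≡.cong (λ j → Q∣ j k) (≡.sym (ℕ.+-suc a m))))))))
           (reflexive (≡.cong (λ j → B j k) (ℕ.m+[n∸m]≡n a≤t))) ⟩
    S (upTo (t ℕ.∸ a)) (λ m → Q∣ (a ℕ.+ m) k - Q∣ (a ℕ.+ suc m) k) + B t k
      ≈⟨ +-cong (S-telescope (λ j → Q∣ j k) a (t ℕ.∸ a)) (B-top k) ⟩
    Q∣ a k - Q∣ (a ℕ.+ (t ℕ.∸ a)) k + Q∣ t k
      ≡⟨ ≡.cong (λ j → Q∣ a k - Q∣ j k + Q∣ t k) (ℕ.m+[n∸m]≡n a≤t) ⟩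
    Q∣ a k - Q∣ t k + Q∣ t k
      ≈⟨ solve 2 (λ x y → x :- y :+ y := x) refl (Q∣ a k) (Q∣ t k) ⟩
    Q∣ a k
      ∎
    where
    a+m<t : ∀ {m} → m ℕ.< t ℕ.∸ a → a ℕ.+ m ℕ.< t
    a+m<t m< = ℕ.<-≤-trans (ℕ.+-monoʳ-< a m<) (ℕ.≤-reflexive (ℕ.m+[n∸m]≡n a≤t))

  -- The range stops short of `s`, where the two cosets coincide and must not be counted twice. The
  -- missing `P∣ s k` comes from the sums χ_sm.
  A-range-sum : ∀ {a} → a ℕ.≤ s → ∀ k → S (a ⋯ (s ℕ.∸ 1)) (λ i → A plus i k + A minus i k) ≈ P∣ a k - P∣ s k
  A-range-sum {a} a≤s k = begin
    S (a ⋯ (s ℕ.∸ 1)) (λ i → A plus i k + A minus i k)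
      ≈⟨ S-⋯ a (s ℕ.∸ 1) _ ⟩
    S (upTo (suc (s ℕ.∸ 1) ℕ.∸ a)) (λ i → A plus (a ℕ.+ i) k + A minus (a ℕ.+ i) k)
      ≡⟨ ≡.cong (λ N → S (upTo (N ℕ.∸ a)) (λ i → A plus (a ℕ.+ i) k + A minus (a ℕ.+ i) k))
           (ℕ.m+[n∸m]≡n 1≤s) ⟩
    S (upTo (s ℕ.∸ a)) (λ i → A plus (a ℕ.+ i) k + A minus (a ℕ.+ i) k)
      ≈⟨ S-upTo-cong (s ℕ.∸ a) (λ i i< → trans (A-sum (a+i<s i<) k)
           (+-congˡ (-‿cong (reflexive (≡.cong (λ j → P∣ j k) (≡.sym (ℕ.+-suc a i))))))) ⟩
    S (upTo (s ℕ.∸ a)) (λ i → P∣ (a ℕ.+ i) k - P∣ (a ℕ.+ suc i) k)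
      ≈⟨ S-telescope (λ j → P∣ j k) a (s ℕ.∸ a) ⟩
    P∣ a k - P∣ (a ℕ.+ (s ℕ.∸ a)) k
      ≡⟨ ≡.cong (λ j → P∣ a k - P∣ j k) (ℕ.m+[n∸m]≡n a≤s) ⟩
    P∣ a k - P∣ s k
      ∎
    where
    a+i<s : ∀ {i} → i ℕ.< s ℕ.∸ a → a ℕ.+ i ℕ.< s
    a+i<s i< = ℕ.<-≤-trans (ℕ.+-monoʳ-< a i<) (ℕ.≤-reflexive (ℕ.m+[n∸m]≡n a≤s))

  column-represents : ∀ ε {i b} → i ℕ.≤ s → b ℕ.≤ t →
    ∑[ m ∈ b ⋯ t ] (cosetSum (rep ε i m)) represents λ k → A ε i k * Q∣ b k
  column-represents ε {i} {b} i≤s b≤t = represents-cong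
    (represents-∑ (b ⋯ t) (λ m∈ → cosetSum-represents ε i≤s (∈-⋯ (ℕ.m≤n⇒m≤1+n b≤t) m∈)))
    (λ k → trans (S-*ˡ (A ε i k) (b ⋯ t) (λ m → B m k)) (*-congˡ (B-sum b≤t k)))

  top-column-represents : ∀ {b} → b ℕ.≤ t → ∑[ m ∈ b ⋯ t ] (χ s m) represents λ k → P∣ s k * Q∣ b k
  top-column-represents b≤t = represents-cong (column-represents plus ℕ.≤-refl b≤t)
      (λ k → *-congʳ (A-top k))

  top-cell-represents : ∀ {m} → m ℕ.≤ t → χ s m represents λ k → P∣ s k * B m k
  top-cell-represents m≤t = represents-cong (cosetSum-represents plus ℕ.≤-refl m≤t)
      (λ k → *-congʳ (A-top k))

  cells-represent : ∀ {i m} → i ℕ.≤ s → m ℕ.≤ t → χ i m ⊕ χ* i m represents λ k → (A plus i k + A minus i k)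
      * B m k
  cells-represent i≤s m≤t = represents-cong
    (represents-⊕ (cosetSum-represents plus i≤s m≤t) (cosetSum-represents minus i≤s m≤t))
    (λ k → sym (distribʳ _ _ _))

  ∈-⋯s : ∀ {a i} → a ℕ.≤ s → i ∈ a ⋯ (s ℕ.∸ 1) → i ℕ.≤ s
  ∈-⋯s a≤s i∈ = ℕ.≤-trans (∈-⋯ (ℕ.≤-trans a≤s (ℕ.≤-reflexive (≡.sym (ℕ.m+[n∸m]≡n 1≤s)))) i∈) (ℕ.m∸n≤m s 1)

  row-represents : ∀ {a m} → a ℕ.≤ s → m ℕ.≤ t →
    ∑[ i ∈ a ⋯ (s ℕ.∸ 1) ] (χ i m ⊕ χ* i m) represents λ k → (P∣ a k - P∣ s k) * B m k
  row-represents {a} {m} a≤s m≤t = represents-cong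
    (represents-∑ (a ⋯ (s ℕ.∸ 1)) (λ i∈ → cells-represent (∈-⋯s a≤s i∈) m≤t))
    (λ k → trans (S-*ʳ (B m k) (a ⋯ (s ℕ.∸ 1)) (λ i → A plus i k + A minus i k))
        (*-congʳ (A-range-sum a≤s k)))

  block-represents : ∀ {a b} → a ℕ.≤ s → b ℕ.≤ t →
    ∑[ i ∈ a ⋯ (s ℕ.∸ 1) ] (∑[ m ∈ b ⋯ t ] (χ i m ⊕ χ* i m)) represents λ k → (P∣ a k - P∣ s k) * Q∣ b k
  block-represents {a} {b} a≤s b≤t = represents-cong
    (represents-∑ (a ⋯ (s ℕ.∸ 1)) (λ i∈ → represents-cong
      (represents-∑ (b ⋯ t) (λ m∈ → cells-represent (∈-⋯s a≤s i∈) (∈-⋯ (ℕ.m≤n⇒m≤1+n b≤t) m∈)))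
      (λ k → trans (S-*ˡ _ (b ⋯ t) (λ m → B m k)) (*-congˡ (B-sum b≤t k)))))
    (λ k → trans (S-*ʳ (Q∣ b k) (a ⋯ (s ℕ.∸ 1)) (λ i → A plus i k + A minus i k))
        (*-congʳ (A-range-sum a≤s k)))

  q-1 : ℤ
  q-1 = + q ℤ.- 1ℤ

  -- The transform of k ↦ F k * [q^j′ ∣ k], for every j′, determines those of the coefficient
  -- functions in the theorem.
  Transforms : (ℕ → Carrier) → ℕ → ℕ → Carrier → Set ℓ
  Transforms F N u C = ∀ j j′ → j ℕ.+ j′ ≡ t → Φ u (λ k → F k * Q∣ j′ k) ≈ ι (+ (N ℕ.* q ℕ.^ j)) *
      (C * Q∣ j u)

  transform-full : ∀ {F} N {u C} → Transforms F N u C →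
    Φ u (λ k → F k * Q∣ 0 k) ≈ ι (+ (N ℕ.* q ℕ.^ t)) * (C * B t u)
  transform-full N {u} T = trans (T t 0 (ℕ.+-identityʳ t)) (*-congˡ (*-congˡ (sym (B-top u))))

  -- Rewritten as `q` times one divisibility indicator minus another, the coefficient function has
  -- two transforms with the common scalar N q^(j+1); their difference leaves the exact q-part of
  -- `u`.
  transform-partial : ∀ {F} N {u C} → Transforms F N u C → ∀ {j m} → j ℕ.+ suc m ≡ t →
    Φ u (λ k → F k * (ι q-1 * Q∣ (suc m) k - B m k)) ≈ ι (+ (N ℕ.* q ℕ.^ suc j)) * (C * B j u)
  transform-partial {F} N {u} {C} T {j} {m} j+m = begin
    Φ u (λ k → F k * (ι q-1 * Q∣ (suc m) k - B m k))
      ≈⟨ Φ-cong u pointwise ⟩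
    Φ u (λ k → ι (+ q) * (F k * Q∣ (suc m) k) - F k * Q∣ m k)
      ≈⟨ trans (Φ-minus u (λ k → ι (+ q) * (F k * Q∣ (suc m) k)) (λ k → F k * Q∣ m k))
           (+-congʳ (Φ-* u (ι (+ q)) (λ k → F k * Q∣ (suc m) k))) ⟩
    ι (+ q) * Φ u (λ k → F k * Q∣ (suc m) k) - Φ u (λ k → F k * Q∣ m k)
      ≈⟨ +-cong (*-congˡ (T j (suc m) j+m)) (-‿cong (T (suc j) m (≡.trans (≡.sym (ℕ.+-suc j m)) j+m))) ⟩
    ι (+ q) * (ι (+ (N ℕ.* q ℕ.^ j)) * (C * Q∣ j u)) - ι (+ (N ℕ.* q ℕ.^ suc j)) * (C * Q∣ (suc j) u)
      ≈⟨ +-congʳ (trans (sym (*-assoc _ _ _)) (*-congʳ (trans (sym (ι-* (+ q) (+ (N ℕ.* q ℕ.^ j))))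
           (ι-≡ (≡.trans (≡.sym (ℤ.pos-* q (N ℕ.* q ℕ.^ j))) (≡.cong +_ (lem q N (q ℕ.^ j)))))))) ⟩
    ι (+ (N ℕ.* q ℕ.^ suc j)) * (C * Q∣ j u) - ι (+ (N ℕ.* q ℕ.^ suc j)) * (C * Q∣ (suc j) u)
      ≈⟨ solve 4 (λ n c x y → n :* (c :* x) :- n :* (c :* y) := n :* (c :* (x :- y))) refl
           (ι (+ (N ℕ.* q ℕ.^ suc j))) C (Q∣ j u) (Q∣ (suc j) u) ⟩
    ι (+ (N ℕ.* q ℕ.^ suc j)) * (C * (Q∣ j u - Q∣ (suc j) u))
      ≈⟨ *-congˡ (*-congˡ (B-difference j<t u)) ⟨
    ι (+ (N ℕ.* q ℕ.^ suc j)) * (C * B j u)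
      ∎
    where
    j<t : j ℕ.< t
    j<t = ≡.subst (j ℕ.<_) j+m (ℕ.m<m+n j (s≤s z≤n))
    m<t : m ℕ.< t
    m<t = ≡.subst (suc m ℕ.≤_) j+m (ℕ.m≤n+m (suc m) j)
    lem : ∀ q N Q → q ℕ.* (N ℕ.* Q) ≡ N ℕ.* (q ℕ.* Q)
    lem = ℕSolver.solve-∀
    ι-q-1 : ι q-1 ≈ ι (+ q) - 1#
    ι-q-1 = trans (ι-+ (+ q) (ℤ.- 1ℤ)) (+-congˡ (trans (ι-neg 1ℤ) (-‿cong ι-1)))
    pointwise : ∀ k → F k * (ι q-1 * Q∣ (suc m) k - B m k) ≈ ι (+ q) * (F k * Q∣ (suc m) k) - F k * Q∣ m k
    pointwise k = begin
      F k * (ι q-1 * Q∣ (suc m) k - B m k)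
        ≈⟨ *-congˡ (+-cong (trans (*-congʳ ι-q-1)
             (trans (distribʳ _ _ _) (+-congˡ (RingProperties.-1*x≈-x ring _))))
             (-‿cong (B-difference m<t k))) ⟩
      F k * ((ι (+ q) * Q∣ (suc m) k - Q∣ (suc m) k) - (Q∣ m k - Q∣ (suc m) k))
        ≈⟨ solve 4 (λ f r x y → f :* ((r :* x :- x) :- (y :- x)) := r :* (f :* x) :- f :* y) refl (F k)
             (ι (+ q)) (Q∣ (suc m) k) (Q∣ m k) ⟩
      ι (+ q) * (F k * Q∣ (suc m) k) - F k * Q∣ m k
        ∎

  transforms-pCoefficient : ∀ ε {b i} → b ℕ.+ suc i ≡ s → ∀ u → Transforms (pCoefficient ε b) (p ℕ.^ suc i)
      u (A ε i u)
  transforms-pCoefficient ε b+i u j j′ j+j′ = Φ-pCoefficient ε {j = j} {j′} b+i j+j′ u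

  -- `P∣ 0` is constantly 1; in this notation the p-part for i = s has the same shape as the others.
  transforms-one : ∀ u → Transforms (P∣ 0) (p ℕ.^ s) u (A plus s u)
  transforms-one u j j′ j+j′ = trans
      (Φ-cong u (λ k → trans (*-congʳ (ind-yes (1 ∣? k) (ℕ∣.1∣ k))) (*-identityˡ _)))
    (trans (Φ-top {j} {j′} j+j′ u) (*-congˡ (*-congʳ (sym (A-top u)))))

  -- The six families of idempotents

  module Conclusion (minimal : ∀ δ → MinimalPolynomial K α δ) (𝓡 𝓝 : ℤ)
    (𝓡≈ : ι 𝓡 ≈ powerSum K β (residues p)) (𝓝≈ : ι 𝓝 ≈ powerSum K β (nonresidues p)) where

    open Theta K α minimal

    period : Sign → ℤ
    period plus  = 𝓡
    period minus = 𝓝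

    period≈ : ∀ ε → ι (period ε) ≈ gaussPeriod ε
    period≈ plus = trans 𝓡≈ (trans (S-filter residue? (upTo p) (β ^_))
      (S-cong (upTo p) (λ {x} _ → *-congʳ (ind-cong (residue? x) (Class? plus (+ x))
        (λ (x≢0 , r) → ≢0⇒inv x≢0 , Fin-Square r) (λ (i , r) → inv⇒≢0 i , Square-Fin r)))))
      where
      residue? = λ a → ¬? ((+ a) ≡? 0ℤ [mod p ]) ×-dec square? p (+ a)
    period≈ minus = trans 𝓝≈ (trans (S-filter nonresidue? (upTo p) (β ^_))
      (S-cong (upTo p) (λ {x} _ → *-congʳ (ind-cong (nonresidue? x) (Class? minus (+ x))
        (λ (x≢0 , r) → ≢0⇒inv x≢0 , λ q → r (Square-Fin q)) (λ (i , r) → inv⇒≢0 i , λ q → r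
            (Fin-Square q))))))
      where
      nonresidue? = λ a → ¬? ((+ a) ≡? 0ℤ [mod p ]) ×-dec ¬? (square? p (+ a))

    infix 3 Θ[_,_,_]≐_
    Θ[_,_,_]≐_ : Sign → ℕ → ℕ → Poly → Set ℓ
    Θ[ ε , i , j ]≐ f = ∀ e → IsPrimitiveIdempotent K α (minimal (rep ε i j)) e ⇔ e ≃ f

    -- `d` is the denominator as the statement writes it, `N` as the transform produces it. Since
    -- `l` does not divide it, `recip l d` is a true inverse and only the coset indicator remains.
    idempotent : ∀ ε {i j} → i ℕ.≤ s → j ℕ.≤ t → ∀ {f w} → f represents w → ∀ d N → d ≡ N → ¬ l ∣ N →
      (∀ u → Φ u w ≈ ι (+ N) * (A ε i u * B j u)) → Θ[ ε , i , j ]≐ recip l d ∙ f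
    idempotent ε {i} {j} i≤s j≤t {f} {w} r d .d ≡.refl l∤d e = idempotent-characterised (∈C? ε i≤s j≤t)
        (minimal (rep ε i j))
      (recip l d ∙ f) λ u → begin
        evalAt (recip l d ∙ f) (α ^ u)                          ≈⟨ evalAt-∙ (recip l d) f (α ^ u) ⟩
        ι (recip l d) * evalAt f (α ^ u)                        ≈⟨ *-congˡ (trans (transform r u) (e u)) ⟩
        ι (recip l d) * (ι (+ d) * (A ε i u * B j u))           ≈⟨ *-assoc _ _ _ ⟨
        ι (recip l d) * ι (+ d) * (A ε i u * B j u)             ≈⟨ trans
            (*-congʳ (ι-recip d (∤⇒coprime-l l∤d))) (*-identityˡ _) ⟩
        A ε i u * B j u                                         ≈⟨ ind-∈C ε i≤s j≤t u ⟨
        ind (∈C? ε i≤s j≤t u)                                   ∎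

    private
      -- This identity and its companions factor the coefficient of a candidate into a p-part and a
      -- q-part.
      merge-full : ∀ x y c a c′ a′ Q → x * (y * Q) + c * (a * Q) + c′ * (a′ * Q) ≈
          (x * y + (c * a + c′ * a′)) * Q
      merge-full = solve 7 (λ x y c a c′ a′ Q → x :* (y :* Q) :+ c :* (a :* Q) :+ c′ :* (a′ :* Q) :=
        (x :* y :+ (c :* a :+ c′ :* a′)) :* Q) refl

      merge-partial : ∀ x y c a c′ a′ r Q B →
        (x * r) * (y * Q) + r * (c * (a * Q) + c′ * (a′ * Q)) - (c * (a * B) + c′ * (a′ * B)) - x * (y * B)
            ≈
        (x * y + (c * a + c′ * a′)) * (r * Q - B)
      merge-partial = solve 9 (λ x y c a c′ a′ r Q B →
        (x :* r) :* (y :* Q) :+ r :* (c :* (a :* Q) :+ c′ :* (a′ :* Q)) :-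
            (c :* (a :* B) :+ c′ :* (a′ :* B)) :- x :* (y :* B) :=
        (x :* y :+ (c :* a :+ c′ :* a′)) :* (r :* Q :- B)) refl

      complete : ∀ y z Q → (y - z) * Q + z * Q ≈ y * Q
      complete = solve 3 (λ y z Q → (y :- z) :* Q :+ z :* Q := y :* Q) refl

      merge-top : ∀ r y Q B → r * (y * Q) - y * B ≈ y * (r * Q - B)
      merge-top = solve 4 (λ r y Q B → r :* (y :* Q) :- y :* B := y :* (r :* Q :- B)) refl

    periods : ∀ ε b k → ι h * P∣ (suc b) k + (ι (period (opposite ε)) * A plus b k + ι (period ε) * A minus
        b k) ≈ pCoefficient ε b k
    periods ε b k = +-congˡ (+-cong (*-congʳ (period≈ (opposite ε))) (*-congʳ (period≈ ε)))

    block-top-represents : ∀ {a b} → a ℕ.≤ s → b ℕ.≤ t →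
      ∑[ i ∈ a ⋯ (s ℕ.∸ 1) ] (∑[ m ∈ b ⋯ t ] (χ i m ⊕ χ* i m)) ⊕ ∑[ m ∈ b ⋯ t ] (χ s m) represents λ k → P∣
          a k * Q∣ b k
    block-top-represents {a} {b} a≤s b≤t = represents-cong (represents-⊕ (block-represents a≤s b≤t)
        (top-column-represents b≤t))
      (λ k → complete (P∣ a k) (P∣ s k) (Q∣ b k))

    -- All rows from `a` up to the top are needed here: only then is the p-factor the same `P∣ a k`
    -- as in `block-top-represents`, so that `partial-represents` can take it out.
    row-top-represents : ∀ {a m} → a ℕ.≤ s → m ℕ.≤ t →
      ∑[ i ∈ a ⋯ (s ℕ.∸ 1) ] (χ i m ⊕ χ* i m) ⊕ χ s m represents λ k → P∣ a k * B m k
    row-top-represents {a} {m} a≤s m≤t = represents-cong (represents-⊕ (row-represents a≤s m≤t)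
        (top-cell-represents m≤t))
      (λ k → complete (P∣ a k) (P∣ s k) (B m k))

    full-represents : ∀ ε {f a b} → a ≡ suc b → b ℕ.≤ s → f represents (λ k → ι h * (P∣ a k * Q∣ 0 k)) →
      f ⊕ period (opposite ε) ∙ (∑[ m ∈ 0 ⋯ t ] (χ b m)) ⊕ period ε ∙ (∑[ m ∈ 0 ⋯ t ] (χ* b m)) represents
      λ k → pCoefficient ε b k * Q∣ 0 k
    full-represents ε {b = b} ≡.refl b≤s r = represents-cong
      (represents-⊕ (represents-⊕ r (represents-∙ (period (opposite ε)) (column-represents plus b≤s z≤n)))
        (represents-∙ (period ε) (column-represents minus b≤s z≤n)))
      (λ k → trans (merge-full (ι h) (P∣ (suc b) k) (ι (period (opposite ε))) (A plus b k) (ι (period ε))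
          (A minus b k) (Q∣ 0 k))
        (*-congʳ (periods ε b k)))

    -- The indices are tied by equations because the statement writes them as truncated differences,
    -- which are successors only propositionally.
    partial-represents : ∀ ε {f f′ a b d m} → a ≡ suc b → b ℕ.≤ s → d ≡ suc m → d ℕ.≤ t →
      f represents (λ k → P∣ a k * Q∣ d k) → f′ represents (λ k → P∣ a k * B m k) →
      (h ℤ.* q-1) ∙ f
      ⊕ q-1 ∙ (period (opposite ε) ∙ (∑[ m ∈ d ⋯ t ] (χ b m)) ⊕ period ε ∙ (∑[ m ∈ d ⋯ t ] (χ* b m)))
      ⊖ (period (opposite ε) ∙ χ b m ⊕ period ε ∙ χ* b m)
      ⊖ h ∙ f′
      represents λ k → pCoefficient ε b k * (ι q-1 * Q∣ (suc m) k - B m k)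
    partial-represents ε {b = b} {d} {m} ≡.refl b≤s ≡.refl d≤t r r′ = represents-cong
      (represents-⊖ (represents-⊖ (represents-⊕ (represents-∙ (h ℤ.* q-1) r)
        (represents-∙ q-1 (represents-⊕ (represents-∙ c₁ (column-represents plus b≤s d≤t))
            (represents-∙ c₂ (column-represents minus b≤s d≤t)))))
        (represents-⊕ (represents-∙ c₁ (cosetSum-represents plus b≤s m≤t))
            (represents-∙ c₂ (cosetSum-represents minus b≤s m≤t))))
        (represents-∙ h r′))
      (λ k → trans (+-congʳ (+-congʳ (+-congʳ (*-congʳ (ι-* h q-1)))))
        (trans (merge-partial (ι h) (P∣ (suc b) k) (ι c₁) (A plus b k) (ι c₂) (A minus b k) (ι q-1)
            (Q∣ (suc m) k) (B m k))
          (*-congʳ (periods ε b k))))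
      where
      c₁ = period (opposite ε)
      c₂ = period ε
      m≤t = ℕ.≤-trans (ℕ.n≤1+n m) d≤t

    1+b≤s : ∀ {b i} → b ℕ.+ suc i ≡ s → suc b ℕ.≤ s
    1+b≤s {b} {i} e = ≡.subst (suc b ℕ.≤_) e (ℕ.m<m+n b (s≤s z≤n))

    i≤s : ∀ {b i} → b ℕ.+ suc i ≡ s → i ℕ.≤ s
    i≤s {b} {i} e = ℕ.≤-trans (ℕ.n≤1+n i) (≡.subst (suc i ℕ.≤_) e (ℕ.m≤n+m (suc i) b))

    j≤t : ∀ {j m} → j ℕ.+ suc m ≡ t → j ℕ.≤ t
    j≤t {j} {m} e = ≡.subst (j ℕ.≤_) e (ℕ.m≤m+n j (suc m))

    1+m≤t : ∀ {j m} → j ℕ.+ suc m ≡ t → suc m ℕ.≤ t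
    1+m≤t {j} {m} e = ≡.subst (suc m ℕ.≤_) e (ℕ.m≤n+m (suc m) j)

    full-idempotent : ∀ ε {f b i d} → b ℕ.+ suc i ≡ s → d ≡ p ℕ.^ suc i ℕ.* q ℕ.^ t →
      f represents (λ k → pCoefficient ε b k * Q∣ 0 k) → Θ[ ε , i , t ]≐ recip l d ∙ f
    full-idempotent ε {b = b} {i} {d} e d≡ r = idempotent ε (i≤s e) ℕ.≤-refl r d (p ℕ.^ suc i ℕ.* q ℕ.^ t)
        d≡ (l∤p^q^ (suc i) t)
      (λ u → transform-full (p ℕ.^ suc i) (transforms-pCoefficient ε e u))

    partial-idempotent : ∀ ε {f b i j m d} → b ℕ.+ suc i ≡ s → j ℕ.+ suc m ≡ t → d ≡ p ℕ.^ suc i ℕ.* q ℕ.^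
        suc j →
      f represents (λ k → pCoefficient ε b k * (ι q-1 * Q∣ (suc m) k - B m k)) → Θ[ ε , i , j ]≐ recip l d ∙
          f
    partial-idempotent ε {b = b} {i} {j} {m} {d} e e′ d≡ r = idempotent ε (i≤s e) (j≤t e′) r d
        (p ℕ.^ suc i ℕ.* q ℕ.^ suc j) d≡ (l∤p^q^ (suc i) (suc j))
      (λ u → transform-partial (p ℕ.^ suc i) (transforms-pCoefficient ε e u) e′)

    -- For i = 0 the index b + 1 is already `s`, so the multiples of p^(b+1) are covered by the sums
    -- χ_sm alone.
    case-i : ∀ ε {b} → suc b ≡ s → Θ[ ε , 0 , t ]≐ recip l (p ℕ.* q ℕ.^ t) ∙
      (h ∙ (∑[ m ∈ 0 ⋯ t ] (χ s m))
      ⊕ period (opposite ε) ∙ (∑[ m ∈ 0 ⋯ t ] (χ b m))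
      ⊕ period ε ∙ (∑[ m ∈ 0 ⋯ t ] (χ* b m)))
    case-i ε {b} e = full-idempotent ε (≡.trans (ℕ.+-comm b 1) e)
        (≡.cong (ℕ._* q ℕ.^ t) (≡.sym (ℕ.^-identityʳ p)))
      (full-represents ε (≡.sym e) (ℕ.≤-trans (ℕ.n≤1+n b) (ℕ.≤-reflexive e))
          (represents-∙ h (top-column-represents z≤n)))

    case-ii : ∀ ε {b j d m} → suc b ≡ s → d ≡ suc m → j ℕ.+ suc m ≡ t → Θ[ ε , 0 , j ]≐ recip l
        (p ℕ.* q ℕ.^ (j ℕ.+ 1)) ∙
      ((h ℤ.* q-1) ∙ (∑[ m ∈ d ⋯ t ] (χ s m))
      ⊕ q-1 ∙ (period (opposite ε) ∙ (∑[ m ∈ d ⋯ t ] (χ b m)) ⊕ period ε ∙ (∑[ m ∈ d ⋯ t ] (χ* b m)))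
      ⊖ (period (opposite ε) ∙ χ b m ⊕ period ε ∙ χ* b m)
      ⊖ h ∙ χ s m)
    case-ii ε {b} {j} {d} {m} e d≡ e′ = partial-idempotent ε (≡.trans (ℕ.+-comm b 1) e) e′
      (≡.cong₂ ℕ._*_ (≡.sym (ℕ.^-identityʳ p)) (≡.cong (q ℕ.^_) (ℕ.+-comm j 1)))
      (partial-represents ε (≡.sym e) (ℕ.≤-trans (ℕ.n≤1+n b) (ℕ.≤-reflexive e)) d≡ d≤t
        (top-column-represents d≤t) (top-cell-represents (ℕ.≤-trans (ℕ.n≤1+n m) (1+m≤t e′))))
      where
      d≤t = ≡.subst (ℕ._≤ t) (≡.sym d≡) (1+m≤t e′)

    case-iii : ∀ ε {a b i j d m} → a ≡ suc b → b ℕ.+ suc i ≡ s → d ≡ suc m → j ℕ.+ suc m ≡ t →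
      Θ[ ε , i , j ]≐ recip l (p ℕ.^ (i ℕ.+ 1) ℕ.* q ℕ.^ (j ℕ.+ 1)) ∙
      ((h ℤ.* q-1) ∙ ((∑[ k ∈ a ⋯ (s ℕ.∸ 1) ] (∑[ m ∈ d ⋯ t ] (χ k m ⊕ χ* k m))) ⊕ (∑[ m ∈ d ⋯ t ] (χ s m)))
      ⊕ q-1 ∙ (period (opposite ε) ∙ (∑[ m ∈ d ⋯ t ] (χ b m)) ⊕ period ε ∙ (∑[ m ∈ d ⋯ t ] (χ* b m)))
      ⊖ (period (opposite ε) ∙ χ b m ⊕ period ε ∙ χ* b m)
      ⊖ h ∙ ((∑[ k ∈ a ⋯ (s ℕ.∸ 1) ] (χ k m ⊕ χ* k m)) ⊕ χ s m))
    case-iii ε {a} {b} {i} {j} {d} {m} a≡ e d≡ e′ = partial-idempotent ε e e′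
      (≡.cong₂ ℕ._*_ (≡.cong (p ℕ.^_) (ℕ.+-comm i 1)) (≡.cong (q ℕ.^_) (ℕ.+-comm j 1)))
      (partial-represents ε a≡ (ℕ.≤-trans (ℕ.n≤1+n b) (1+b≤s e)) d≡ d≤t
        (block-top-represents a≤s d≤t) (row-top-represents a≤s (ℕ.≤-trans (ℕ.n≤1+n m) (1+m≤t e′))))
      where
      d≤t = ≡.subst (ℕ._≤ t) (≡.sym d≡) (1+m≤t e′)
      a≤s = ≡.subst (ℕ._≤ s) (≡.sym a≡) (1+b≤s e)

    case-iv : ∀ ε {a b i} → a ≡ suc b → b ℕ.+ suc i ≡ s → Θ[ ε , i , t ]≐ recip l
        (p ℕ.^ (i ℕ.+ 1) ℕ.* q ℕ.^ t) ∙
      (h ∙ (∑[ k ∈ a ⋯ (s ℕ.∸ 1) ] (∑[ m ∈ 0 ⋯ t ] (χ k m ⊕ χ* k m)))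
      ⊕ h ∙ (∑[ m ∈ 0 ⋯ t ] (χ s m))
      ⊕ period (opposite ε) ∙ (∑[ m ∈ 0 ⋯ t ] (χ b m))
      ⊕ period ε ∙ (∑[ m ∈ 0 ⋯ t ] (χ* b m)))
    case-iv ε {a} {b} {i} a≡ e = full-idempotent ε e (≡.cong (λ i → p ℕ.^ i ℕ.* q ℕ.^ t) (ℕ.+-comm i 1))
      (full-represents ε a≡ (ℕ.≤-trans (ℕ.n≤1+n b) (1+b≤s e))
        -- The factor `h` is written separately on the block and on the top column; taking it out
        -- lets the two telescope together.
        (represents-cong (represents-⊕ (represents-∙ h (block-represents a≤s z≤n))
            (represents-∙ h (top-column-represents z≤n)))
          (λ k → trans (sym (distribˡ _ _ _)) (*-congˡ (complete (P∣ a k) (P∣ s k) (Q∣ 0 k))))))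
      where
      a≤s = ≡.subst (ℕ._≤ s) (≡.sym a≡) (1+b≤s e)

    case-v : ∀ {j d m} → d ≡ suc m → j ℕ.+ suc m ≡ t → Θ[ plus , s , j ]≐ recip l
        (p ℕ.^ s ℕ.* q ℕ.^ (j ℕ.+ 1)) ∙
      (q-1 ∙ ((∑[ k ∈ 0 ⋯ (s ℕ.∸ 1) ] (∑[ m ∈ d ⋯ t ] (χ k m ⊕ χ* k m))) ⊕ (∑[ m ∈ d ⋯ t ] (χ s m)))
      ⊖ ((∑[ k ∈ 0 ⋯ (s ℕ.∸ 1) ] (χ k m ⊕ χ* k m)) ⊕ χ s m))
    case-v {j} {d} {m} ≡.refl e′ = idempotent plus ℕ.≤-refl (j≤t e′)
      (represents-cong (represents-⊖ (represents-∙ q-1 (block-top-represents z≤n (1+m≤t e′)))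
        (row-top-represents z≤n (ℕ.≤-trans (ℕ.n≤1+n m) (1+m≤t e′))))
        (λ k → merge-top (ι q-1) (P∣ 0 k) (Q∣ (suc m) k) (B m k)))
      (p ℕ.^ s ℕ.* q ℕ.^ (j ℕ.+ 1)) (p ℕ.^ s ℕ.* q ℕ.^ suc j) (≡.cong (λ j → p ℕ.^ s ℕ.* q ℕ.^ j)
          (ℕ.+-comm j 1))
      (l∤p^q^ s (suc j)) (λ u → transform-partial (p ℕ.^ s) (transforms-one u) e′)

    everything : Poly
    everything = (∑[ k ∈ 0 ⋯ (s ℕ.∸ 1) ] (∑[ m ∈ 0 ⋯ t ] (χ k m ⊕ χ* k m))) ⊕ (∑[ m ∈ 0 ⋯ t ] (χ s m))

    case-vi : Θ[ plus , s , t ]≐ recip l (p ℕ.^ s ℕ.* q ℕ.^ t) ∙ everything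
    case-vi = idempotent plus ℕ.≤-refl ℕ.≤-refl (block-top-represents z≤n z≤n)
      (p ℕ.^ s ℕ.* q ℕ.^ t) (p ℕ.^ s ℕ.* q ℕ.^ t) ≡.refl (l∤p^q^ s t) (λ u → transform-full (p ℕ.^ s)
          (transforms-one u))

    -- With both indicators taken at exponent 0 the coefficient function is constantly 1: the cosets
    -- partition the exponents below `n`.
    everything≃all-powers : recip l (p ℕ.^ s ℕ.* q ℕ.^ t) ∙ everything ≃
                            recip l (p ℕ.^ s ℕ.* q ℕ.^ t) ∙ (∑[ u ∈ upTo (p ℕ.^ s ℕ.* q ℕ.^ t) ] (X^ u))
    everything≃all-powers = evalAt⇒≃ (ρ ∙ everything) (ρ ∙ powers) λ u → begin
      evalAt (ρ ∙ everything) (α ^ u)                       ≈⟨ evalAt-∙ ρ everything (α ^ u) ⟩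
      ι ρ * evalAt everything (α ^ u)                       ≈⟨ *-congˡ
          (transform (block-top-represents z≤n z≤n) u) ⟩
      ι ρ * S (upTo n) (λ k → P∣ 0 k * Q∣ 0 k * (α ^ u) ^ k)
        ≈⟨ *-congˡ (S-cong (upTo n) (λ {k} _ → trans (*-congʳ (one k))
             (trans (*-identityˡ _) (sym (evalAt-X^ k (α ^ u)))))) ⟩
      ι ρ * S (upTo n) (λ k → evalAt (X^ k) (α ^ u))        ≈⟨ *-congˡ (evalAt-∑ (upTo n) (λ k → X^ k)
          (α ^ u)) ⟨
      ι ρ * evalAt powers (α ^ u)                           ≈⟨ evalAt-∙ ρ powers (α ^ u) ⟨
      evalAt (ρ ∙ powers) (α ^ u)                           ∎
      where
      ρ = recip l (p ℕ.^ s ℕ.* q ℕ.^ t)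
      powers = ∑[ u ∈ upTo (p ℕ.^ s ℕ.* q ℕ.^ t) ] (X^ u)
      one : ∀ k → P∣ 0 k * Q∣ 0 k ≈ 1#
      one k = trans (*-cong (ind-yes (1 ∣? k) (ℕ∣.1∣ k)) (ind-yes (1 ∣? k) (ℕ∣.1∣ k))) (*-identityˡ 1#)

open import Data.Nat.Base using (_+_; _*_; _∸_; _^_; _≤_; _<_)

theorem5p7 :
  ∀ {c ℓ} (s t p q l : ℕ) → 1 ≤ s → 1 ≤ t →
  Prime p → Prime q → Prime l → p ≢ q → p ≢ l → q ≢ l →
  ¬ (2 ∣ p) → ¬ (2 ∣ q) → p % 4 ≡ 3 →
  HasOrder (p ^ s) (+ l) (φ (p ^ s) / 2) →
  HasOrder (q ^ t) (+ l) (φ (q ^ t)) →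
  gcd (φ (p ^ s)) (φ (q ^ t)) ≡ 2 →
  IsQuadraticResidue p (+ q) →
  (g : ℤ) → IsPrimitiveRoot (p ^ s) g → IsPrimitiveRoot (q ^ t) g →
  let open Idempotents p q s t l g
      h = + ((p ∸ 1) / 2)
      q-1 = + q ℤ.- 1ℤ
  in
  (K : ExtensionField l c ℓ) →
  let module K = ExtensionField K in
  (α : K.Carrier) → IsPrimitiveRootOfUnity K α →
  (minimal : ∀ δ → MinimalPolynomial K α δ) →
  let open Theta K α minimal
      β = α K.^ (p ^ (s ∸ 1) * q ^ t)
  in
  (𝓡 𝓝 : ℤ) →
  K.ι 𝓡 K.≈ powerSum K β (residues p) →
  K.ι 𝓝 K.≈ powerSum K β (nonresidues p) →

  -- (i)
  ( (θ[ 0 , t ]≐ recip l (p * q ^ t) ∙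
       ( h ∙ (∑[ m ∈ 0 ⋯ t ] χ s m)
       ⊕ 𝓝 ∙ (∑[ m ∈ 0 ⋯ t ] χ (s ∸ 1) m)
       ⊕ 𝓡 ∙ (∑[ m ∈ 0 ⋯ t ] χ* (s ∸ 1) m)))
  × (θ*[ 0 , t ]≐ recip l (p * q ^ t) ∙
       ( h ∙ (∑[ m ∈ 0 ⋯ t ] χ s m)
       ⊕ 𝓡 ∙ (∑[ m ∈ 0 ⋯ t ] χ (s ∸ 1) m)
       ⊕ 𝓝 ∙ (∑[ m ∈ 0 ⋯ t ] χ* (s ∸ 1) m))) )

  -- (ii)
  × (∀ j → j ≤ t ∸ 1 →
    (θ[ 0 , j ]≐ recip l (p * q ^ (j + 1)) ∙
       ( (h ℤ.* q-1) ∙ (∑[ m ∈ (t ∸ j) ⋯ t ] χ s m)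
       ⊕ q-1 ∙ ( 𝓝 ∙ (∑[ m ∈ (t ∸ j) ⋯ t ] χ (s ∸ 1) m)
               ⊕ 𝓡 ∙ (∑[ m ∈ (t ∸ j) ⋯ t ] χ* (s ∸ 1) m))
       ⊖ (𝓝 ∙ χ (s ∸ 1) (t ∸ j ∸ 1) ⊕ 𝓡 ∙ χ* (s ∸ 1) (t ∸ j ∸ 1))
       ⊖ h ∙ χ s (t ∸ j ∸ 1)))
  × (θ*[ 0 , j ]≐ recip l (p * q ^ (j + 1)) ∙
       ( (h ℤ.* q-1) ∙ (∑[ m ∈ (t ∸ j) ⋯ t ] χ s m)
       ⊕ q-1 ∙ ( 𝓡 ∙ (∑[ m ∈ (t ∸ j) ⋯ t ] χ (s ∸ 1) m)
               ⊕ 𝓝 ∙ (∑[ m ∈ (t ∸ j) ⋯ t ] χ* (s ∸ 1) m))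
       ⊖ (𝓡 ∙ χ (s ∸ 1) (t ∸ j ∸ 1) ⊕ 𝓝 ∙ χ* (s ∸ 1) (t ∸ j ∸ 1))
       ⊖ h ∙ χ s (t ∸ j ∸ 1))))

  -- (iii), with a misprint in the last summand corrected.  The source has
  -- only the term k = s − i of the sum over k and lacks χ_{s,t−j−1}; in that
  -- form the right-hand side is in general not even idempotent (for example
  -- p = 7, q = 11, l = 107, s = 2, t = 1, i = 1, j = 0).
  × (∀ i j → 1 ≤ i → i ≤ s ∸ 1 → j ≤ t ∸ 1 →
    (θ[ i , j ]≐ recip l (p ^ (i + 1) * q ^ (j + 1)) ∙
       ( (h ℤ.* q-1) ∙
           ( (∑[ k ∈ (s ∸ i) ⋯ (s ∸ 1) ] (∑[ m ∈ (t ∸ j) ⋯ t ] (χ k m ⊕ χ* k m)))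
           ⊕ (∑[ m ∈ (t ∸ j) ⋯ t ] χ s m))
       ⊕ q-1 ∙ ( 𝓝 ∙ (∑[ m ∈ (t ∸ j) ⋯ t ] χ (s ∸ i ∸ 1) m)
               ⊕ 𝓡 ∙ (∑[ m ∈ (t ∸ j) ⋯ t ] χ* (s ∸ i ∸ 1) m))
       ⊖ (𝓝 ∙ χ (s ∸ i ∸ 1) (t ∸ j ∸ 1) ⊕ 𝓡 ∙ χ* (s ∸ i ∸ 1) (t ∸ j ∸ 1))
       ⊖ h ∙ ( (∑[ k ∈ (s ∸ i) ⋯ (s ∸ 1) ] (χ k (t ∸ j ∸ 1) ⊕ χ* k (t ∸ j ∸ 1)))
             ⊕ χ s (t ∸ j ∸ 1))))
  × (θ*[ i , j ]≐ recip l (p ^ (i + 1) * q ^ (j + 1)) ∙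
       ( (h ℤ.* q-1) ∙
           ( (∑[ k ∈ (s ∸ i) ⋯ (s ∸ 1) ] (∑[ m ∈ (t ∸ j) ⋯ t ] (χ k m ⊕ χ* k m)))
           ⊕ (∑[ m ∈ (t ∸ j) ⋯ t ] χ s m))
       ⊕ q-1 ∙ ( 𝓡 ∙ (∑[ m ∈ (t ∸ j) ⋯ t ] χ (s ∸ i ∸ 1) m)
               ⊕ 𝓝 ∙ (∑[ m ∈ (t ∸ j) ⋯ t ] χ* (s ∸ i ∸ 1) m))
       ⊖ (𝓡 ∙ χ (s ∸ i ∸ 1) (t ∸ j ∸ 1) ⊕ 𝓝 ∙ χ* (s ∸ i ∸ 1) (t ∸ j ∸ 1))
       ⊖ h ∙ ( (∑[ k ∈ (s ∸ i) ⋯ (s ∸ 1) ] (χ k (t ∸ j ∸ 1) ⊕ χ* k (t ∸ j ∸ 1)))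
             ⊕ χ s (t ∸ j ∸ 1)))))

  -- (iv)
  × (∀ i → 1 ≤ i → i ≤ s ∸ 1 →
    (θ[ i , t ]≐ recip l (p ^ (i + 1) * q ^ t) ∙
       ( h ∙ (∑[ k ∈ (s ∸ i) ⋯ (s ∸ 1) ] (∑[ m ∈ 0 ⋯ t ] (χ k m ⊕ χ* k m)))
       ⊕ h ∙ (∑[ m ∈ 0 ⋯ t ] χ s m)
       ⊕ 𝓝 ∙ (∑[ m ∈ 0 ⋯ t ] χ (s ∸ i ∸ 1) m)
       ⊕ 𝓡 ∙ (∑[ m ∈ 0 ⋯ t ] χ* (s ∸ i ∸ 1) m)))
  × (θ*[ i , t ]≐ recip l (p ^ (i + 1) * q ^ t) ∙
       ( h ∙ (∑[ k ∈ (s ∸ i) ⋯ (s ∸ 1) ] (∑[ m ∈ 0 ⋯ t ] (χ k m ⊕ χ* k m)))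
       ⊕ h ∙ (∑[ m ∈ 0 ⋯ t ] χ s m)
       ⊕ 𝓡 ∙ (∑[ m ∈ 0 ⋯ t ] χ (s ∸ i ∸ 1) m)
       ⊕ 𝓝 ∙ (∑[ m ∈ 0 ⋯ t ] χ* (s ∸ i ∸ 1) m))))

  -- (v)
  × (∀ j → j ≤ t ∸ 1 →
    θ[ s , j ]≐ recip l (p ^ s * q ^ (j + 1)) ∙
       ( q-1 ∙
           ( (∑[ k ∈ 0 ⋯ (s ∸ 1) ] (∑[ m ∈ (t ∸ j) ⋯ t ] (χ k m ⊕ χ* k m)))
           ⊕ (∑[ m ∈ (t ∸ j) ⋯ t ] χ s m))
       ⊖ ( (∑[ k ∈ 0 ⋯ (s ∸ 1) ] (χ k (t ∸ j ∸ 1) ⊕ χ* k (t ∸ j ∸ 1)))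
         ⊕ χ s (t ∸ j ∸ 1))))

  -- (vi)
  × (θ[ s , t ]≐ recip l (p ^ s * q ^ t) ∙
       ( (∑[ k ∈ 0 ⋯ (s ∸ 1) ] (∑[ m ∈ 0 ⋯ t ] (χ k m ⊕ χ* k m)))
       ⊕ (∑[ m ∈ 0 ⋯ t ] χ s m)))
  × (recip l (p ^ s * q ^ t) ∙
       ( (∑[ k ∈ 0 ⋯ (s ∸ 1) ] (∑[ m ∈ 0 ⋯ t ] (χ k m ⊕ χ* k m)))
       ⊕ (∑[ m ∈ 0 ⋯ t ] χ s m))
     ≃ recip l (p ^ s * q ^ t) ∙ (∑[ u ∈ upTo (p ^ s * q ^ t) ] (X^ u)))
-- Matching on successors makes `s ∸ 1` and `t ∸ 1` compute, so the index equation for i = 0 holds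
-- by reflexivity.
theorem5p7 s@(suc s′) t@(suc t′) p q l 1≤s 1≤t p-prime q-prime l-prime p≢q p≢l q≢l p-odd q-odd p%4≡3
  l-order-p l-order-q gcd≡2 q-residue g g-order-p g-order-q K α α-primitive minimal 𝓡 𝓝 𝓡≈ 𝓝≈ =
  (case-i plus ≡.refl , case-i minus ≡.refl) ,
  (λ j j≤t′ → case-ii plus ≡.refl (suc-t∸j j≤t′) (j+m j≤t′) , case-ii minus ≡.refl (suc-t∸j j≤t′) (j+m j≤t′)) ,
  (λ i j _ i≤s′ j≤t′ →
    case-iii plus  (suc-s∸i i≤s′) (b+i i≤s′) (suc-t∸j j≤t′) (j+m j≤t′) ,
    case-iii minus (suc-s∸i i≤s′) (b+i i≤s′) (suc-t∸j j≤t′) (j+m j≤t′)) ,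
  (λ i _ i≤s′ → case-iv plus (suc-s∸i i≤s′) (b+i i≤s′) , case-iv minus (suc-s∸i i≤s′) (b+i i≤s′)) ,
  (λ j j≤t′ → case-v (suc-t∸j j≤t′) (j+m j≤t′)) ,
  case-vi ,
  everything≃all-powers
  where
  hypotheses : Hypotheses s t p q l g
  hypotheses = record
    { 1≤s = 1≤s ; 1≤t = 1≤t ; p-prime = p-prime ; q-prime = q-prime ; l-prime = l-prime
    ; p≢q = p≢q ; p≢l = p≢l ; q≢l = q≢l ; p-odd = p-odd ; p%4≡3 = p%4≡3
    ; l-order-p = l-order-p ; l-order-q = l-order-q ; gcd≡2 = gcd≡2 ; q-residue = q-residue
    ; g-order-p = g-order-p ; g-order-q = g-order-q }
  open CandidateEvaluation.Conclusion hypotheses K α α-primitive minimal 𝓡 𝓝 𝓡≈ 𝓝≈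
  -- The bound keeps the difference positive, so that subtracting 1 once more is a genuine
  -- predecessor.
  suc-∸ : ∀ {i n} → i ≤ n → suc n ∸ i ≡ suc (suc n ∸ i ∸ 1)
  suc-∸ {i} {n} i≤n = ≡.trans (ℕ.+-∸-assoc 1 i≤n) (≡.cong (λ k → suc (k ∸ 1)) (≡.sym (ℕ.+-∸-assoc 1 i≤n)))
  suc-s∸i : ∀ {i} → i ≤ s′ → s ∸ i ≡ suc (s ∸ i ∸ 1)
  suc-s∸i = suc-∸
  suc-t∸j : ∀ {j} → j ≤ t′ → t ∸ j ≡ suc (t ∸ j ∸ 1)
  suc-t∸j = suc-∸
  b+i : ∀ {i} → i ≤ s′ → (s ∸ i ∸ 1) + suc i ≡ s
  b+i {i} i≤s′ = ≡.trans (ℕ.+-suc (s ∸ i ∸ 1) i) (≡.trans (≡.cong (λ k → k + i) (≡.sym (suc-s∸i i≤s′))) (ℕ.m∸n+n≡m (ℕ.m≤n⇒m≤1+n i≤s′)))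
  j+m : ∀ {j} → j ≤ t′ → j + suc (t ∸ j ∸ 1) ≡ t
  j+m {j} j≤t′ = ≡.trans (≡.cong (λ k → j + k) (≡.sym (suc-t∸j j≤t′))) (ℕ.m+[n∸m]≡n (ℕ.m≤n⇒m≤1+n j≤t′))
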